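{- Let $G\le\mathrm{Sym}(n)$ be a Frobenius group with Frobenius complement $H$ and Frobenius kernel $K$ (so $G=KH$). Then the derangement graph $\Gamma_G$ is the disjoint union of $|H|$ copies of the complete graph $K_n$ on $n$ vertices.
   Context: A transitive permutation group $G\le\mathrm{Sym}(n)$ is a Frobenius group if no non-identity element fixes more than one point of $[n]$ and some non-identity element fixes a point. A Frobenius complement is a non-trivial proper subgroup $H$ with $H\cap g^{ -1}Hg=\{\mathrm{id}\}$ for all $g\in G\setminus H$ (e.g. a point-stabilizer); the Frobenius kernel is $K=\big(G\setminus\bigcup_{g\in G}g^{ -1}Hg\big)\cup\{\mathrm{id}\}$. The derangement graph $\Gamma_G$ of a permutation group $G$ is the Cayley graph with vertex set $G$ in which $g$ and $h$ are adjacent iff $gh^{ -1}$ has no fixed point in $[n]$. -}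

module Defs where

open import Data.Nat using (ℕ)
open import Data.Fin using (Fin)
open import Data.Fin.Properties using (any?)
open import Data.Vec using (Vec; lookup; tabulate)
open import Data.List using (List; length)
open import Data.List.Membership.Propositional using (_∈_; _∉_)
open import Data.List.Relation.Unary.Unique.Propositional using (Unique)
open import Data.Product using (Σ; ∃; ∃-syntax; _×_; _,_)
open import Relation.Nullary using (¬_; yes; no)
open import Relation.Binary.PropositionalEquality using (_≡_; _≢_)
open import Data.Fin using (_≟_)

-- A map [n] → [n], stored as the vector of its values (so that equality is ≡).
Map : ℕ → Set
Map n = Vec (Fin n) n

-- σ is an element of Sym(n) (a bijection; surjectivity suffices on a finite set).
IsPerm : ∀ {n} → Map n → Set
IsPerm {n} σ = ∀ (j : Fin n) → ∃[ i ] lookup σ i ≡ j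

idₚ : ∀ {n} → Map n
idₚ = tabulate (λ i → i)

_∘ₚ_ : ∀ {n} → Map n → Map n → Map n
σ ∘ₚ τ = tabulate (λ x → lookup σ (lookup τ x))

inv : ∀ {n} → Map n → Map n
inv {n} σ = tabulate pre
  where
  pre : Fin n → Fin n
  pre j with any? (λ i → lookup σ i ≟ j)
  ... | yes (i , _) = i
  ... | no _ = j

record IsPermGroup {n : ℕ} (G : List (Map n)) : Set where
  field
    perms   : ∀ g → g ∈ G → IsPerm g
    unique  : Unique G
    has-id  : idₚ ∈ G
    closed∘ : ∀ g h → g ∈ G → h ∈ G → (g ∘ₚ h) ∈ G
    closed⁻ : ∀ g → g ∈ G → inv g ∈ G

record IsSubgroup {n : ℕ} (H G : List (Map n)) : Set where
  field
    unique  : Unique H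
    sub     : ∀ h → h ∈ H → h ∈ G
    has-id  : idₚ ∈ H
    closed∘ : ∀ g h → g ∈ H → h ∈ H → (g ∘ₚ h) ∈ H
    closed⁻ : ∀ g → g ∈ H → inv g ∈ H

Transitive : ∀ {n} → List (Map n) → Set
Transitive {n} G = ∀ (x y : Fin n) → ∃[ g ] (g ∈ G × lookup g x ≡ y)

-- G is a Frobenius group (G assumed to be a permutation group on [n]).
record IsFrobenius {n : ℕ} (G : List (Map n)) : Set where
  field
    transitive : Transitive G
    atMostOne  : ∀ g → g ∈ G → g ≢ idₚ →
                 ∀ x y → lookup g x ≡ x → lookup g y ≡ y → x ≡ y
    someFixes  : ∃[ g ] (g ∈ G × g ≢ idₚ × ∃[ x ] lookup g x ≡ x)

record IsFrobeniusComplement {n : ℕ} (G H : List (Map n)) : Set where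
  field
    subgroup   : IsSubgroup H G
    nontrivial : ∃[ h ] (h ∈ H × h ≢ idₚ)
    proper     : ∃[ g ] (g ∈ G × g ∉ H)
    trivInt    : ∀ g → g ∈ G → g ∉ H →
                 ∀ y → y ∈ H → (∃[ h ] (h ∈ H × y ≡ (inv g ∘ₚ h) ∘ₚ g)) → y ≡ idₚ

Derangement : ∀ {n} → Map n → Set
Derangement {n} g = ∀ (x : Fin n) → lookup g x ≢ x

DerAdj : ∀ {n} → Map n → Map n → Set
DerAdj g h = Derangement (g ∘ₚ inv h)

CopiesAdj : ∀ {m n} → Fin m × Fin n → Fin m × Fin n → Set
CopiesAdj (i , a) (j , b) = i ≡ j × a ≢ b

{-# OPTIONS --safe #-}
module Submission where

-- The derangements of a Frobenius group G together with the identity form its kernel K, so once K is known to be a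
-- subgroup of order n, two elements are adjacent exactly when they are distinct and lie in the same coset of K. There
-- are ∣G∣ / n components, and what remains is ∣H∣ = ∣G∣ / n for every complement H.
--
-- K is a subgroup (Frobenius). Representations are taken over ℚ, as symmetric idempotent matrices commuting with the
-- group; each is a sum of primitive ones, and the characters of two primitive ones are equal or orthogonal. For a
-- nontrivial primitive w of H of degree d, put Θ = Ind w - d Ind 1 + d. By Frobenius reciprocity and malnormality Θ
-- extends χ w, is constant on K, and ⟨Θ,Θ⟩ = ⟨w,w⟩ =: e. If v runs over the primitive constituents of Θ with
-- coefficients c ∈ ℤ, then c ⟨v,v⟩ = ⟨Θ,v⟩ = z e with z ∈ ℤ too, because d and ⟨w,v⟩ on H are integral
-- multiples of e and ⟨1,v⟩ on H is an integer. Hence ∑ c z = 1 with c z ≥ 0, so Θ = χ v for one v. No splitting field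
-- is needed. Elements of K act trivially on all these v, hence so do their products.
--
-- ∣H∣ = ∣S∣ for malnormal subgroups H and S. Their kernels are comparable, say K ⊆ M. If K ≠ M, a Sylow subgroup R of
-- S normalises a Sylow subgroup Q of M for a prime dividing ∣M ∩ H∣, and Q normalises a Sylow subgroup P of K; the
-- latter is unique as Q acts freely on K, so R normalises P as well. Now Q ⋊ R, with R acting freely on Q, acts on the
-- centre of P with both factors acting freely, which is impossible.

-- A complement is an arbitrary malnormal subgroup, not given as a point stabiliser, so its order
-- has to be found from malnormality. Conjugacy of complements is never shown: once two kernels
-- coincide, the product formula `∣K∣ * ∣H∣ = ∣G∣` already gives equal orders.
--
-- The other obstacle is constructive. Primitivity of an idempotent quantifies over all idempotents
-- below it and is not decided, so a decomposition into primitives is available only under double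
-- negation. Whatever is drawn from one is either an equation in ℚ, which is decidable, or a
-- contradiction, so the double negation can be discharged. Working over ℚ gives this decidability
-- and also positivity of sums of squares, on which orthogonal projections and complements rest. The
-- price is that ⟨v,v⟩ need not be 1 for a primitive v; hence all multiplicities are counted in
-- units of such norms.

open import Data.Bool using (Bool; true; false; _∧_; not; if_then_else_)
open import Data.Fin as Fin using (Fin; zero; suc)
import Data.Fin.Properties as Finₚ
open import Data.Nat using (ℕ)
open import Data.Product using (Σ; ∃; _×_; _,_; proj₁; proj₂)
open import Data.Sum using (_⊎_; inj₁; inj₂)
open import Function using (_∘_)
open import Relation.Binary.PropositionalEquality
open import Relation.Nullary using (¬_; Dec; yes; no; does; ¬?; contradiction)
open import Relation.Nullary.Decidable using (dec-true; dec-false; _×-dec_; decidable-stable)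

-- The ordered field ℚ and the integers inside it.

module RationalField where

  open import Data.Nat using (zero; suc)
  open import Data.Integer as ℤ using (ℤ; -[1+_])
  import Data.Integer.Properties as ℤₚ
  import Data.Nat.Properties as ℕₚ
  import Data.Rational as ℚ
  import Data.Rational.Properties as ℚₚ
  import Data.Rational.Unnormalised as ℚᵘ
  import Data.Rational.Unnormalised.Properties as ℚᵘₚ
  open import Data.Maybe using (Maybe; just; nothing)
  open import Algebra.Bundles using (CommutativeRing)
  open import Algebra.Structures using (IsCommutativeRing)
  import Data.Nat.Coprimality as Cop
  import Algebra.Solver.Ring as RingSolver
  import Algebra.Solver.Ring.AlmostCommutativeRing as ACR

  infixl 6 _+_ _-_
  infixl 7 _*_
  infix 8 -_
  infix 4 _≤_ _<_ _≟_

  -- ℚ, kept abstract so that unification can treat the operations as injective.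
  abstract
    F : Set
    F = ℚ.ℚ

    0# 1# : F
    0# = ℚ.0ℚ
    1# = ℚ.1ℚ

    _+_ _*_ : F → F → F
    _+_ = ℚ._+_
    _*_ = ℚ._*_

    -_ : F → F
    -_ = ℚ.-_

    _≤_ _<_ : F → F → Set
    _≤_ = ℚ._≤_
    _<_ = ℚ._<_

    isCommutativeRing : IsCommutativeRing _≡_ _+_ _*_ -_ 0# 1#
    isCommutativeRing = ℚₚ.+-*-isCommutativeRing

    _≟_ : (p q : F) → Dec (p ≡ q)
    _≟_ = ℚₚ._≟_

    ≤-refl : ∀ {p} → p ≤ p
    ≤-refl = ℚₚ.≤-refl

    ≤-trans : ∀ {p q r} → p ≤ q → q ≤ r → p ≤ r
    ≤-trans = ℚₚ.≤-trans

    ≤-antisym : ∀ {p q} → p ≤ q → q ≤ p → p ≡ q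
    ≤-antisym = ℚₚ.≤-antisym

    ≤-total : ∀ p q → p ≤ q ⊎ q ≤ p
    ≤-total = ℚₚ.≤-total

    ≰⇒> : ∀ {p q} → ¬ p ≤ q → q < p
    ≰⇒> = ℚₚ.≰⇒>

    <⇒≤ : ∀ {p q} → p < q → p ≤ q
    <⇒≤ = ℚₚ.<⇒≤

    <⇒≱ : ∀ {p q} → p < q → ¬ q ≤ p
    <⇒≱ p<q q≤p = ℚₚ.<-irrefl refl (ℚₚ.<-≤-trans p<q q≤p)

    +-mono-≤ : ∀ {p q r s} → p ≤ q → r ≤ s → p + r ≤ q + s
    +-mono-≤ = ℚₚ.+-mono-≤

    0≤* : ∀ {p q} → 0# ≤ p → 0# ≤ q → 0# ≤ p * q
    0≤* {p} {q} a b = ℚₚ.nonNegative⁻¹ (p * q)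
      {{ℚₚ.nonNeg*nonNeg⇒nonNeg p {{ℚ.nonNegative a}} q {{ℚ.nonNegative b}}}}

    0≤sq : ∀ p → 0# ≤ p * p
    0≤sq p with ℚₚ.≤-total ℚ.0ℚ p
    ... | inj₁ h = 0≤* h h
    ... | inj₂ h = ℚₚ.nonNegative⁻¹ (p * p)
      {{ℚₚ.nonPos*nonPos⇒nonPos p {{ℚ.nonPositive h}} p {{ℚ.nonPositive h}}}}

    ≢0⇒inverse : ∀ {p} → p ≢ 0# → ∃ λ q → q * p ≡ 1#
    ≢0⇒inverse {p} h = (ℚ.1/ p) {{ℚ.≢-nonZero h}} , ℚₚ.*-inverseˡ p {{ℚ.≢-nonZero h}}

    0<1 : 0# < 1#
    0<1 = ℚₚ.positive⁻¹ ℚ.1ℚ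

    ι : ℤ → F
    ι z = ℚ.mkℚ z 0 (Cop.sym (Cop.1-coprimeTo ℤ.∣ z ∣))

    -- The numerator, not the floor; only its value on integers matters. It names a candidate
    -- integer in advance, so that integrality of `q` becomes the decidable equation `q ≡ ι ⌊ q ⌋`.
    ⌊_⌋ : F → ℤ
    ⌊ q ⌋ = ℚ.↥ q

    ⌊ι⌋ : ∀ z → ⌊ ι z ⌋ ≡ z
    ⌊ι⌋ z = refl

    ι-0 : ι (ℤ.+ 0) ≡ 0#
    ι-0 = refl

    ι-1 : ι (ℤ.+ 1) ≡ 1#
    ι-1 = refl

    ι-+ : ∀ a b → ι (a ℤ.+ b) ≡ ι a + ι b
    ι-+ a b = ℚₚ.toℚᵘ-injective (ℚᵘₚ.≃-trans
      (ℚᵘ.*≡* (cong₂ ℤ._*_ (sym (cong₂ ℤ._+_ (ℤₚ.*-identityʳ a) (ℤₚ.*-identityʳ b))) refl))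
      (ℚᵘₚ.≃-sym (ℚₚ.toℚᵘ-homo-+ (ι a) (ι b))))

    ι-* : ∀ a b → ι (a ℤ.* b) ≡ ι a * ι b
    ι-* a b = ℚₚ.toℚᵘ-injective (ℚᵘₚ.≃-trans (ℚᵘ.*≡* refl) (ℚᵘₚ.≃-sym (ℚₚ.toℚᵘ-homo-* (ι a) (ι b))))

    ι-neg : ∀ a → ι (ℤ.- a) ≡ - ι a
    ι-neg (ℤ.+ zero) = refl
    ι-neg (ℤ.+ suc n) = refl
    ι-neg -[1+ n ] = refl

    ι-0≤ : ∀ {a} → 0# ≤ ι a → ℤ.+ 0 ℤ.≤ a
    ι-0≤ {a} (ℚ.*≤* h) = subst (ℤ.+ 0 ℤ.≤_) (ℤₚ.*-identityʳ a) h

    -- Turns a rational trace into the natural number that bounds the recursion in `decompose`. The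
    -- absolute value of the numerator suffices, the denominator being at least 1.
    archimedean : ∀ q → ∃ λ k → q ≤ ι (ℤ.+ k)
    archimedean (ℚ.mkℚ n d _) = ℤ.∣ n ∣ , ℚ.*≤*
        (ℤₚ.≤-trans (subst (ℤ._≤ ℤ.+ ℤ.∣ n ∣) (sym (ℤₚ.*-identityʳ n)) (n≤∣n∣ n))
      (subst (ℤ.+ ℤ.∣ n ∣ ℤ.≤_) (ℤₚ.pos-* ℤ.∣ n ∣ (suc d)) (ℤ.+≤+ (ℕₚ.m≤m*n ℤ.∣ n ∣ (suc d)))))
      where
      n≤∣n∣ : ∀ n → n ℤ.≤ ℤ.+ ℤ.∣ n ∣
      n≤∣n∣ (ℤ.+ n) = ℤₚ.≤-refl
      n≤∣n∣ -[1+ n ] = ℤ.-≤+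

  ι-injective : ∀ {a b} → ι a ≡ ι b → a ≡ b
  ι-injective {a} {b} e = trans (sym (⌊ι⌋ a)) (trans (cong ⌊_⌋ e) (⌊ι⌋ b))

  _-_ : F → F → F
  p - q = p + - q

  commutativeRing : CommutativeRing _ _
  commutativeRing = record { isCommutativeRing = isCommutativeRing }

  open CommutativeRing commutativeRing public
    using (semiring; +-assoc; +-comm; +-identityˡ; +-identityʳ; -‿inverseˡ; -‿inverseʳ;
           *-assoc; *-comm; *-identityˡ; *-identityʳ; zeroˡ; zeroʳ; distribˡ; distribʳ)

  ι-≟ : ∀ a b → Maybe (ι a ≡ ι b)
  ι-≟ a b with a ℤ.≟ b
  ... | yes e = just (cong ι e)
  ... | no _ = nothing

  ι-homomorphism : CommutativeRing.rawRing ℤₚ.+-*-commutativeRing ACR.-Raw-AlmostCommutative⟶ ACR.fromCommutativeRing commutativeRing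
  ι-homomorphism = record { ⟦_⟧ = ι ; +-homo = ι-+ ; *-homo = ι-* ; -‿homo = ι-neg ; 0-homo = ι-0 ; 1-homo = ι-1 }

  open RingSolver (CommutativeRing.rawRing ℤₚ.+-*-commutativeRing)
      (ACR.fromCommutativeRing commutativeRing) ι-homomorphism ι-≟ public
    using (solve; _:+_; _:*_; _:-_; :-_; _:=_)

-- Finite sums over ℚ, positivity, and orthogonal projection of vectors.

module RationalSums where

  open import Data.Nat using (ℕ; zero; suc)
  open import Data.Fin.Permutation using (permutation)
  import Algebra.Properties.Semiring.Sum as Sum
  open RationalField

  private
    module S = Sum semiring
    variable n k : ℕ

  abstract
    ∑ : (Fin n → F) → F
    ∑ = S.sum

    ∑-cong : {f g : Fin n → F} → (∀ i → f i ≡ g i) → ∑ f ≡ ∑ g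
    ∑-cong = S.sum-cong-≗

    ∑-zero : (f : Fin 0 → F) → ∑ f ≡ 0#
    ∑-zero f = refl

    ∑-suc : (f : Fin (suc n) → F) → ∑ f ≡ f zero + ∑ (f ∘ suc)
    ∑-suc f = refl

    ∑-distrib-+ : (f g : Fin n → F) → ∑ (λ i → f i + g i) ≡ ∑ f + ∑ g
    ∑-distrib-+ = S.∑-distrib-+

    ∑-comm : (f : Fin n → Fin k → F) → ∑ (λ i → ∑ λ j → f i j) ≡ ∑ λ j → ∑ λ i → f i j
    ∑-comm = S.∑-comm

    *-distribˡ-∑ : ∀ x (f : Fin n → F) → x * ∑ f ≡ ∑ λ i → x * f i
    *-distribˡ-∑ = S.*-distribˡ-sum

    *-distribʳ-∑ : ∀ x (f : Fin n → F) → ∑ f * x ≡ ∑ λ i → f i * x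
    *-distribʳ-∑ = S.*-distribʳ-sum

    ∑-reindex : (f : Fin n → F) (φ ψ : Fin n → Fin n) →
                (∀ i → φ (ψ i) ≡ i) → (∀ i → ψ (φ i) ≡ i) → ∑ f ≡ ∑ (f ∘ φ)
    ∑-reindex f φ ψ φψ ψφ = S.sum-permute f (permutation φ ψ φψ ψφ)

  ∑-0 : {f : Fin n → F} → (∀ i → f i ≡ 0#) → ∑ f ≡ 0#
  ∑-0 {zero} h = ∑-zero _
  ∑-0 {suc n} h = trans (∑-suc _) (trans (cong₂ _+_ (h zero) (∑-0 (h ∘ suc))) (+-identityˡ 0#))

  ∑-sub : (f g : Fin n → F) → ∑ (λ i → f i - g i) ≡ ∑ f - ∑ g
  ∑-sub f g = trans (solve 2 (λ a b → a := a :+ b :- b) refl (∑ λ i → f i - g i) (∑ g))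
    (cong (_- ∑ g) (trans (sym (∑-distrib-+ (λ i → f i - g i) g))
      (∑-cong λ i → solve 2 (λ a b → a :- b :+ b := a) refl (f i) (g i))))

  ∑∑-* : (f : Fin n → F) (g : Fin k → F) → ∑ (λ i → ∑ λ j → f i * g j) ≡ ∑ f * ∑ g
  ∑∑-* f g = trans (∑-cong λ i → sym (*-distribˡ-∑ (f i) g)) (sym (*-distribʳ-∑ (∑ g) f))

  0≤+ : ∀ {p q} → 0# ≤ p → 0# ≤ q → 0# ≤ p + q
  0≤+ {p} {q} a b = subst (_≤ p + q) (+-identityˡ 0#) (+-mono-≤ a b)

  *-cancelˡ : ∀ {p q r} → p ≢ 0# → p * q ≡ p * r → q ≡ r
  *-cancelˡ {p} {q} {r} p≢0 h with ≢0⇒inverse p≢0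
  ... | s , sp = trans (undo q) (trans (cong (s *_) h) (sym (undo r)))
    where
    undo : ∀ t → t ≡ s * (p * t)
    undo t = trans (sym (*-identityˡ t)) (trans (cong (_* t) (sym sp)) (*-assoc s p t))

  *-integral : ∀ {p q} → p * q ≡ 0# → p ≢ 0# → q ≡ 0#
  *-integral {p} h p≢0 = *-cancelˡ p≢0 (trans h (sym (zeroʳ p)))

  sq≡0 : ∀ {p} → p * p ≡ 0# → p ≡ 0#
  sq≡0 {p} h with p ≟ 0#
  ... | yes e = e
  ... | no ne = *-integral h ne

  0≤∧≢0⇒0< : ∀ {p} → 0# ≤ p → p ≢ 0# → 0# < p
  0≤∧≢0⇒0< h ne = ≰⇒> λ p≤0 → ne (≤-antisym p≤0 h)

  0<⇒≢0 : ∀ {p} → 0# < p → p ≢ 0#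
  0<⇒≢0 h e = <⇒≱ h (subst (_≤ 0#) (sym e) ≤-refl)

  0<* : ∀ {p q} → 0# < p → 0# < q → 0# < p * q
  0<* a b = 0≤∧≢0⇒0< (0≤* (<⇒≤ a) (<⇒≤ b)) λ e → 0<⇒≢0 b (*-integral e (0<⇒≢0 a))

  ≤⇒0≤- : ∀ {p q} → p ≤ q → 0# ≤ q - p
  ≤⇒0≤- {p} {q} h = subst (_≤ q - p) (-‿inverseʳ p) (+-mono-≤ h ≤-refl)

  0≤-⇒≤ : ∀ {p q} → 0# ≤ q - p → p ≤ q
  0≤-⇒≤ {p} {q} h = subst₂ _≤_ (+-identityˡ p) (solve 2 (λ a b → a :- b :+ b := a) refl q p) (+-mono-≤ h (≤-refl {p}))

  -≡0⇒≡ : ∀ {p q} → p - q ≡ 0# → p ≡ q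
  -≡0⇒≡ {p} {q} h = trans (solve 2 (λ a b → a := a :- b :+ b) refl p q) (trans (cong (_+ q) h) (+-identityˡ q))

  +-nonneg-zero : ∀ {p q} → 0# ≤ p → 0# ≤ q → p + q ≡ 0# → p ≡ 0# × q ≡ 0#
  +-nonneg-zero {p} {q} a b e = p≡0 , trans (sym (+-identityˡ q)) (trans (cong (_+ q) (sym p≡0)) e)
    where
    p≡0 = ≤-antisym (subst₂ _≤_ (+-identityʳ p) e (+-mono-≤ (≤-refl {p}) b)) a

  ∑-nonneg : {f : Fin n → F} → (∀ i → 0# ≤ f i) → 0# ≤ ∑ f
  ∑-nonneg {zero} h = subst (0# ≤_) (sym (∑-zero _)) ≤-refl
  ∑-nonneg {suc n} h = subst (0# ≤_) (sym (∑-suc _)) (0≤+ (h zero) (∑-nonneg (h ∘ suc)))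

  ∑-nonneg-zero : {f : Fin n → F} → (∀ i → 0# ≤ f i) → ∑ f ≡ 0# → ∀ i → f i ≡ 0#
  ∑-nonneg-zero {suc n} {f} h e i = at i
    where
    parts = +-nonneg-zero (h zero) (∑-nonneg (h ∘ suc)) (trans (sym (∑-suc f)) e)
    at : ∀ i → f i ≡ 0#
    at zero = proj₁ parts
    at (suc i) = ∑-nonneg-zero (h ∘ suc) (proj₂ parts) i

  ∑-pos : {f : Fin n → F} → (∀ i → 0# ≤ f i) → ∀ i → f i ≢ 0# → 0# < ∑ f
  ∑-pos h i ne = 0≤∧≢0⇒0< (∑-nonneg h) λ e → ne (∑-nonneg-zero h e i)

  ∑-single : (f : Fin n → F) (j : Fin n) → (∀ i → i ≢ j → f i ≡ 0#) → ∑ f ≡ f j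
  ∑-single {suc n} f zero h =
    trans (∑-suc f) (trans (cong (f zero +_) (∑-0 (λ i → h (suc i) λ ()))) (+-identityʳ _))
  ∑-single {suc n} f (suc j) h = trans (∑-suc f)
    (trans (cong₂ _+_ (h zero λ ()) (∑-single (f ∘ suc) j λ i ne → h (suc i) λ { refl → ne refl })) (+-identityˡ _))

  -- Gram–Schmidt: ∑ⱼ c j z j is the orthogonal projection of v onto the span of z.
  project : ∀ {k} (z : Fin k → Fin n → F) (v : Fin n → F) →
            ∃ λ (c : Fin k → F) → ∀ i → ∑ (λ x → z i x * (v x - ∑ λ j → z j x * c j)) ≡ 0#
  project {k = zero} z v = (λ ()) , λ ()
  project {n = n} {k = suc k} z v = c , orth
    where
    zs = z ∘ suc
    c₁ = proj₁ (project zs v)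
    c₂ = proj₁ (project zs (z zero))
    r t : Fin n → F
    r x = v x - ∑ λ j → zs j x * c₁ j
    t x = z zero x - ∑ λ j → zs j x * c₂ j
    r⊥ : ∀ i → ∑ (λ x → zs i x * r x) ≡ 0#
    r⊥ = proj₂ (project zs v)
    t⊥ : ∀ i → ∑ (λ x → zs i x * t x) ≡ 0#
    t⊥ = proj₂ (project zs (z zero))
    tt = ∑ λ x → t x * t x
    tr = ∑ λ x → t x * r x
    -- `r` and `t` are the residuals of `v` and `z zero` against `zs`. The vectors may be dependent,
    -- so `t` may vanish; by positivity `tt ≡ 0#` implies that, then `tr` is 0 too and the
    -- coefficient 0 serves.
    coefficient : ∃ λ a → tr ≡ a * tt
    coefficient with tt ≟ 0#
    ... | yes e = 0# , trans (∑-0 λ x → trans (cong (_* r x) (sq≡0 (∑-nonneg-zero (λ y → 0≤sq (t y)) e x))) (zeroˡ _))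
                             (sym (zeroˡ tt))
    ... | no ne = let s , st = ≢0⇒inverse ne in
      tr * s , sym (trans (*-assoc tr s tt) (trans (cong (tr *_) st) (*-identityʳ tr)))
    a = proj₁ coefficient
    c : Fin (suc k) → F
    c zero = a
    c (suc j) = c₁ j - a * c₂ j
    residual : ∀ x → v x - ∑ (λ j → z j x * c j) ≡ r x - a * t x
    residual x = begin
      v x - ∑ (λ j → z j x * c j)
        ≡⟨ cong (λ h → v x - h) (∑-suc _) ⟩
      v x - (z zero x * a + ∑ (λ j → zs j x * (c₁ j - a * c₂ j)))
        ≡⟨ cong (λ h → v x - (z zero x * a + h)) inner ⟩
      v x - (z zero x * a + (s₁ - a * s₂))
        ≡⟨ solve 5 (λ v z a s₁ s₂ → v :- (z :* a :+ (s₁ :- a :* s₂)) := (v :- s₁) :- a :* (z :- s₂)) refl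
             (v x) (z zero x) a s₁ s₂ ⟩
      r x - a * t x ∎
      where
      open ≡-Reasoning
      s₁ = ∑ λ j → zs j x * c₁ j
      s₂ = ∑ λ j → zs j x * c₂ j
      inner : ∑ (λ j → zs j x * (c₁ j - a * c₂ j)) ≡ s₁ - a * s₂
      inner = trans (∑-cong λ j → solve 4 (λ z c a d → z :* (c :- a :* d) := z :* c :- a :* (z :* d)) refl (zs j x)
          (c₁ j) a (c₂ j))
                (trans (∑-sub (λ j → zs j x * c₁ j) _) (cong (λ h → s₁ - h) (sym (*-distribˡ-∑ a _))))
    combine : ∀ (f : Fin n → F) → ∑ (λ x → f x * (r x - a * t x)) ≡ ∑ (λ x → f x * r x) - a * ∑ (λ x → f x * t x)
    combine f = trans (∑-cong λ x → solve 4 (λ z c a d → z :* (c :- a :* d) := z :* c :- a :* (z :* d)) refl (f x)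
        (r x) a (t x))
      (trans (∑-sub (λ x → f x * r x) _) (cong (λ h → ∑ (λ x → f x * r x) - h) (sym (*-distribˡ-∑ a _))))
    zs⊥ : ∀ i → ∑ (λ x → zs i x * (r x - a * t x)) ≡ 0#
    zs⊥ i = trans (combine (zs i)) (trans (cong₂ (λ p q → p - a * q) (r⊥ i) (t⊥ i))
      (trans (cong (λ h → 0# - h) (zeroʳ a)) (-‿inverseʳ 0#)))
    orth : ∀ i → ∑ (λ x → z i x * (v x - ∑ λ j → z j x * c j)) ≡ 0#
    orth (suc i) = trans (∑-cong λ x → cong (z (suc i) x *_) (residual x)) (zs⊥ i)
    orth zero = begin
      ∑ (λ x → z zero x * (v x - ∑ λ j → z j x * c j))
        ≡⟨ ∑-cong (λ x → trans (cong (z zero x *_) (residual x)) (split x)) ⟩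
      ∑ (λ x → t x * (r x - a * t x) + ∑ λ j → c₂ j * (zs j x * (r x - a * t x)))
        ≡⟨ ∑-distrib-+ (λ x → t x * (r x - a * t x)) _ ⟩
      ∑ (λ x → t x * (r x - a * t x)) + ∑ (λ x → ∑ λ j → c₂ j * (zs j x * (r x - a * t x)))
        ≡⟨ cong₂ _+_ (combine t) (∑-comm _) ⟩
      (tr - a * tt) + ∑ (λ j → ∑ λ x → c₂ j * (zs j x * (r x - a * t x)))
        ≡⟨ cong₂ _+_ (cong (_- a * tt) (proj₂ coefficient))
             (∑-0 λ j → trans (sym (*-distribˡ-∑ (c₂ j) _)) (trans (cong (c₂ j *_) (zs⊥ j)) (zeroʳ _))) ⟩
      (a * tt - a * tt) + 0#
        ≡⟨ trans (+-identityʳ _) (-‿inverseʳ _) ⟩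
      0# ∎
      where
      open ≡-Reasoning
      -- `z zero` is `t` plus a combination of `zs`, and the new residual is already orthogonal to
      -- `zs`.
      split : ∀ x → z zero x * (r x - a * t x) ≡ t x * (r x - a * t x) + ∑ λ j → c₂ j * (zs j x * (r x - a * t x))
      split x = trans (solve 3 (λ z s y → z :* y := (z :- s) :* y :+ s :* y) refl (z zero x) s y)
        (cong (t x * y +_) (trans (*-distribʳ-∑ y _)
            (∑-cong λ j → solve 3 (λ z c y → z :* c :* y := c :* (z :* y)) refl (zs j x) (c₂ j) y)))
        where
        y = r x - a * t x
        s = ∑ λ j → zs j x * c₂ j

-- Finite groups on `Fin m`, Boolean subsets, and a solver for group identities.

module FiniteGroups where

  open import Data.Bool.Properties using () renaming (_≟_ to _≟ᵇ_)
  open import Data.Nat using (ℕ; suc)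
  open import Data.List using (List; []; _∷_)
  open import Data.Vec using (Vec; lookup; []; _∷_)

  Sub : ℕ → Set
  Sub m = Fin m → Bool

  infix 4 _∈_ _∉_ _⊆_

  _∈_ _∉_ : ∀ {m} → Fin m → Sub m → Set
  x ∈ P = P x ≡ true
  x ∉ P = ¬ x ∈ P

  _⊆_ : ∀ {m} → Sub m → Sub m → Set
  P ⊆ Q = ∀ x → x ∈ P → x ∈ Q

  _∈?_ : ∀ {m} (x : Fin m) (P : Sub m) → Dec (x ∈ P)
  x ∈? P = P x ≟ᵇ true

  ∉⇒false : ∀ {m} {x : Fin m} (P : Sub m) → x ∉ P → P x ≡ false
  ∉⇒false {x = x} P h with P x
  ... | true = contradiction refl h
  ... | false = refl

  does-sound : ∀ {A : Set} (d : Dec A) → does d ≡ true → A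
  does-sound (yes a) _ = a

  record FinGroup (m : ℕ) : Set where
    infixl 7 _∙_
    infix 8 _⁻¹
    field
      _∙_ : Fin m → Fin m → Fin m
      ε : Fin m
      _⁻¹ : Fin m → Fin m
      assoc : ∀ x y z → (x ∙ y) ∙ z ≡ x ∙ (y ∙ z)
      identityˡ : ∀ x → ε ∙ x ≡ x
      identityʳ : ∀ x → x ∙ ε ≡ x
      inverseˡ : ∀ x → x ⁻¹ ∙ x ≡ ε
      inverseʳ : ∀ x → x ∙ x ⁻¹ ≡ ε

    x⁻¹∙xy : ∀ x y → x ⁻¹ ∙ (x ∙ y) ≡ y
    x⁻¹∙xy x y = trans (sym (assoc _ _ _)) (trans (cong (_∙ y) (inverseˡ x)) (identityˡ y))

    x∙x⁻¹y : ∀ x y → x ∙ (x ⁻¹ ∙ y) ≡ y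
    x∙x⁻¹y x y = trans (sym (assoc _ _ _)) (trans (cong (_∙ y) (inverseʳ x)) (identityˡ y))

    ∙-cancelˡ : ∀ x {y z} → x ∙ y ≡ x ∙ z → y ≡ z
    ∙-cancelˡ x {y} {z} e = trans (sym (x⁻¹∙xy x y)) (trans (cong (x ⁻¹ ∙_) e) (x⁻¹∙xy x z))

    inverse-unique : ∀ x y → x ∙ y ≡ ε → y ≡ x ⁻¹
    inverse-unique x y e = ∙-cancelˡ x (trans e (sym (inverseʳ x)))

    ⁻¹-involutive : ∀ x → x ⁻¹ ⁻¹ ≡ x
    ⁻¹-involutive x = sym (inverse-unique (x ⁻¹) x (inverseˡ x))

    ⁻¹-∙ : ∀ x y → (x ∙ y) ⁻¹ ≡ y ⁻¹ ∙ x ⁻¹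
    ⁻¹-∙ x y = sym (inverse-unique (x ∙ y) _
      (trans (assoc x y _) (trans (cong (x ∙_) (x∙x⁻¹y y _)) (inverseʳ x))))

    ε⁻¹ : ε ⁻¹ ≡ ε
    ε⁻¹ = sym (inverse-unique ε ε (identityˡ ε))

    infixl 7 _:∙_
    infix 8 _:⁻¹

    -- Identities valid in all groups are proved by reflection: both sides become words in the free
    -- group, adjacent inverse literals being cancelled, and `refl` compares the words. The Boolean
    -- in a literal is its sign.
    data Expr (n : ℕ) : Set where
      var : Fin n → Expr n
      :ε : Expr n
      _:∙_ : Expr n → Expr n → Expr n
      _:⁻¹ : Expr n → Expr n

    ⟦_⟧ : ∀ {n} → Expr n → Vec (Fin m) n → Fin m
    ⟦ var i ⟧ ρ = lookup ρ i
    ⟦ :ε ⟧ ρ = ε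
    ⟦ a :∙ b ⟧ ρ = ⟦ a ⟧ ρ ∙ ⟦ b ⟧ ρ
    ⟦ a :⁻¹ ⟧ ρ = ⟦ a ⟧ ρ ⁻¹

    Word : ℕ → Set
    Word n = List (Bool × Fin n)

    literal : ∀ {n} → Vec (Fin m) n → Bool × Fin n → Fin m
    literal ρ (true , i) = lookup ρ i
    literal ρ (false , i) = lookup ρ i ⁻¹

    ⟦_⟧ʷ : ∀ {n} → Word n → Vec (Fin m) n → Fin m
    ⟦ [] ⟧ʷ ρ = ε
    ⟦ l ∷ w ⟧ʷ ρ = literal ρ l ∙ ⟦ w ⟧ʷ ρ

    push : ∀ {n} → Bool × Fin n → Word n → Word n
    push l [] = l ∷ []
    push (b , i) ((c , j) ∷ w) with i Fin.≟ j | b ≟ᵇ not c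
    ... | yes _ | yes _ = w
    ... | yes _ | no _ = (b , i) ∷ (c , j) ∷ w
    ... | no _ | _ = (b , i) ∷ (c , j) ∷ w

    push-correct : ∀ {n} (ρ : Vec (Fin m) n) l w → ⟦ push l w ⟧ʷ ρ ≡ literal ρ l ∙ ⟦ w ⟧ʷ ρ
    push-correct ρ l [] = refl
    push-correct ρ (b , i) ((c , j) ∷ w) with i Fin.≟ j | b ≟ᵇ not c
    push-correct ρ (.false , i) ((true , .i) ∷ w) | yes refl | yes refl = sym (x⁻¹∙xy _ _)
    push-correct ρ (.true , i) ((false , .i) ∷ w) | yes refl | yes refl = sym (x∙x⁻¹y _ _)
    ... | yes _ | no _ = refl
    ... | no _ | _ = refl

    signed : Bool → Fin m → Fin m
    signed true x = x
    signed false x = x ⁻¹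

    normalise : ∀ {n} → Bool → Expr n → Word n → Word n
    normalise s (var i) w = push (s , i) w
    normalise s :ε w = w
    normalise true (a :∙ b) w = normalise true a (normalise true b w)
    normalise false (a :∙ b) w = normalise false b (normalise false a w)
    normalise s (a :⁻¹) w = normalise (not s) a w

    normalise-correct : ∀ {n} (ρ : Vec (Fin m) n) s e w →
                        ⟦ normalise s e w ⟧ʷ ρ ≡ signed s (⟦ e ⟧ ρ) ∙ ⟦ w ⟧ʷ ρ
    normalise-correct ρ true (var i) w = push-correct ρ (true , i) w
    normalise-correct ρ false (var i) w = push-correct ρ (false , i) w
    normalise-correct ρ true :ε w = sym (identityˡ _)
    normalise-correct ρ false :ε w = sym (trans (cong (_∙ ⟦ w ⟧ʷ ρ) ε⁻¹) (identityˡ _))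
    normalise-correct ρ true (a :∙ b) w = trans (normalise-correct ρ true a _)
      (trans (cong (⟦ a ⟧ ρ ∙_) (normalise-correct ρ true b w)) (sym (assoc _ _ _)))
    normalise-correct ρ false (a :∙ b) w = trans (normalise-correct ρ false b _)
      (trans (cong (⟦ b ⟧ ρ ⁻¹ ∙_) (normalise-correct ρ false a w))
        (trans (sym (assoc _ _ _)) (cong (_∙ ⟦ w ⟧ʷ ρ) (sym (⁻¹-∙ _ _)))))
    normalise-correct ρ true (a :⁻¹) w = normalise-correct ρ false a w
    normalise-correct ρ false (a :⁻¹) w =
      trans (normalise-correct ρ true a w) (cong (_∙ ⟦ w ⟧ʷ ρ) (sym (⁻¹-involutive _)))

    solveᴳ : ∀ {n} (ρ : Vec (Fin m) n) (e₁ e₂ : Expr n) →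
             normalise true e₁ [] ≡ normalise true e₂ [] → ⟦ e₁ ⟧ ρ ≡ ⟦ e₂ ⟧ ρ
    solveᴳ ρ e₁ e₂ h = trans (sym (identityʳ _)) (trans (sym (normalise-correct ρ true e₁ []))
      (trans (cong (λ w → ⟦ w ⟧ʷ ρ) h) (trans (normalise-correct ρ true e₂ []) (identityʳ _))))

    a₀ : ∀ {n} → Expr (suc n)
    a₀ = var zero
    a₁ : ∀ {n} → Expr (suc (suc n))
    a₁ = var (suc zero)
    a₂ : ∀ {n} → Expr (suc (suc (suc n)))
    a₂ = var (suc (suc zero))
    a₃ : ∀ {n} → Expr (suc (suc (suc (suc n))))
    a₃ = var (suc (suc (suc zero)))

    record IsSub (P : Sub m) : Set where
      field
        ε∈ : ε ∈ P
        ∙∈ : ∀ {x y} → x ∈ P → y ∈ P → x ∙ y ∈ P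
        ⁻¹∈ : ∀ {x} → x ∈ P → x ⁻¹ ∈ P

    full : Sub m
    full _ = true

    full-isSub : IsSub full
    full-isSub = record { ε∈ = refl ; ∙∈ = λ _ _ → refl ; ⁻¹∈ = λ _ → refl }

    _^_ : Fin m → Fin m → Fin m
    x ^ g = g ⁻¹ ∙ x ∙ g

    Malnormal : Sub m → Set
    Malnormal H = ∀ g h → g ∉ H → h ∈ H → h ^ g ∈ H → h ≡ ε

    infix 4 _∈ᴷ_
    _∈ᴷ_ : Fin m → Sub m → Set
    x ∈ᴷ H = x ≡ ε ⊎ (∀ g → x ^ g ∉ H)

    kernel? : ∀ H x → Dec (x ∈ᴷ H)
    kernel? H x with x Fin.≟ ε
    ... | yes e = yes (inj₁ e)
    ... | no ne with Finₚ.any? (λ g → (x ^ g) ∈? H)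
    ...   | yes (g , h) = no λ { (inj₁ e) → ne e ; (inj₂ k) → k g h }
    ...   | no h = yes (inj₂ λ g k → h (g , k))

    kernel : Sub m → Sub m
    kernel H x = does (kernel? H x)

open FiniteGroups

-- Square rational matrices and projections onto column spaces.

module Matrices where

  open import Data.Vec using (Vec; lookup; tabulate)
  open import Data.Vec.Properties using (lookup∘tabulate; tabulate∘lookup; tabulate-cong; ≡-dec)
  open RationalField
  open RationalSums

  infix 4 _≟ᴹ_

  abstract
    -- Vectors rather than functions, so that extensional equality is ≡.
    Mat : ℕ → Set
    Mat m = Vec (Vec F m) m

    infix 9 _⟨_,_⟩
    _⟨_,_⟩ : ∀ {m} → Mat m → Fin m → Fin m → F
    a ⟨ i , j ⟩ = lookup (lookup a i) j

    mat : ∀ {m} → (Fin m → Fin m → F) → Mat m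
    mat f = tabulate λ i → tabulate (f i)

    mat-entry : ∀ {m} (f : Fin m → Fin m → F) i j → mat f ⟨ i , j ⟩ ≡ f i j
    mat-entry f i j = trans (cong (λ r → lookup r j) (lookup∘tabulate (λ i → tabulate (f i)) i))
        (lookup∘tabulate (f i) j)

    ext : ∀ {m} {a b : Mat m} → (∀ i j → a ⟨ i , j ⟩ ≡ b ⟨ i , j ⟩) → a ≡ b
    ext {a = a} {b} h = trans (sym (tabulate∘lookup a)) (trans (tabulate-cong λ i →
      trans (sym (tabulate∘lookup (lookup a i))) (trans (tabulate-cong (h i)) (tabulate∘lookup (lookup b i))))
      (tabulate∘lookup b))

    _≟ᴹ_ : ∀ {m} (a b : Mat m) → Dec (a ≡ b)
    _≟ᴹ_ = ≡-dec (≡-dec _≟_)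

  module _ {m : ℕ} where
    infixl 7 _·_
    infixl 6 _⊖_
    infix 8 _ᵀ

    𝟘 : Mat m
    𝟘 = mat λ _ _ → 0#

    _·_ _⊖_ : Mat m → Mat m → Mat m
    a · b = mat λ i j → ∑ λ k → a ⟨ i , k ⟩ * b ⟨ k , j ⟩
    a ⊖ b = mat λ i j → a ⟨ i , j ⟩ - b ⟨ i , j ⟩

    _ᵀ : Mat m → Mat m
    a ᵀ = mat λ i j → a ⟨ j , i ⟩

    trace : Mat m → F
    trace a = ∑ λ i → a ⟨ i , i ⟩

    ·-entry : ∀ (a b : Mat m) i j → (a · b) ⟨ i , j ⟩ ≡ ∑ λ k → a ⟨ i , k ⟩ * b ⟨ k , j ⟩
    ·-entry a b = mat-entry _

    ⊖-entry : ∀ (a b : Mat m) i j → (a ⊖ b) ⟨ i , j ⟩ ≡ a ⟨ i , j ⟩ - b ⟨ i , j ⟩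
    ⊖-entry a b = mat-entry _

    ᵀ-entry : ∀ (a : Mat m) i j → (a ᵀ) ⟨ i , j ⟩ ≡ a ⟨ j , i ⟩
    ᵀ-entry a = mat-entry _

    𝟘-entry : ∀ i j → 𝟘 ⟨ i , j ⟩ ≡ 0#
    𝟘-entry = mat-entry _

    ·-assoc : ∀ (a b c : Mat m) → (a · b) · c ≡ a · (b · c)
    ·-assoc a b c = ext λ i j → begin
      ((a · b) · c) ⟨ i , j ⟩
        ≡⟨ ·-entry (a · b) c i j ⟩
      ∑ (λ k → (a · b) ⟨ i , k ⟩ * c ⟨ k , j ⟩)
        ≡⟨ ∑-cong (λ k → trans (cong (_* c ⟨ k , j ⟩) (·-entry a b i k)) (*-distribʳ-∑ _ _)) ⟩
      ∑ (λ k → ∑ λ l → a ⟨ i , l ⟩ * b ⟨ l , k ⟩ * c ⟨ k , j ⟩)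
        ≡⟨ ∑-comm _ ⟩
      ∑ (λ l → ∑ λ k → a ⟨ i , l ⟩ * b ⟨ l , k ⟩ * c ⟨ k , j ⟩)
        ≡⟨ ∑-cong (λ l → trans (∑-cong λ k → *-assoc _ _ _)
             (trans (sym (*-distribˡ-∑ _ _)) (cong (a ⟨ i , l ⟩ *_) (sym (·-entry b c l j))))) ⟩
      ∑ (λ l → a ⟨ i , l ⟩ * (b · c) ⟨ l , j ⟩)
        ≡⟨ sym (·-entry a (b · c) i j) ⟩
      (a · (b · c)) ⟨ i , j ⟩ ∎
      where open ≡-Reasoning

    ᵀ-· : ∀ (a b : Mat m) → (a · b) ᵀ ≡ b ᵀ · a ᵀ
    ᵀ-· a b = ext λ i j → trans (ᵀ-entry _ i j) (trans (·-entry a b j i)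
      (trans (∑-cong λ k → trans (*-comm _ _) (sym (cong₂ _*_ (ᵀ-entry b i k) (ᵀ-entry a k j))))
        (sym (·-entry (b ᵀ) (a ᵀ) i j))))

    ᵀᵀ : ∀ (a : Mat m) → a ᵀ ᵀ ≡ a
    ᵀᵀ a = ext λ i j → trans (ᵀ-entry _ i j) (ᵀ-entry a j i)

    ᵀ-⊖ : ∀ (a b : Mat m) → (a ⊖ b) ᵀ ≡ a ᵀ ⊖ b ᵀ
    ᵀ-⊖ a b = ext λ i j → trans (ᵀ-entry _ i j) (trans (⊖-entry a b j i)
      (sym (trans (⊖-entry (a ᵀ) (b ᵀ) i j) (cong₂ _-_ (ᵀ-entry a i j) (ᵀ-entry b i j)))))

    ·-distribˡ-⊖ : ∀ (a b c : Mat m) → a · (b ⊖ c) ≡ a · b ⊖ a · c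
    ·-distribˡ-⊖ a b c = ext λ i j → trans (·-entry a _ i j)
      (trans (∑-cong λ k → trans (cong (a ⟨ i , k ⟩ *_) (⊖-entry b c k j))
                (solve 3 (λ x y z → x :* (y :- z) := x :* y :- x :* z) refl (a ⟨ i , k ⟩) (b ⟨ k , j ⟩)
                    (c ⟨ k , j ⟩)))
        (trans (∑-sub _ _) (sym (trans (⊖-entry _ _ i j) (cong₂ _-_ (·-entry a b i j) (·-entry a c i j))))))

    ·-distribʳ-⊖ : ∀ (a b c : Mat m) → (b ⊖ c) · a ≡ b · a ⊖ c · a
    ·-distribʳ-⊖ a b c = ext λ i j → trans (·-entry _ a i j)
      (trans (∑-cong λ k → trans (cong (_* a ⟨ k , j ⟩) (⊖-entry b c i k))
                (solve 3 (λ x y z → (y :- z) :* x := y :* x :- z :* x) refl (a ⟨ k , j ⟩) (b ⟨ i , k ⟩)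
                    (c ⟨ i , k ⟩)))
        (trans (∑-sub _ _) (sym (trans (⊖-entry _ _ i j) (cong₂ _-_ (·-entry b a i j) (·-entry c a i j))))))

    ⊖-self : ∀ (a : Mat m) → a ⊖ a ≡ 𝟘
    ⊖-self a = ext λ i j → trans (⊖-entry a a i j) (trans (-‿inverseʳ _) (sym (𝟘-entry i j)))

    ⊖≡𝟘⇒≡ : ∀ {a b : Mat m} → a ⊖ b ≡ 𝟘 → a ≡ b
    ⊖≡𝟘⇒≡ {a} {b} h = ext λ i j → -≡0⇒≡ (trans (sym (⊖-entry a b i j)) (trans (cong (_⟨ i , j ⟩) h) (𝟘-entry i j)))

    ·-𝟘ˡ : ∀ (a : Mat m) → 𝟘 · a ≡ 𝟘
    ·-𝟘ˡ a = ext λ i j → trans (·-entry 𝟘 a i j)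
      (trans (∑-0 λ k → trans (cong (_* a ⟨ k , j ⟩) (𝟘-entry i k)) (zeroˡ _)) (sym (𝟘-entry i j)))

    trace-⊖ : ∀ (a b : Mat m) → trace (a ⊖ b) ≡ trace a - trace b
    trace-⊖ a b = trans (∑-cong λ i → ⊖-entry a b i i) (∑-sub _ _)

    trace-sq : ∀ (a : Mat m) → trace (a · a ᵀ) ≡ ∑ λ i → ∑ λ j → a ⟨ i , j ⟩ * a ⟨ i , j ⟩
    trace-sq a = ∑-cong λ i → trans (·-entry a (a ᵀ) i i) (∑-cong λ j → cong (a ⟨ i , j ⟩ *_) (ᵀ-entry a j i))

    ∑sq≡0⇒𝟘 : ∀ (a : Mat m) → ∑ (λ i → ∑ λ j → a ⟨ i , j ⟩ * a ⟨ i , j ⟩) ≡ 0# → a ≡ 𝟘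
    ∑sq≡0⇒𝟘 a h = ext λ i j → trans (sq≡0 (∑-nonneg-zero (λ j → 0≤sq _)
      (∑-nonneg-zero (λ i → ∑-nonneg λ j → 0≤sq _) h i) j)) (sym (𝟘-entry i j))

    -- The fields pin down the orthogonal projection onto the column space of `z`: `P≡zY` keeps its
    -- range inside that space and `fixes` makes it all of it.
    record Projection (z : Mat m) : Set where
      field
        P Y : Mat m
        P≡zY : P ≡ z · Y
        symmetric : P ᵀ ≡ P
        idempotent : P · P ≡ P
        fixes : P · z ≡ z

    gram-schmidt : ∀ z → Projection z
    gram-schmidt z = record
      { P = P ; Y = Y ; P≡zY = refl
      ; symmetric = symmetric
      ; idempotent = trans (cong (_· P) (sym symmetric)) (trans (sym Pᵀ≡PᵀP) symmetric)
      ; fixes = trans (cong (_· z) (sym symmetric)) (trans (cong (P ᵀ ·_) (sym (ᵀᵀ z)))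
                  (trans (sym (ᵀ-· (z ᵀ) P)) (trans (cong _ᵀ zᵀP≡zᵀ) (ᵀᵀ z)))) }
      where
      δ : Fin m → Fin m → F
      δ i j with i Fin.≟ j
      ... | yes _ = 1#
      ... | no _ = 0#
      δ-refl : ∀ i → δ i i ≡ 1#
      δ-refl i with i Fin.≟ i
      ... | yes _ = refl
      ... | no ne = contradiction refl ne
      δ-≢ : ∀ {i j} → i ≢ j → δ i j ≡ 0#
      δ-≢ {i} {j} ne with i Fin.≟ j
      ... | yes e = contradiction e ne
      ... | no _ = refl
      columns : ∀ j → _
      columns j = project (λ i x → z ⟨ x , i ⟩) (δ j)
      Y = mat λ k j → proj₁ (columns j) k
      P = z · Y
      -- The normal equations: `δ j` minus its projection, the `j`-th column of `P`, is orthogonal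
      -- to every column of `z`.
      zᵀP≡zᵀ : z ᵀ · P ≡ z ᵀ
      zᵀP≡zᵀ = ext λ i j → begin
        (z ᵀ · P) ⟨ i , j ⟩
          ≡⟨ trans (·-entry (z ᵀ) P i j) (∑-cong λ x → cong (_* P ⟨ x , j ⟩) (ᵀ-entry z i x)) ⟩
        ∑ (λ x → z ⟨ x , i ⟩ * P ⟨ x , j ⟩)
          ≡⟨ sym (-≡0⇒≡ (trans (sym (∑-sub _ _)) (trans (∑-cong λ x →
               trans (solve 3 (λ a b c → a :* b :- a :* c := a :* (b :- c)) refl (z ⟨ x , i ⟩) (δ j x) (P ⟨ x , j ⟩))
                 (cong (λ h → z ⟨ x , i ⟩ * (δ j x - h)) (trans (·-entry z Y x j)
                   (∑-cong λ k → cong (z ⟨ x , k ⟩ *_) (mat-entry _ k j)))))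
               (proj₂ (columns j) i)))) ⟩
        ∑ (λ x → z ⟨ x , i ⟩ * δ j x)
          ≡⟨ ∑-single _ j (λ x ne → trans (cong (z ⟨ x , i ⟩ *_) (δ-≢ (ne ∘ sym))) (zeroʳ _)) ⟩
        z ⟨ j , i ⟩ * δ j j
          ≡⟨ trans (cong (z ⟨ j , i ⟩ *_) (δ-refl j)) (*-identityʳ _) ⟩
        z ⟨ j , i ⟩
          ≡⟨ sym (ᵀ-entry z i j) ⟩
        (z ᵀ) ⟨ i , j ⟩ ∎
        where open ≡-Reasoning
      -- Follows from `P = z · Y` and the normal equations. The right-hand side is symmetric, hence
      -- so is `P`, and then this same equation is idempotence.
      Pᵀ≡PᵀP : P ᵀ ≡ P ᵀ · P
      Pᵀ≡PᵀP = trans (ᵀ-· z Y) (trans (cong (Y ᵀ ·_) (sym zᵀP≡zᵀ))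
        (trans (sym (·-assoc (Y ᵀ) (z ᵀ) P)) (cong (_· P) (sym (ᵀ-· z Y)))))
      symmetric : P ᵀ ≡ P
      symmetric = trans Pᵀ≡PᵀP (trans (sym (trans (ᵀ-· (P ᵀ) P) (cong (P ᵀ ·_) (ᵀᵀ P))))
        (trans (cong _ᵀ (sym Pᵀ≡PᵀP)) (ᵀᵀ P)))

    abstract
      projection : ∀ z → Projection z
      projection = gram-schmidt

-- Subrepresentations as invariant idempotents, Schur's lemma, and orthogonality of characters.

module PrimitiveIdempotents {m : ℕ} (G : FinGroup m) where

  open import Data.Vec using ([]; _∷_)
  open RationalField
  open RationalSums
  open Matrices
  open FinGroup G

  private variable a x y z p : Mat m

  ∑-translate : ∀ u (f : Fin m → F) → ∑ f ≡ ∑ λ i → f (u ∙ i)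
  ∑-translate u f = ∑-reindex f (u ∙_) (u ⁻¹ ∙_) (x∙x⁻¹y u) (x⁻¹∙xy u)

  𝟙[_] : Sub m → Fin m → F
  𝟙[ U ] u = if U u then 1# else 0#

  𝟙-∈ : ∀ {U u} → u ∈ U → 𝟙[ U ] u ≡ 1#
  𝟙-∈ e = cong (if_then 1# else 0#) e

  𝟙-∉ : ∀ {U u} → u ∉ U → 𝟙[ U ] u ≡ 0#
  𝟙-∉ {U} h = cong (if_then 1# else 0#) (∉⇒false U h)

  0≤𝟙 : ∀ U u → 0# ≤ 𝟙[ U ] u
  0≤𝟙 U u with U u
  ... | true = <⇒≤ 0<1
  ... | false = ≤-refl

  𝟙-cong-* : ∀ U u {p q} → (u ∈ U → p ≡ q) → 𝟙[ U ] u * p ≡ 𝟙[ U ] u * q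
  𝟙-cong-* U u h with u ∈? U
  ... | yes e = cong (𝟙[ U ] u *_) (h e)
  ... | no ne = trans (cong (_* _) (𝟙-∉ {U} ne)) (trans (zeroˡ _) (sym (trans (cong (_* _) (𝟙-∉ {U} ne)) (zeroˡ _))))

  ∣_∣ : Sub m → F
  ∣ U ∣ = ∑ 𝟙[ U ]

  -- Conjugation by the permutation matrix of left translation by `u`. Being `Invariant U` therefore
  -- means commuting with the left regular action of `U`.
  shift : Fin m → Mat m → Mat m
  shift u a = mat λ i j → a ⟨ u ∙ i , u ∙ j ⟩

  shift-entry : ∀ u a i j → shift u a ⟨ i , j ⟩ ≡ a ⟨ u ∙ i , u ∙ j ⟩
  shift-entry u a = mat-entry _

  shift-· : ∀ u a b → shift u (a · b) ≡ shift u a · shift u b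
  shift-· u a b = ext λ i j → trans (shift-entry u _ i j) (trans (·-entry a b _ _)
    (trans (∑-translate u _) (sym (trans (·-entry _ _ i j)
      (∑-cong λ k → cong₂ _*_ (shift-entry u a i k) (shift-entry u b k j))))))

  shift-ᵀ : ∀ u a → shift u (a ᵀ) ≡ shift u a ᵀ
  shift-ᵀ u a = ext λ i j → trans (shift-entry u _ i j)
    (trans (ᵀ-entry a _ _) (sym (trans (ᵀ-entry _ i j) (shift-entry u a j i))))

  shift-⊖ : ∀ u a b → shift u (a ⊖ b) ≡ shift u a ⊖ shift u b
  shift-⊖ u a b = ext λ i j → trans (shift-entry u _ i j)
    (trans (⊖-entry a b _ _) (sym (trans (⊖-entry _ _ i j) (cong₂ _-_ (shift-entry u a i j) (shift-entry u b i j)))))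

  Invariant : Sub m → Mat m → Set
  Invariant U a = ∀ u → u ∈ U → shift u a ≡ a

  invariant-entry : ∀ {U} → Invariant U a → ∀ {u} → u ∈ U → ∀ i j → a ⟨ u ∙ i , u ∙ j ⟩ ≡ a ⟨ i , j ⟩
  invariant-entry {a} h {u} hu i j = trans (sym (shift-entry u a i j)) (cong (_⟨ i , j ⟩) (h u hu))

  -- The trace of `a` times the permutation matrix of left translation by `u`, hence the character
  -- of the image of `a` when `a` is an invariant idempotent.
  χ : Mat m → Fin m → F
  χ a u = ∑ λ i → a ⟨ i , u ∙ i ⟩

  χ-ε : ∀ a → χ a ε ≡ trace a
  χ-ε a = ∑-cong λ i → cong (a ⟨ i ,_⟩) (identityˡ i)

  χ-⊖ : ∀ a b u → χ (a ⊖ b) u ≡ χ a u - χ b u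
  χ-⊖ a b u = trans (∑-cong λ i → ⊖-entry a b i (u ∙ i)) (∑-sub _ _)

  χ-𝟘 : ∀ u → χ 𝟘 u ≡ 0#
  χ-𝟘 u = ∑-0 λ i → 𝟘-entry i (u ∙ i)

  -- Cyclicity of the trace; invariance of `a` is what lets the translation move past it.
  χ-· : ∀ {u} a b → shift u a ≡ a → χ (a · b) u ≡ χ (b · a) u
  χ-· {u} a b h = begin
    χ (a · b) u
      ≡⟨ ∑-cong (λ i → ·-entry a b i (u ∙ i)) ⟩
    ∑ (λ i → ∑ λ k → a ⟨ i , k ⟩ * b ⟨ k , u ∙ i ⟩)
      ≡⟨ ∑-comm _ ⟩
    ∑ (λ k → ∑ λ i → a ⟨ i , k ⟩ * b ⟨ k , u ∙ i ⟩)
      ≡⟨ ∑-cong (λ k → ∑-cong λ i → trans (*-comm _ _) (cong (b ⟨ k , u ∙ i ⟩ *_)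
           (trans (cong (_⟨ i , k ⟩) (sym h)) (shift-entry u a i k)))) ⟩
    ∑ (λ k → ∑ λ i → b ⟨ k , u ∙ i ⟩ * a ⟨ u ∙ i , u ∙ k ⟩)
      ≡⟨ ∑-cong (λ k → sym (∑-translate u _)) ⟩
    ∑ (λ k → ∑ λ i → b ⟨ k , i ⟩ * a ⟨ i , u ∙ k ⟩)
      ≡⟨ ∑-cong (λ k → sym (·-entry b a k (u ∙ k))) ⟩
    χ (b · a) u ∎
    where open ≡-Reasoning

  -- A symmetric idempotent is the orthogonal projection onto a subrepresentation of U in the space of functions on G.
  record SI (U : Sub m) (a : Mat m) : Set where
    field
      symmetric : a ᵀ ≡ a
      idempotent : a · a ≡ a
      invariant : Invariant U a

  record Primitive (U : Sub m) (x : Mat m) : Set where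
    field
      si : SI U x
      ≢𝟘 : x ≢ 𝟘
      minimal : ∀ p → SI U p → x · p ≡ p → p ≡ 𝟘 ⊎ p ≡ x
    open SI si public

  module Subgroup (U : Sub m) (isU : IsSub U) where
    open IsSub isU

    ∣U∣>0 : 0# < ∣ U ∣
    ∣U∣>0 = ∑-pos (0≤𝟙 U) ε λ e → 0<⇒≢0 0<1 (trans (sym (𝟙-∈ {U} ε∈)) e)

    ∣U∣⁻¹ : F
    ∣U∣⁻¹ = proj₁ (≢0⇒inverse (0<⇒≢0 ∣U∣>0))

    ∣U∣⁻¹∣U∣ : ∣U∣⁻¹ * ∣ U ∣ ≡ 1#
    ∣U∣⁻¹∣U∣ = proj₂ (≢0⇒inverse (0<⇒≢0 ∣U∣>0))

    0<∣U∣⁻¹ : 0# < ∣U∣⁻¹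
    0<∣U∣⁻¹ = ≰⇒> λ c≤0 → <⇒≱ 0<1 (0≤-⇒≤ (subst (0# ≤_) (trans
      (solve 3 (λ o c u → (o :- c) :* u := o :* u :- c :* u) refl 0# ∣U∣⁻¹ (∣ U ∣)) (cong₂ _-_ (zeroˡ _) ∣U∣⁻¹∣U∣))
      (0≤* (≤⇒0≤- c≤0) (<⇒≤ ∣U∣>0))))

    ∈-translate : ∀ {u} → u ∈ U → ∀ v → U (u ∙ v) ≡ U v
    ∈-translate {u} hu v with v ∈? U
    ... | yes hv = trans (∙∈ hu hv) (sym hv)
    ... | no nv = trans (∉⇒false U λ h → nv (subst (_∈ U) (x⁻¹∙xy u v) (∙∈ (⁻¹∈ hu) h))) (sym (∉⇒false U nv))

    average : Mat m → Mat m
    average a = mat λ i j → ∣U∣⁻¹ * ∑ λ u → 𝟙[ U ] u * a ⟨ u ∙ i , u ∙ j ⟩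

    average-invariant : ∀ a → Invariant U (average a)
    average-invariant a v hv = ext λ i j → trans (shift-entry v _ i j) (trans (mat-entry _ _ _)
      (sym (trans (mat-entry _ i j) (cong (∣U∣⁻¹ *_) (trans
        (∑-reindex _ (_∙ v) (_∙ v ⁻¹)
          (λ u → solveᴳ (u ∷ v ∷ []) (a₀ :∙ a₁ :⁻¹ :∙ a₁) a₀ refl)
          (λ u → solveᴳ (u ∷ v ∷ []) (a₀ :∙ a₁ :∙ a₁ :⁻¹) a₀ refl))
        (∑-cong λ u → cong₂ _*_ (cong (if_then 1# else 0#) (∈-translateʳ u))
          (cong₂ (λ s t → a ⟨ s , t ⟩) (assoc u v i) (assoc u v j))))))))
      where
      ∈-translateʳ : ∀ u → U (u ∙ v) ≡ U u
      ∈-translateʳ u with u ∈? U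
      ... | yes hu = trans (∙∈ hu hv) (sym hu)
      ... | no nu = trans (∉⇒false U λ h → nu (subst (_∈ U)
        (solveᴳ (u ∷ v ∷ []) (a₀ :∙ a₁ :∙ a₁ :⁻¹) a₀ refl) (∙∈ h (⁻¹∈ hv)))) (sym (∉⇒false U nu))

    -- The projection `P ≡ z · Y` need not come with an invariant factor `Y`. Averaging repairs
    -- this: as `z` and `x` are invariant, every translate of a solution is again one.
    ·-average : ∀ z a x → Invariant U z → Invariant U x → z · a ≡ x → z · average a ≡ x
    ·-average z a x hz hx h = ext λ i j → begin
      (z · average a) ⟨ i , j ⟩
        ≡⟨ trans (·-entry z _ i j) (∑-cong λ k → trans (cong (z ⟨ i , k ⟩ *_) (mat-entry _ k j))
             (solve 3 (λ a b c → a :* (b :* c) := b :* (a :* c)) refl (z ⟨ i , k ⟩) ∣U∣⁻¹ _)) ⟩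
      ∑ (λ k → ∣U∣⁻¹ * (z ⟨ i , k ⟩ * ∑ λ u → 𝟙[ U ] u * a ⟨ u ∙ k , u ∙ j ⟩))
        ≡⟨ sym (*-distribˡ-∑ _ _) ⟩
      ∣U∣⁻¹ * ∑ (λ k → z ⟨ i , k ⟩ * ∑ λ u → 𝟙[ U ] u * a ⟨ u ∙ k , u ∙ j ⟩)
        ≡⟨ cong (∣U∣⁻¹ *_) (trans (∑-cong λ k → *-distribˡ-∑ _ _) (∑-comm _)) ⟩
      ∣U∣⁻¹ * ∑ (λ u → ∑ λ k → z ⟨ i , k ⟩ * (𝟙[ U ] u * a ⟨ u ∙ k , u ∙ j ⟩))
        ≡⟨ cong (∣U∣⁻¹ *_) (∑-cong λ u → trans (∑-cong λ k →
             solve 3 (λ a b c → a :* (b :* c) := b :* (a :* c)) refl (z ⟨ i , k ⟩) (𝟙[ U ] u) _)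
             (trans (sym (*-distribˡ-∑ _ _)) (𝟙-cong-* U u (inner i j u)))) ⟩
      ∣U∣⁻¹ * ∑ (λ u → 𝟙[ U ] u * x ⟨ i , j ⟩)
        ≡⟨ trans (cong (∣U∣⁻¹ *_) (sym (*-distribʳ-∑ _ _))) (trans (sym (*-assoc _ _ _))
             (trans (cong (_* x ⟨ i , j ⟩) ∣U∣⁻¹∣U∣) (*-identityˡ _))) ⟩
      x ⟨ i , j ⟩ ∎
      where
      open ≡-Reasoning
      inner : ∀ i j u → u ∈ U → ∑ (λ k → z ⟨ i , k ⟩ * a ⟨ u ∙ k , u ∙ j ⟩) ≡ x ⟨ i , j ⟩
      inner i j u hu = trans (∑-cong λ k → cong (_* a ⟨ u ∙ k , u ∙ j ⟩) (sym (invariant-entry hz hu i k)))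
        (trans (sym (∑-translate u _)) (trans (sym (·-entry z a _ _))
          (trans (cong (_⟨ u ∙ i , u ∙ j ⟩) h) (invariant-entry hx hu i j))))

    SI-⊖ : SI U x → SI U p → x · p ≡ p → SI U (x ⊖ p)
    SI-⊖ {x} {p} hx hp xp = record
      { symmetric = trans (ᵀ-⊖ x p) (cong₂ _⊖_ (SI.symmetric hx) (SI.symmetric hp))
      ; idempotent = ⊖≡𝟘⇒≡ (trans (cong (_⊖ (x ⊖ p)) (trans (·-distribˡ-⊖ (x ⊖ p) x p)
          (cong₂ _⊖_
            (trans (·-distribʳ-⊖ x x p) (cong₂ _⊖_ (SI.idempotent hx) px))
            (trans (·-distribʳ-⊖ p x p) (trans (cong₂ _⊖_ xp (SI.idempotent hp)) (⊖-self p))))))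
          (ext λ i j → trans (⊖-entry _ _ i j) (trans (cong (_- (x ⊖ p) ⟨ i , j ⟩)
            (trans (⊖-entry _ _ i j) (cong (λ h → (x ⊖ p) ⟨ i , j ⟩ - h) (𝟘-entry i j))))
            (trans (cong (λ h → (x ⊖ p) ⟨ i , j ⟩ - h - (x ⊖ p) ⟨ i , j ⟩) (sym (-‿inverseʳ 0#)))
            (trans (solve 2 (λ a o → a :- (o :- o) :- a := o :- o) refl ((x ⊖ p) ⟨ i , j ⟩) 0#)
              (trans (-‿inverseʳ 0#) (sym (𝟘-entry i j))))))))
      ; invariant = λ u hu → trans (shift-⊖ u x p) (cong₂ _⊖_ (SI.invariant hx u hu) (SI.invariant hp u hu)) }
      where
      px : p · x ≡ p
      px = trans (sym (trans (ᵀ-· x p) (cong₂ _·_ (SI.symmetric hp) (SI.symmetric hx))))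
             (trans (cong _ᵀ xp) (SI.symmetric hp))

    -- The projection onto the column space of z is invariant, because it is unique.
    divide : Primitive U x → Invariant U z → z ≢ 𝟘 → x · z ≡ z → ∃ λ y → Invariant U y × z · y ≡ x
    divide {x} {z} hx hz z≢𝟘 xz =
      average Y , average-invariant Y , ·-average z Y x hz (Primitive.invariant hx) zY≡x
      where
      open Projection (projection z)
      P-invariant : Invariant U P
      P-invariant u hu = begin
        shift u P                  ≡⟨ cong (shift u) P≡zY ⟩
        shift u (z · Y)            ≡⟨ shift-· u z Y ⟩
        shift u z · shift u Y      ≡⟨ cong (_· shift u Y) (hz u hu) ⟩
        z · shift u Y              ≡⟨ cong (_· shift u Y) (sym fixes) ⟩
        P · z · shift u Y          ≡⟨ ·-assoc P z _ ⟩
        P · (z · shift u Y)        ≡⟨ cong (P ·_) (sym shiftP) ⟩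
        P · shift u P              ≡⟨ cong₂ _·_ (sym symmetric) (sym shiftP-symmetric) ⟩
        P ᵀ · shift u P ᵀ          ≡⟨ sym (ᵀ-· (shift u P) P) ⟩
        (shift u P · P) ᵀ          ≡⟨ cong _ᵀ (trans (cong (shift u P ·_) P≡zY) (sym (·-assoc (shift u P) z Y))) ⟩
        (shift u P · z · Y) ᵀ      ≡⟨ cong (λ h → (h · Y) ᵀ) shiftP-fixes ⟩
        (z · Y) ᵀ                  ≡⟨ cong _ᵀ (sym P≡zY) ⟩
        P ᵀ                        ≡⟨ symmetric ⟩
        P                          ∎
        where
        open ≡-Reasoning
        shiftP : shift u P ≡ z · shift u Y
        shiftP = trans (cong (shift u) P≡zY) (trans (shift-· u z Y) (cong (_· shift u Y) (hz u hu)))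
        shiftP-symmetric : shift u P ᵀ ≡ shift u P
        shiftP-symmetric = trans (sym (shift-ᵀ u P)) (cong (shift u) symmetric)
        shiftP-fixes : shift u P · z ≡ z
        shiftP-fixes = trans (cong (shift u P ·_) (sym (hz u hu)))
          (trans (sym (shift-· u P z)) (trans (cong (shift u) fixes) (hz u hu)))
      -- Schur's lemma: the column space of `z` is a non-zero subrepresentation of the image of `x`,
      -- hence all of it.
      zY≡x : z · Y ≡ x
      zY≡x with Primitive.minimal hx P
          (record { symmetric = symmetric ; idempotent = idempotent ; invariant = P-invariant })
                  (trans (cong (x ·_) P≡zY) (trans (sym (·-assoc x z Y)) (trans (cong (_· Y) xz) (sym P≡zY))))
      ... | inj₁ P≡𝟘 = contradiction (trans (sym fixes) (trans (cong (_· z) P≡𝟘) (·-𝟘ˡ z))) z≢𝟘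
      ... | inj₂ P≡x = trans (sym P≡zY) P≡x

    ⟪_,_⟫ : (Fin m → F) → (Fin m → F) → F
    ⟪ f , g ⟫ = ∣U∣⁻¹ * ∑ λ u → 𝟙[ U ] u * (f u * g u)

    -- A non-zero intertwiner `z` between the images of `y` and `x` is invertible: `divide` gives it
    -- a right inverse `v`, and `v` in turn a right inverse, whence `v` is two-sided. The characters
    -- are then those of `z · v` and `v · z`.
    equivalent⇒χ-equal : Primitive U x → Primitive U y → Invariant U z → z ≢ 𝟘 → x · z ≡ z → z · y ≡ z →
                         ∀ u → u ∈ U → χ x u ≡ χ y u
    equivalent⇒χ-equal {x} {y} {z} hx hy hz z≢𝟘 xz zy u hu =
      trans (cong (λ a → χ a u) (sym zv≡x)) (trans (χ-· z v (hz u hu)) (cong (λ a → χ a u) vz≡y))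
      where
      q = divide hx hz z≢𝟘 xz
      w = proj₁ q
      v = y · w · x
      zv≡x : z · v ≡ x
      zv≡x = begin
        z · (y · w · x)    ≡⟨ sym (·-assoc z (y · w) x) ⟩
        z · (y · w) · x    ≡⟨ cong (_· x) (sym (·-assoc z y w)) ⟩
        z · y · w · x      ≡⟨ cong (λ h → h · w · x) zy ⟩
        z · w · x          ≡⟨ cong (_· x) (proj₂ (proj₂ q)) ⟩
        x · x              ≡⟨ Primitive.idempotent hx ⟩
        x                  ∎
        where open ≡-Reasoning
      v≢𝟘 : v ≢ 𝟘
      v≢𝟘 e = Primitive.≢𝟘 hx (trans (sym (Primitive.idempotent hx)) (trans (cong (_· x) (sym zv≡x))
        (trans (·-assoc z v x) (trans (cong (λ h → z · (h · x)) e) (trans (cong (z ·_) (·-𝟘ˡ x)) (·-𝟘ʳ z))))))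
        where
        ·-𝟘ʳ : ∀ a → a · 𝟘 ≡ 𝟘
        ·-𝟘ʳ a = ext λ i j → trans (·-entry a 𝟘 i j)
          (trans (∑-0 λ k → trans (cong (a ⟨ i , k ⟩ *_) (𝟘-entry k j)) (zeroʳ _)) (sym (𝟘-entry i j)))
      v-invariant : Invariant U v
      v-invariant s hs = trans (shift-· s (y · w) x) (cong₂ _·_ (trans (shift-· s y w)
        (cong₂ _·_ (Primitive.invariant hy s hs) (proj₁ (proj₂ q) s hs))) (Primitive.invariant hx s hs))
      yv≡v : y · v ≡ v
      yv≡v = trans (sym (·-assoc y (y · w) x))
          (cong (_· x) (trans (sym (·-assoc y y w)) (cong (_· w) (Primitive.idempotent hy))))
      vx≡v : v · x ≡ v
      vx≡v = trans (·-assoc (y · w) x x) (cong (y · w ·_) (Primitive.idempotent hx))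
      r = divide hy v-invariant v≢𝟘 yv≡v
      t = proj₁ r
      z≡xt : z ≡ x · t
      z≡xt = trans (sym zy) (trans (cong (z ·_) (sym (proj₂ (proj₂ r))))
          (trans (sym (·-assoc z v t)) (cong (_· t) zv≡x)))
      vz≡y : v · z ≡ y
      vz≡y = trans (cong (v ·_) z≡xt) (trans (sym (·-assoc v x t)) (trans (cong (_· t) vx≡v) (proj₂ (proj₂ r))))

    -- The matrix unit at `(i , j)`, summed over its `U`-translates and put between `x` and `y`.
    -- These matrices are the test intertwiners for Schur's lemma.
    link : Mat m → Mat m → Fin m → Fin m → Mat m
    link x y i j = mat λ k l → ∑ λ u → 𝟙[ U ] u * (x ⟨ k , u ∙ i ⟩ * y ⟨ u ∙ j , l ⟩)

    -- If all links vanish, taking the `(i , j)` entry of `link x y i j` and summing over `i` and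
    -- `j` yields the inner product of the characters. A non-zero link is an equivalence. There are
    -- finitely many links to test, so this alternative is decided outright.
    dichotomy : Primitive U x → Primitive U y → (∀ u → u ∈ U → χ x u ≡ χ y u) ⊎ ⟪ χ x , χ y ⟫ ≡ 0#
    dichotomy {x} {y} hx hy with Finₚ.any? (λ i → Finₚ.any? (λ j → ¬? (link x y i j ≟ᴹ 𝟘)))
    ... | no all𝟘 = inj₂ (trans (cong (∣U∣⁻¹ *_) zero-sum) (zeroʳ _))
      where
      vanish : ∀ i j → ∑ (λ u → 𝟙[ U ] u * (x ⟨ i , u ∙ i ⟩ * y ⟨ u ∙ j , j ⟩)) ≡ 0#
      vanish i j = trans (sym (mat-entry _ i j))
        (trans (cong (_⟨ i , j ⟩) (decidable-stable (link x y i j ≟ᴹ 𝟘) λ ne → all𝟘 (i , j , ne))) (𝟘-entry i j))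
      zero-sum : ∑ (λ u → 𝟙[ U ] u * (χ x u * χ y u)) ≡ 0#
      zero-sum = begin
        ∑ (λ u → 𝟙[ U ] u * (χ x u * χ y u))
          ≡⟨ ∑-cong (λ u → cong (𝟙[ U ] u *_) (trans (sym (∑∑-* _ _)) (∑-cong λ i → ∑-cong λ j →
               cong (x ⟨ i , u ∙ i ⟩ *_) (trans (sym (ᵀ-entry y (u ∙ j) j))
                   (cong (_⟨ u ∙ j , j ⟩) (Primitive.symmetric hy)))))) ⟩
        ∑ (λ u → 𝟙[ U ] u * ∑ λ i → ∑ λ j → x ⟨ i , u ∙ i ⟩ * y ⟨ u ∙ j , j ⟩)
          ≡⟨ ∑-cong (λ u → trans (*-distribˡ-∑ _ _) (∑-cong λ i → *-distribˡ-∑ _ _)) ⟩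
        ∑ (λ u → ∑ λ i → ∑ λ j → 𝟙[ U ] u * (x ⟨ i , u ∙ i ⟩ * y ⟨ u ∙ j , j ⟩))
          ≡⟨ trans (∑-comm _) (∑-cong λ i → ∑-comm _) ⟩
        ∑ (λ i → ∑ λ j → ∑ λ u → 𝟙[ U ] u * (x ⟨ i , u ∙ i ⟩ * y ⟨ u ∙ j , j ⟩))
          ≡⟨ ∑-0 (λ i → ∑-0 (vanish i)) ⟩
        0# ∎
        where open ≡-Reasoning
    ... | yes (i , j , z≢𝟘) = inj₁ (equivalent⇒χ-equal hx hy ζ-invariant z≢𝟘 xζ ζy)
      where
      ζ = link x y i j
      ζ-invariant : Invariant U ζ
      ζ-invariant v hv = ext λ k l → trans (shift-entry v ζ k l) (trans (mat-entry _ _ _) (trans (∑-translate v _)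
        (trans (∑-cong λ u → cong₂ _*_ (cong (if_then 1# else 0#) (∈-translate hv u))
            (cong₂ _*_ (trans (cong (x ⟨ v ∙ k ,_⟩) (assoc v u i)) (invariant-entry (Primitive.invariant hx) hv k _))
                       (trans (cong (y ⟨_, v ∙ l ⟩) (assoc v u j))
                           (invariant-entry (Primitive.invariant hy) hv _ l))))
          (sym (mat-entry _ k l)))))
      xζ : x · ζ ≡ ζ
      xζ = ext λ k l → begin
        (x · ζ) ⟨ k , l ⟩
          ≡⟨ trans (·-entry x ζ k l) (∑-cong λ s → trans (cong (x ⟨ k , s ⟩ *_) (mat-entry _ s l))
              (*-distribˡ-∑ _ _)) ⟩
        ∑ (λ s → ∑ λ u → x ⟨ k , s ⟩ * (𝟙[ U ] u * (x ⟨ s , u ∙ i ⟩ * y ⟨ u ∙ j , l ⟩)))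
          ≡⟨ ∑-comm _ ⟩
        ∑ (λ u → ∑ λ s → x ⟨ k , s ⟩ * (𝟙[ U ] u * (x ⟨ s , u ∙ i ⟩ * y ⟨ u ∙ j , l ⟩)))
          ≡⟨ ∑-cong (λ u → trans (∑-cong λ s → solve 4 (λ a b c d → a :* (b :* (c :* d)) := (a :* c) :* (b :* d)) refl
               (x ⟨ k , s ⟩) (𝟙[ U ] u) (x ⟨ s , u ∙ i ⟩) (y ⟨ u ∙ j , l ⟩)) (trans (sym (*-distribʳ-∑ _ _))
               (trans (cong (_* (𝟙[ U ] u * y ⟨ u ∙ j , l ⟩)) (trans (sym (·-entry x x k (u ∙ i)))
                   (cong (_⟨ k , u ∙ i ⟩) (Primitive.idempotent hx))))
                 (solve 3 (λ a b c → a :* (b :* c) := b :* (a :* c)) refl (x ⟨ k , u ∙ i ⟩) (𝟙[ U ] u)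
                     (y ⟨ u ∙ j , l ⟩))))) ⟩
        ∑ (λ u → 𝟙[ U ] u * (x ⟨ k , u ∙ i ⟩ * y ⟨ u ∙ j , l ⟩))
          ≡⟨ sym (mat-entry _ k l) ⟩
        ζ ⟨ k , l ⟩ ∎
        where open ≡-Reasoning
      ζy : ζ · y ≡ ζ
      ζy = ext λ k l → begin
        (ζ · y) ⟨ k , l ⟩
          ≡⟨ trans (·-entry ζ y k l) (∑-cong λ s → trans (cong (_* y ⟨ s , l ⟩) (mat-entry _ k s))
              (*-distribʳ-∑ _ _)) ⟩
        ∑ (λ s → ∑ λ u → 𝟙[ U ] u * (x ⟨ k , u ∙ i ⟩ * y ⟨ u ∙ j , s ⟩) * y ⟨ s , l ⟩)
          ≡⟨ ∑-comm _ ⟩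
        ∑ (λ u → ∑ λ s → 𝟙[ U ] u * (x ⟨ k , u ∙ i ⟩ * y ⟨ u ∙ j , s ⟩) * y ⟨ s , l ⟩)
          ≡⟨ ∑-cong (λ u → trans (∑-cong λ s → solve 4 (λ a b c d → a :* (b :* c) :* d := a :* b :* (c :* d)) refl
               (𝟙[ U ] u) (x ⟨ k , u ∙ i ⟩) (y ⟨ u ∙ j , s ⟩) (y ⟨ s , l ⟩)) (trans (sym (*-distribˡ-∑ _ _))
               (trans (cong (𝟙[ U ] u * x ⟨ k , u ∙ i ⟩ *_) (trans (sym (·-entry y y (u ∙ j) l))
                   (cong (_⟨ u ∙ j , l ⟩) (Primitive.idempotent hy))))
                 (*-assoc _ _ _)))) ⟩
        ∑ (λ u → 𝟙[ U ] u * (x ⟨ k , u ∙ i ⟩ * y ⟨ u ∙ j , l ⟩))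
          ≡⟨ sym (mat-entry _ k l) ⟩
        ζ ⟨ k , l ⟩ ∎
        where open ≡-Reasoning

-- Complete reducibility and integrality of multiplicities and degrees.

module Characters {m : ℕ} (G : FinGroup m) where

  open import Data.Nat using (ℕ; zero; suc)

  import Data.Integer as ℤ
  open import Data.Vec using ([]; _∷_)
  open import Data.List using (List; []; _∷_; _++_)
  open import Data.List.Relation.Unary.All as All using (All; []; _∷_)
  import Data.List.Relation.Unary.All.Properties as Allₚ
  open import Relation.Nullary.Decidable using (¬¬-excluded-middle)
  open RationalField
  open RationalSums
  open Matrices
  open FinGroup G
  open PrimitiveIdempotents G

  private variable a x : Mat m

  0≤s+s⇒0≤s : ∀ {s} → 0# ≤ s + s → 0# ≤ s
  0≤s+s⇒0≤s {s} h with ≤-total 0# s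
  ... | inj₁ k = k
  ... | inj₂ k = ≤-trans h (subst (s + s ≤_) (+-identityʳ s) (+-mono-≤ ≤-refl k))

  cauchy-schwarz : ∀ {n} (f g : Fin n → F) →
                   ∑ (λ i → f i * g i) * ∑ (λ i → f i * g i) ≤ ∑ (λ i → f i * f i) * ∑ (λ i → g i * g i)
  cauchy-schwarz f g = 0≤-⇒≤
      (0≤s+s⇒0≤s (subst (0# ≤_) lagrange (∑-nonneg λ k → ∑-nonneg λ l → 0≤sq (f k * g l - f l * g k))))
    where
    open ≡-Reasoning
    A = ∑ λ i → f i * f i
    B = ∑ λ i → g i * g i
    C = ∑ λ i → f i * g i
    lagrange : ∑ (λ k → ∑ λ l → (f k * g l - f l * g k) * (f k * g l - f l * g k)) ≡ (A * B - C * C) + (A * B - C * C)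
    lagrange = begin
      ∑ (λ k → ∑ λ l → (f k * g l - f l * g k) * (f k * g l - f l * g k))
        ≡⟨ ∑-cong (λ k → ∑-cong λ l → solve 4 (λ a b c d →
             (a :* d :- c :* b) :* (a :* d :- c :* b) :=
             (a :* a) :* (d :* d) :+ (b :* b) :* (c :* c) :- ((a :* b) :* (c :* d) :+ (a :* b) :* (c :* d))) refl
                 (f k) (g k) (f l) (g l)) ⟩
      ∑ (λ k → ∑ λ l → (f k * f k) * (g l * g l) + (g k * g k) * (f l * f l) -
          ((f k * g k) * (f l * g l) + (f k * g k) * (f l * g l)))
        ≡⟨ ∑-cong (λ k → trans (∑-sub _ _) (cong₂ _-_ (∑-distrib-+ _ _) (∑-distrib-+ _ _))) ⟩
      ∑ (λ k → ∑ (λ l → (f k * f k) * (g l * g l)) + ∑ (λ l → (g k * g k) * (f l * f l))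
                 - (∑ (λ l → (f k * g k) * (f l * g l)) + ∑ (λ l → (f k * g k) * (f l * g l))))
        ≡⟨ trans (∑-sub _ _) (cong₂ _-_ (∑-distrib-+ _ _) (∑-distrib-+ _ _)) ⟩
      ∑ (λ k → ∑ (λ l → (f k * f k) * (g l * g l))) + ∑ (λ k → ∑ (λ l → (g k * g k) * (f l * f l)))
        - (∑ (λ k → ∑ (λ l → (f k * g k) * (f l * g l))) + ∑ (λ k → ∑ (λ l → (f k * g k) * (f l * g l))))
        ≡⟨ cong₂ _-_ (cong₂ _+_ (∑∑-* _ _) (∑∑-* _ _)) (cong₂ _+_ (∑∑-* _ _) (∑∑-* _ _)) ⟩
      A * B + B * A - (C * C + C * C)
        ≡⟨ solve 3 (λ a b c → a :* b :+ b :* a :- (c :* c :+ c :* c) := (a :* b :- c :* c) :+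
            (a :* b :- c :* c)) refl A B C ⟩
      (A * B - C * C) + (A * B - C * C) ∎

  module _ {U : Sub m} where

    trace-SI : SI U x → trace x ≡ ∑ λ i → ∑ λ j → x ⟨ i , j ⟩ * x ⟨ i , j ⟩
    trace-SI {x} h = trans (cong trace (trans (sym (SI.idempotent h)) (cong (x ·_) (sym (SI.symmetric h)))))
        (trace-sq x)

    0≤trace : SI U x → 0# ≤ trace x
    0≤trace h = subst (0# ≤_) (sym (trace-SI h)) (∑-nonneg λ i → ∑-nonneg λ j → 0≤sq _)

    trace≢0 : SI U x → x ≢ 𝟘 → trace x ≢ 0#
    trace≢0 {x} h ne e = ne (∑sq≡0⇒𝟘 x (trans (sym (trace-SI h)) e))

    -- A lower bound on the rank without speaking of rank. Entries of `x` are inner products of its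
    -- rows, so by Cauchy-Schwarz the square of `x ⟨ i , j ⟩` is at most the product of two diagonal
    -- entries. Summation gives `t ≤ t * t`, and `t` is not 0.
    1≤trace : SI U x → x ≢ 𝟘 → 1# ≤ trace x
    1≤trace {x} h ne with ≤-total 1# (trace x)
    ... | inj₁ k = k
    ... | inj₂ t≤1 = subst (_≤ t)
        (sym (-≡0⇒≡ (*-integral (≤-antisym t*[1-t]≤0 (0≤* (0≤trace h) (≤⇒0≤- t≤1))) (trace≢0 h ne)))) ≤-refl
      where
      t = trace x
      entry : ∀ i j → x ⟨ i , j ⟩ ≡ ∑ λ k → x ⟨ i , k ⟩ * x ⟨ j , k ⟩
      entry i j = trans (cong (_⟨ i , j ⟩) (trans (sym (SI.idempotent h)) (cong (x ·_) (sym (SI.symmetric h)))))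
        (trans (·-entry x (x ᵀ) i j) (∑-cong λ k → cong (x ⟨ i , k ⟩ *_) (ᵀ-entry x k j)))
      minor : ∀ i j → x ⟨ i , j ⟩ * x ⟨ i , j ⟩ ≤ x ⟨ i , i ⟩ * x ⟨ j , j ⟩
      minor i j = subst₂ _≤_ (sym (cong₂ _*_ (entry i j) (entry i j))) (sym (cong₂ _*_ (entry i i) (entry j j)))
        (cauchy-schwarz (x ⟨ i ,_⟩) (x ⟨ j ,_⟩))
      0≤tt-t : 0# ≤ t * t - t
      0≤tt-t = subst (0# ≤_) (trans (∑-cong λ i → ∑-sub _ _) (trans (∑-sub _ _)
        (cong₂ _-_ (∑∑-* _ _) (sym (trace-SI h))))) (∑-nonneg λ i → ∑-nonneg λ j → ≤⇒0≤- (minor i j))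
      t*[1-t]≤0 : t * (1# - t) ≤ 0#
      t*[1-t]≤0 = 0≤-⇒≤ (subst (0# ≤_) (trans (cong (t * t +_) (cong -_ (sym (*-identityʳ t))))
        (trans (solve 2 (λ t o → t :* t :- t :* o := (t :* o :- t :* o) :- t :* (o :- t)) refl t 1#)
          (cong (_- t * (1# - t)) (-‿inverseʳ _)))) 0≤tt-t)

  ∑ᴸ : ∀ {A : Set} → (A → F) → List A → F
  ∑ᴸ f [] = 0#
  ∑ᴸ f (a ∷ as) = f a + ∑ᴸ f as

  ∑ᴸ-++ : ∀ {A : Set} (f : A → F) as bs → ∑ᴸ f (as ++ bs) ≡ ∑ᴸ f as + ∑ᴸ f bs
  ∑ᴸ-++ f [] bs = sym (+-identityˡ _)
  ∑ᴸ-++ f (a ∷ as) bs = trans (cong (f a +_) (∑ᴸ-++ f as bs)) (sym (+-assoc _ _ _))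

  -- Only characters are required to add up, and they do so on all of `G`. The field `below` is kept
  -- so that the parts of `identityᴴ` inherit its support in `H`.
  record Decomposition (U : Sub m) (x : Mat m) : Set where
    field
      parts : List (Mat m)
      primitives : All (Primitive U) parts
      below : All (λ p → x · p ≡ p) parts
      χ-sum : ∀ g → χ x g ≡ ∑ᴸ (λ p → χ p g) parts

  module Subgroup₂ (U : Sub m) (isU : IsSub U) where
    open IsSub isU
    open Subgroup U isU

    private
      -- The fuel bounds the trace; in a proper splitting each part takes at least 1 of it. Excluded
      -- middle on primitivity is admissible under the double negation. If no decomposition existed,
      -- then no proper part of `x` could exist either, since it and its complement decompose, and
      -- `x` would be primitive after all.
      decompose-fuel : ∀ k x → SI U x → trace x ≤ ι (ℤ.+ k) → ¬ ¬ Decomposition U x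
      decompose-fuel k x hx ht cont with x ≟ᴹ 𝟘
      ... | yes e = cont (record { parts = [] ; primitives = [] ; below = []
                                 ; χ-sum = λ g → trans (cong (λ a → χ a g) e) (χ-𝟘 g) })
      decompose-fuel zero x hx ht cont | no ne =
        <⇒≱ 0<1 (≤-trans (1≤trace hx ne) (subst (trace x ≤_) ι-0 ht))
      decompose-fuel (suc k) x hx ht cont | no ne = ¬¬-excluded-middle λ where
          (yes prim) → cont (record { parts = x ∷ [] ; primitives = prim ∷ [] ; below = SI.idempotent hx ∷ []
                                    ; χ-sum = λ g → sym (+-identityʳ _) })
          (no ¬prim) → ¬prim (record { si = hx ; ≢𝟘 = ne ; minimal = λ p hp xp → split p hp xp (p ≟ᴹ 𝟘) (p ≟ᴹ x) })
        where
        reduce : ∀ s t → trace x ≡ s + t → 1# ≤ t → s ≤ ι (ℤ.+ k)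
        reduce s t e 1≤t = 0≤-⇒≤ (subst (0# ≤_)
          (solve 4 (λ o i s t → (o :+ i :- (s :+ t)) :+ (t :- o) := i :- s) refl 1# (ι (ℤ.+ k)) s t)
          (0≤+ (≤⇒0≤- (subst₂ _≤_ e (trans (ι-+ (ℤ.+ 1) (ℤ.+ k)) (cong (_+ ι (ℤ.+ k)) ι-1)) ht)) (≤⇒0≤- 1≤t)))
        split : ∀ p → SI U p → x · p ≡ p → Dec (p ≡ 𝟘) → Dec (p ≡ x) → p ≡ 𝟘 ⊎ p ≡ x
        split p hp xp (yes e) _ = inj₁ e
        split p hp xp (no _) (yes e) = inj₂ e
        split p hp xp (no p≢𝟘) (no p≢x) = contradiction cont
          λ cont → decompose-fuel k p hp (reduce (trace p) (trace q) (trans traces (+-comm _ _)) (1≤trace hq q≢𝟘))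
          λ D₁ → decompose-fuel k q hq (reduce (trace q) (trace p) traces (1≤trace hp p≢𝟘))
          λ D₂ → cont (join D₁ D₂)
          where
          q = x ⊖ p
          hq = SI-⊖ hx hp xp
          q≢𝟘 : q ≢ 𝟘
          q≢𝟘 e = p≢x (sym (⊖≡𝟘⇒≡ e))
          traces : trace x ≡ trace q + trace p
          traces = trans (solve 2 (λ a b → a := a :- b :+ b) refl (trace x) (trace p))
              (cong (_+ trace p) (sym (trace-⊖ x p)))
          xq≡q : x · q ≡ q
          xq≡q = trans (·-distribˡ-⊖ x x p) (cong₂ _⊖_ (SI.idempotent hx) xp)
          lift : ∀ {r} → x · r ≡ r → ∀ {ps} → All (λ p → r · p ≡ p) ps → All (λ p → x · p ≡ p) ps
          lift {r} xr = All.map λ {s} rs → trans (cong (x ·_) (sym rs))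
              (trans (sym (·-assoc x r s)) (trans (cong (_· s) xr) rs))
          join : Decomposition U p → Decomposition U q → Decomposition U x
          join D₁ D₂ = record
            { parts = D₁.parts ++ D₂.parts
            ; primitives = Allₚ.++⁺ D₁.primitives D₂.primitives
            ; below = Allₚ.++⁺ (lift xp D₁.below) (lift xq≡q D₂.below)
            ; χ-sum = λ g → trans (solve 2 (λ a b → a := b :+ (a :- b)) refl (χ x g) (χ p g))
                (trans (cong₂ _+_ (D₁.χ-sum g) (trans (sym (χ-⊖ x p g)) (D₂.χ-sum g)))
                    (sym (∑ᴸ-++ _ D₁.parts D₂.parts))) }
            where
            module D₁ = Decomposition D₁
            module D₂ = Decomposition D₂

    decompose : SI U x → ¬ ¬ Decomposition U x
    decompose {x} hx = let k , hk = archimedean (trace x) in decompose-fuel k x hx hk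

    𝟙𝟙 : ∀ u → 𝟙[ U ] u * 𝟙[ U ] u ≡ 𝟙[ U ] u
    𝟙𝟙 u with U u
    ... | true = *-identityˡ 1#
    ... | false = zeroˡ 0#

    -- The rank-one projection onto the indicator function of `U`, that is, the trivial
    -- representation realised inside the functions supported on `U`.
    trivial : Mat m
    trivial = mat λ i j → ∣U∣⁻¹ * (𝟙[ U ] i * 𝟙[ U ] j)

    trivial-entry : ∀ i j → trivial ⟨ i , j ⟩ ≡ ∣U∣⁻¹ * (𝟙[ U ] i * 𝟙[ U ] j)
    trivial-entry = mat-entry _

    trivial-si : SI U trivial
    trivial-si = record
      { symmetric = ext λ i j → trans (ᵀ-entry _ i j) (trans (trivial-entry j i)
          (trans (cong (∣U∣⁻¹ *_) (*-comm _ _)) (sym (trivial-entry i j))))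
      ; idempotent = ext λ i j → trans (·-entry _ _ i j) (trans (∑-cong λ k →
          trans (cong₂ _*_ (trivial-entry i k) (trivial-entry k j))
            (trans (solve 4 (λ c i k j → (c :* (i :* k)) :* (c :* (k :* j)) := c :* (i :* j) :* (c :* (k :* k))) refl
               ∣U∣⁻¹ (𝟙[ U ] i) (𝟙[ U ] k) (𝟙[ U ] j))
              (cong (λ h → ∣U∣⁻¹ * (𝟙[ U ] i * 𝟙[ U ] j) * (∣U∣⁻¹ * h)) (𝟙𝟙 k))))
          (trans (sym (*-distribˡ-∑ _ _))
              (trans (cong (∣U∣⁻¹ * (𝟙[ U ] i * 𝟙[ U ] j) *_) (trans (sym (*-distribˡ-∑ _ _)) ∣U∣⁻¹∣U∣))
            (trans (*-identityʳ _) (sym (trivial-entry i j))))))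
      ; invariant = λ u hu → ext λ i j → trans (shift-entry u _ i j) (trans (trivial-entry _ _)
          (trans (cong (∣U∣⁻¹ *_) (cong₂ _*_ (cong (if_then 1# else 0#) (∈-translate hu i))
              (cong (if_then 1# else 0#) (∈-translate hu j))))
            (sym (trivial-entry i j)))) }

    χ-trivial : ∀ u → u ∈ U → χ trivial u ≡ 1#
    χ-trivial u hu = trans (∑-cong λ i → trans (trivial-entry i (u ∙ i)) (cong (∣U∣⁻¹ *_)
        (trans (cong (𝟙[ U ] i *_) (cong (if_then 1# else 0#) (∈-translate hu i))) (𝟙𝟙 i))))
      (trans (sym (*-distribˡ-∑ _ _)) ∣U∣⁻¹∣U∣)

    trivial-εε : trivial ⟨ ε , ε ⟩ ≡ ∣U∣⁻¹
    trivial-εε = trans (trivial-entry ε ε) (trans (cong (∣U∣⁻¹ *_) (trans (𝟙𝟙 ε) (𝟙-∈ {U} ε∈))) (*-identityʳ _))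

    -- The quadratic form of `p` at the indicator of `U`, divided by `∣ U ∣`.
    mass : Mat m → F
    mass p = ∣U∣⁻¹ * ∑ λ k → 𝟙[ U ] k * ∑ λ l → 𝟙[ U ] l * p ⟨ l , k ⟩

    -- `trivial · p ≡ p` makes `p` constant along `U` in its first index and 0 outside; symmetry
    -- does the same for the second, so `p` is a scalar multiple of `trivial`.
    below-trivial : ∀ p → SI U p → trivial · p ≡ p → ∀ i j → p ⟨ i , j ⟩ ≡ mass p * trivial ⟨ i , j ⟩
    below-trivial p hp ep i j = begin
      p ⟨ i , j ⟩
        ≡⟨ row i j ⟩
      c * (𝟙[ U ] i * r j)
        ≡⟨ cong (λ h → c * (𝟙[ U ] i * h)) (∑-cong λ k → cong (𝟙[ U ] k *_) (trans (swap k j) (row j k))) ⟩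
      c * (𝟙[ U ] i * ∑ λ k → 𝟙[ U ] k * (c * (𝟙[ U ] j * r k)))
        ≡⟨ cong (λ h → c * (𝟙[ U ] i * h)) (trans (∑-cong λ k →
             solve 4 (λ k c j r → k :* (c :* (j :* r)) := c :* j :* (k :* r)) refl (𝟙[ U ] k) c (𝟙[ U ] j) (r k))
                 (sym (*-distribˡ-∑ _ _))) ⟩
      c * (𝟙[ U ] i * (c * 𝟙[ U ] j * ∑ λ k → 𝟙[ U ] k * r k))
        ≡⟨ solve 4 (λ c i j t → c :* (i :* (c :* j :* t)) := c :* t :* (c :* (i :* j))) refl c (𝟙[ U ] i)
            (𝟙[ U ] j) _ ⟩
      mass p * (c * (𝟙[ U ] i * 𝟙[ U ] j))
        ≡⟨ cong (mass p *_) (sym (trivial-entry i j)) ⟩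
      mass p * trivial ⟨ i , j ⟩ ∎
      where
      open ≡-Reasoning
      c = ∣U∣⁻¹
      r : Fin m → F
      r j = ∑ λ l → 𝟙[ U ] l * p ⟨ l , j ⟩
      swap : ∀ i j → p ⟨ i , j ⟩ ≡ p ⟨ j , i ⟩
      swap i j = trans (sym (ᵀ-entry p j i)) (cong (_⟨ j , i ⟩) (SI.symmetric hp))
      row : ∀ i j → p ⟨ i , j ⟩ ≡ c * (𝟙[ U ] i * r j)
      row i j = trans (cong (_⟨ i , j ⟩) (sym ep)) (trans (·-entry trivial p i j) (trans (∑-cong λ k →
        trans (cong (_* p ⟨ k , j ⟩) (trivial-entry i k))
          (solve 4 (λ c i k p → c :* (i :* k) :* p := c :* i :* (k :* p)) refl c (𝟙[ U ] i) (𝟙[ U ] k) (p ⟨ k , j ⟩)))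
        (trans (sym (*-distribˡ-∑ _ _)) (*-assoc _ _ _))))

    trivial-primitive : Primitive U trivial
    trivial-primitive = record
      { si = trivial-si
      ; ≢𝟘 = λ e → 0<⇒≢0 0<∣U∣⁻¹ (trans (sym trivial-εε) (trans (cong (_⟨ ε , ε ⟩) e) (𝟘-entry ε ε)))
      ; minimal = minimal }
      where
      minimal : ∀ p → SI U p → trivial · p ≡ p → p ≡ 𝟘 ⊎ p ≡ trivial
      minimal p hp ep with mass p ≟ 0#
      ... | yes e = inj₁ (ext λ i j → trans (below-trivial p hp ep i j)
        (trans (cong (_* trivial ⟨ i , j ⟩) e) (trans (zeroˡ _) (sym (𝟘-entry i j)))))
      ... | no ne = inj₂ (ext λ i j → trans (below-trivial p hp ep i j)
        (trans (cong (_* trivial ⟨ i , j ⟩) mass≡1) (*-identityˡ _)))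
        where
        pp : ∀ i j → p ⟨ i , j ⟩ ≡ mass p * p ⟨ i , j ⟩
        pp i j = trans (cong (_⟨ i , j ⟩) (sym (SI.idempotent hp))) (trans (·-entry p p i j)
          (trans (∑-cong λ k → trans (cong (_* p ⟨ k , j ⟩) (below-trivial p hp ep i k)) (*-assoc _ _ _))
            (trans (sym (*-distribˡ-∑ _ _))
                (cong (mass p *_) (trans (sym (·-entry trivial p i j)) (cong (_⟨ i , j ⟩) ep))))))
        pεε≢0 : p ⟨ ε , ε ⟩ ≢ 0#
        pεε≢0 e = 0<⇒≢0 0<∣U∣⁻¹ (trans (sym trivial-εε) (*-integral (trans (sym (below-trivial p hp ep ε ε)) e) ne))
        mass≡1 : mass p ≡ 1#
        mass≡1 = *-cancelˡ pεε≢0 (trans (*-comm _ _) (trans (sym (pp ε ε)) (sym (*-identityʳ _))))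

    χ≢0 : Primitive U x → χ x ε ≢ 0#
    χ≢0 {x} hx e = trace≢0 (Primitive.si hx) (Primitive.≢𝟘 hx) (trans (sym (χ-ε x)) e)

    ⟪⟫-pos : ∀ f → f ε ≢ 0# → 0# < ⟪ f , f ⟫
    ⟪⟫-pos f ne = 0<* 0<∣U∣⁻¹ (∑-pos (λ u → 0≤* (0≤𝟙 U u) (0≤sq (f u))) ε
      λ e → ne (sq≡0 (trans (sym (trans (cong (_* (f ε * f ε)) (𝟙-∈ {U} ε∈)) (*-identityˡ _))) e)))

    ⟪⟫-cong : ∀ {f f′ g g′} → (∀ u → u ∈ U → f u ≡ f′ u) → (∀ u → u ∈ U → g u ≡ g′ u) → ⟪ f , g ⟫ ≡ ⟪ f′ , g′ ⟫
    ⟪⟫-cong hf hg = cong (∣U∣⁻¹ *_) (∑-cong λ u → 𝟙-cong-* U u λ hu → cong₂ _*_ (hf u hu) (hg u hu))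

    ⟪⟫-comm : ∀ f g → ⟪ f , g ⟫ ≡ ⟪ g , f ⟫
    ⟪⟫-comm f g = cong (∣U∣⁻¹ *_) (∑-cong λ u → cong (𝟙[ U ] u *_) (*-comm _ _))

    ⟪⟫-+ : ∀ f g h → ⟪ f , (λ u → g u + h u) ⟫ ≡ ⟪ f , g ⟫ + ⟪ f , h ⟫
    ⟪⟫-+ f g h = trans (cong (∣U∣⁻¹ *_) (trans (∑-cong λ u →
        solve 4 (λ i a b c → i :* (a :* (b :+ c)) := i :* (a :* b) :+ i :* (a :* c)) refl (𝟙[ U ] u) (f u) (g u)
            (h u))
      (∑-distrib-+ _ _))) (distribˡ _ _ _)

    ⟪⟫-* : ∀ f c g → ⟪ f , (λ u → c * g u) ⟫ ≡ c * ⟪ f , g ⟫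
    ⟪⟫-* f c g = trans (cong (∣U∣⁻¹ *_) (trans (∑-cong λ u →
        solve 4 (λ i a b c → i :* (a :* (c :* b)) := c :* (i :* (a :* b))) refl (𝟙[ U ] u) (f u) (g u) c)
      (sym (*-distribˡ-∑ _ _)))) (solve 3 (λ a b c → a :* (b :* c) := b :* (a :* c)) refl ∣U∣⁻¹ c _)

    ⟪⟫-0 : ∀ f → ⟪ f , (λ _ → 0#) ⟫ ≡ 0#
    ⟪⟫-0 f = trans (cong (∣U∣⁻¹ *_) (∑-0 λ u → trans (cong (𝟙[ U ] u *_) (zeroʳ _)) (zeroʳ _))) (zeroʳ _)

    ⟪⟫-∑ᴸ : ∀ {A : Set} f (g : A → Fin m → F) as → ⟪ f , (λ u → ∑ᴸ (λ a → g a u) as) ⟫ ≡ ∑ᴸ (λ a → ⟪ f , g a ⟫) as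
    ⟪⟫-∑ᴸ f g [] = ⟪⟫-0 f
    ⟪⟫-∑ᴸ f g (a ∷ as) = trans (⟪⟫-+ f (g a) _) (cong (⟪ f , g a ⟫ +_) (⟪⟫-∑ᴸ f g as))

    ⟪1,1⟫ : ⟪ (λ _ → 1#) , (λ _ → 1#) ⟫ ≡ 1#
    ⟪1,1⟫ = trans (cong (∣U∣⁻¹ *_) (∑-cong λ u → trans (cong (𝟙[ U ] u *_) (*-identityˡ 1#))
        (*-identityʳ _))) ∣U∣⁻¹∣U∣

    -- By `dichotomy` each primitive constituent of `a` pairs with `w` to `e` or to 0. Naming the
    -- integer beforehand as a numerator leaves a decidable equation, which can be drawn from the
    -- double-negated decomposition.
    multiplicity : ∀ {w} → Primitive U w → SI U a → ∃ λ z → ⟪ χ w , χ a ⟫ ≡ ι z * ⟪ χ w , χ w ⟫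
    multiplicity {a} {w} hw ha = ⌊ n ⌋ , trans (sym n*e) (cong (_* e) (decidable-stable (n ≟ ι ⌊ n ⌋) integral))
      where
      e = ⟪ χ w , χ w ⟫
      inverse = ≢0⇒inverse (0<⇒≢0 (⟪⟫-pos (χ w) (χ≢0 hw)))
      n = ⟪ χ w , χ a ⟫ * proj₁ inverse
      n*e : n * e ≡ ⟪ χ w , χ a ⟫
      n*e = trans (*-assoc _ _ _) (trans (cong (⟪ χ w , χ a ⟫ *_) (proj₂ inverse)) (*-identityʳ _))
      count : ∀ {ps} → All (Primitive U) ps → ∃ λ z → ∑ᴸ (λ p → ⟪ χ w , χ p ⟫) ps ≡ ι z * e
      count [] = ℤ.+ 0 , trans (sym (zeroˡ e)) (cong (_* e) (sym ι-0))
      count {p ∷ ps} (hp ∷ hps) with count hps | dichotomy hw hp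
      ... | z , ez | inj₂ e0 = z , trans (cong₂ _+_ e0 ez) (+-identityˡ _)
      ... | z , ez | inj₁ eq = ℤ.+ 1 ℤ.+ z , (begin
        ⟪ χ w , χ p ⟫ + ∑ᴸ (λ p → ⟪ χ w , χ p ⟫) ps
          ≡⟨ cong₂ _+_ (trans (⟪⟫-cong (λ _ _ → refl) (λ u hu → sym (eq u hu))) (sym (*-identityˡ e))) ez ⟩
        1# * e + ι z * e
          ≡⟨ sym (distribʳ _ _ _) ⟩
        (1# + ι z) * e
          ≡⟨ cong (_* e) (trans (cong (_+ ι z) (sym ι-1)) (sym (ι-+ (ℤ.+ 1) z))) ⟩
        ι (ℤ.+ 1 ℤ.+ z) * e ∎)
        where open ≡-Reasoning
      integral : ¬ ¬ (n ≡ ι ⌊ n ⌋)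
      integral cont = decompose ha λ D → cont (conclude D)
        where
        conclude : Decomposition U a → n ≡ ι ⌊ n ⌋
        conclude D = trans n≡ι (cong ι (trans (sym (⌊ι⌋ z)) (cong ⌊_⌋ (sym n≡ι))))
          where
          open Decomposition D
          z = proj₁ (count primitives)
          n≡ι : n ≡ ι z
          n≡ι = *-cancelˡ (0<⇒≢0 (⟪⟫-pos (χ w) (χ≢0 hw))) (trans (*-comm e n) (trans n*e
            (trans (⟪⟫-cong (λ _ _ → refl) (λ u _ → χ-sum u)) (trans (⟪⟫-∑ᴸ (χ w) χ parts)
              (trans (proj₂ (count primitives)) (*-comm _ _))))))

  trivialSubgroup : Sub m
  trivialSubgroup x = does (x Fin.≟ ε)

  trivialSubgroup-isSub : IsSub trivialSubgroup
  trivialSubgroup-isSub = record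
    { ε∈ = dec-true (ε Fin.≟ ε) refl
    ; ∙∈ = λ {x} {y} hx hy → dec-true (x ∙ y Fin.≟ ε)
        (trans (cong₂ _∙_ (does-sound (x Fin.≟ ε) hx) (does-sound (y Fin.≟ ε) hy)) (identityˡ ε))
    ; ⁻¹∈ = λ {x} hx → dec-true (x ⁻¹ Fin.≟ ε) (trans (cong _⁻¹ (does-sound (x Fin.≟ ε) hx)) ε⁻¹) }

  -- Over the one-element subgroup the trivial character has norm 1, and its multiplicity in `a` is
  -- `χ a ε`, the trace.
  trace-integral : ∀ {U} → SI U a → ∃ λ z → trace a ≡ ι z
  trace-integral {a} ha = z , (begin
    trace a                                  ≡⟨ sym (χ-ε a) ⟩
    χ a ε                                    ≡⟨ sym (*-identityˡ _) ⟩
    1# * χ a ε                               ≡⟨ cong (_* χ a ε) (sym ⟪1,1⟫) ⟩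
    ⟪ (λ _ → 1#) , (λ _ → 1#) ⟫ * χ a ε      ≡⟨ *-comm _ _ ⟩
    χ a ε * ⟪ (λ _ → 1#) , (λ _ → 1#) ⟫      ≡⟨ sym (⟪⟫-* _ (χ a ε) _) ⟩
    ⟪ (λ _ → 1#) , (λ _ → χ a ε * 1#) ⟫      ≡⟨ ⟪⟫-cong (λ u hu → sym (χ-trivial u hu)) (λ u hu →
                                                  trans (*-identityʳ _) (cong (χ a)
                                                      (sym (does-sound (u Fin.≟ ε) hu)))) ⟩
    ⟪ χ trivial , χ a ⟫                      ≡⟨ proj₂ mult ⟩
    ι z * ⟪ χ trivial , χ trivial ⟫          ≡⟨ cong (ι z *_) (trans (⟪⟫-cong χ-trivial χ-trivial) ⟪1,1⟫) ⟩
    ι z * 1#                                 ≡⟨ *-identityʳ _ ⟩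
    ι z                                      ∎)
    where
    open ≡-Reasoning
    open Subgroup trivialSubgroup trivialSubgroup-isSub
    open Subgroup₂ trivialSubgroup trivialSubgroup-isSub
    mult = multiplicity trivial-primitive (record
      { symmetric = SI.symmetric ha ; idempotent = SI.idempotent ha
      ; invariant = λ u hu → ext λ i j → trans (shift-entry u a i j)
          (cong₂ (λ s t → a ⟨ s , t ⟩) (fixed hu i) (fixed hu j)) })
      where
      fixed : ∀ {u} → u ∈ trivialSubgroup → ∀ i → u ∙ i ≡ i
      fixed {u} hu i = trans (cong (_∙ i) (does-sound (u Fin.≟ ε) hu)) (identityˡ i)
    z = proj₁ mult

-- Integer combinations of primitive characters and those with the norm of a single one.

module VirtualCharacters {m : ℕ} (G : FinGroup m) where

  open import Data.Nat using (ℕ; zero; suc)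

  open import Data.Integer as ℤ using (ℤ)
  import Data.Integer.Properties as ℤₚ
  import Data.Nat.Properties as ℕₚ
  open import Data.Vec using ([]; _∷_)
  open import Data.List as List using (List; []; _∷_)
  open import Data.List.Relation.Unary.All as All using (All; []; _∷_)
  open import Data.Sum using () renaming (map to map⊎)
  open RationalField
  open RationalSums
  open Matrices
  open FinGroup G
  open PrimitiveIdempotents G
  open Characters G

  Class : Sub m → (Fin m → F) → Set
  Class U f = ∀ x u → x ∈ U → f (u ^ x) ≡ f u

  χ-class : ∀ {U a} → Invariant U a → Class U (χ a)
  χ-class {U} {a} ha x u hx = trans (∑-cong λ i → sym (trans
      (cong (a ⟨ x ∙ i ,_⟩) (solveᴳ (x ∷ u ∷ i ∷ []) (a₁ :∙ (a₀ :∙ a₂)) (a₀ :∙ ((a₀ :⁻¹ :∙ a₁ :∙ a₀) :∙ a₂)) refl))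
      (invariant-entry {a} ha hx i ((u ^ x) ∙ i))))
    (sym (∑-translate x _))

  -- The sum of the squares (a ⟨ i , u ∙ j ⟩ - a ⟨ i , j ⟩)² is twice χ a ε - χ a u.
  χ-maximal : ∀ {U a u} → SI U a → χ a u ≡ χ a ε → ∀ g → χ a (u ∙ g) ≡ χ a g
  χ-maximal {U} {a} {u} ha e g = ∑-cong λ i → trans (cong (a ⟨ i ,_⟩) (assoc u g i)) (fixed i (g ∙ i))
    where
    t = trace a
    s₁ : ∑ (λ i → ∑ λ j → a ⟨ i , u ∙ j ⟩ * a ⟨ i , u ∙ j ⟩) ≡ t
    s₁ = trans (∑-cong λ i → sym (∑-translate u (λ j → a ⟨ i , j ⟩ * a ⟨ i , j ⟩))) (sym (trace-SI ha))
    s₂ : ∑ (λ i → ∑ λ j → a ⟨ i , u ∙ j ⟩ * a ⟨ i , j ⟩) ≡ t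
    s₂ = begin
      ∑ (λ i → ∑ λ j → a ⟨ i , u ∙ j ⟩ * a ⟨ i , j ⟩)
        ≡⟨ ∑-comm _ ⟩
      ∑ (λ j → ∑ λ i → a ⟨ i , u ∙ j ⟩ * a ⟨ i , j ⟩)
        ≡⟨ ∑-cong (λ j → trans (∑-cong λ i → trans (*-comm _ _)
             (cong (_* a ⟨ i , u ∙ j ⟩) (trans (sym (ᵀ-entry a j i)) (cong (_⟨ j , i ⟩) (SI.symmetric ha)))))
             (trans (sym (·-entry a a j (u ∙ j))) (cong (_⟨ j , u ∙ j ⟩) (SI.idempotent ha)))) ⟩
      χ a u ≡⟨ trans e (χ-ε a) ⟩
      t ∎
      where open ≡-Reasoning
    fixed : ∀ i j → a ⟨ i , u ∙ j ⟩ ≡ a ⟨ i , j ⟩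
    fixed i j = -≡0⇒≡ (sq≡0 (∑-nonneg-zero (λ j → 0≤sq _) (∑-nonneg-zero (λ i → ∑-nonneg λ j → 0≤sq _) total i) j))
      where
      total : ∑ (λ i → ∑ λ j → (a ⟨ i , u ∙ j ⟩ - a ⟨ i , j ⟩) * (a ⟨ i , u ∙ j ⟩ - a ⟨ i , j ⟩)) ≡ 0#
      total = begin
        ∑ (λ i → ∑ λ j → (a ⟨ i , u ∙ j ⟩ - a ⟨ i , j ⟩) * (a ⟨ i , u ∙ j ⟩ - a ⟨ i , j ⟩))
          ≡⟨ ∑-cong (λ i → trans (∑-cong λ j → solve 2 (λ p q → (p :- q) :* (p :- q) := (p :* p :+ q :* q) :-
              (p :* q :+ p :* q)) refl
               (a ⟨ i , u ∙ j ⟩) (a ⟨ i , j ⟩)) (trans (∑-sub _ _) (cong₂ _-_ (∑-distrib-+ _ _) (∑-distrib-+ _ _)))) ⟩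
        ∑ (λ i → (∑ (λ j → a ⟨ i , u ∙ j ⟩ * a ⟨ i , u ∙ j ⟩) + ∑ (λ j → a ⟨ i , j ⟩ * a ⟨ i , j ⟩))
               - (∑ (λ j → a ⟨ i , u ∙ j ⟩ * a ⟨ i , j ⟩) + ∑ (λ j → a ⟨ i , u ∙ j ⟩ * a ⟨ i , j ⟩)))
          ≡⟨ trans (∑-sub _ _) (cong₂ _-_ (∑-distrib-+ _ _) (∑-distrib-+ _ _)) ⟩
        (∑ (λ i → ∑ (λ j → a ⟨ i , u ∙ j ⟩ * a ⟨ i , u ∙ j ⟩)) + ∑ (λ i → ∑ (λ j → a ⟨ i , j ⟩ * a ⟨ i , j ⟩)))
               - (∑ (λ i → ∑ (λ j → a ⟨ i , u ∙ j ⟩ * a ⟨ i , j ⟩)) + ∑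
                   (λ i → ∑ (λ j → a ⟨ i , u ∙ j ⟩ * a ⟨ i , j ⟩)))
          ≡⟨ cong₂ _-_ (cong₂ _+_ s₁ (sym (trace-SI ha))) (cong₂ _+_ s₂ s₂) ⟩
        (t + t) - (t + t)
          ≡⟨ -‿inverseʳ _ ⟩
        0# ∎
        where open ≡-Reasoning

  ℤ-unit : ∀ c z → c ℤ.* z ≡ ℤ.+ 1 → c ≡ ℤ.+ 1 ⊎ c ≡ ℤ.- ℤ.+ 1
  ℤ-unit c z h = sign c (ℕₚ.m*n≡1⇒m≡1 ℤ.∣ c ∣ ℤ.∣ z ∣ (trans (sym (ℤₚ.abs-* c z)) (cong ℤ.∣_∣ h)))
    where
    sign : ∀ c → ℤ.∣ c ∣ ≡ 1 → c ≡ ℤ.+ 1 ⊎ c ≡ ℤ.- ℤ.+ 1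
    sign (ℤ.+ _) refl = inj₁ refl
    sign ℤ.-[1+ zero ] refl = inj₂ refl

  module Combinations (U : Sub m) (isU : IsSub U) where
    open Subgroup U isU
    open Subgroup₂ U isU

    Combination : Set
    Combination = List (ℤ × Mat m)

    value : Combination → Fin m → F
    value L g = ∑ᴸ (λ (c , v) → ι c * χ v g) L

    _⊥_ : Mat m → Combination → Set
    v ⊥ L = All (λ (_ , y) → ⟪ χ v , χ y ⟫ ≡ 0#) L

    data Orthogonal : Combination → Set where
      [] : Orthogonal []
      _∷_ : ∀ {c v L} → v ⊥ L → Orthogonal L → Orthogonal ((c , v) ∷ L)

    Primitives : Combination → Set
    Primitives = All λ (_ , v) → Primitive U v

    record Orthogonalised (f : Fin m → F) : Set where
      field
        list : Combination
        primitives : Primitives list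
        orthogonal : Orthogonal list
        value≡ : ∀ u → u ∈ U → value list u ≡ f u

    -- By `dichotomy`, `χ v` either agrees on `U` with the character at the head, and the
    -- coefficients merge, or is orthogonal to it and moves on. The second conclusion serves the
    -- recursion: the skipped head stays orthogonal to the new tail.
    insert : ∀ c v L → Primitive U v → Primitives L → Orthogonal L →
             ∃ λ (O : Orthogonalised (λ u → ι c * χ v u + value L u)) →
               ∀ y → ⟪ χ y , χ v ⟫ ≡ 0# → y ⊥ L → y ⊥ Orthogonalised.list O
    insert c v [] hv [] [] =
      record { list = (c , v) ∷ [] ; primitives = hv ∷ [] ; orthogonal = [] ∷ [] ; value≡ = λ _ _ → refl } ,
      λ y yv _ → yv ∷ []
    insert c v ((d , w) ∷ L) hv (hw ∷ hL) (w⊥L ∷ oL) with dichotomy hv hw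
    ... | inj₁ eq = record
          { list = (c ℤ.+ d , w) ∷ L ; primitives = hw ∷ hL ; orthogonal = w⊥L ∷ oL
          ; value≡ = λ u hu → trans (cong (_+ value L u) (trans (cong (_* χ w u) (ι-+ c d))
              (trans (distribʳ _ _ _) (cong (λ h → ι c * h + ι d * χ w u) (sym (eq u hu)))))) (+-assoc _ _ _) } ,
        λ { y _ (yw ∷ yL) → yw ∷ yL }
    ... | inj₂ v⊥w = record
          { list = (d , w) ∷ O.list ; primitives = hw ∷ O.primitives
          ; orthogonal = proj₂ rest w (trans (⟪⟫-comm _ _) v⊥w) w⊥L ∷ O.orthogonal
          ; value≡ = λ u hu → trans (cong (ι d * χ w u +_) (O.value≡ u hu))
              (solve 3 (λ a b c → a :+ (b :+ c) := b :+ (a :+ c)) refl (ι d * χ w u) (ι c * χ v u) (value L u)) } ,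
        λ { y yv (yw ∷ yL) → yw ∷ proj₂ rest y yv yL }
      where
      rest = insert c v L hv hL oL
      module O = Orthogonalised (proj₁ rest)

    orthogonalise : ∀ L → Primitives L → Orthogonalised (value L)
    orthogonalise [] [] = record { list = [] ; primitives = [] ; orthogonal = [] ; value≡ = λ _ _ → refl }
    orthogonalise ((c , v) ∷ L) (hv ∷ hL) = record
      { list = O′.list ; primitives = O′.primitives ; orthogonal = O′.orthogonal
      ; value≡ = λ u hu → trans (O′.value≡ u hu) (cong (ι c * χ v u +_) (O.value≡ u hu)) }
      where
      module O = Orthogonalised (orthogonalise L hL)
      module O′ = Orthogonalised (proj₁ (insert c v O.list hv O.primitives O.orthogonal))

    ⟪⟫-value : ∀ f L → ⟪ f , value L ⟫ ≡ ∑ᴸ (λ (c , v) → ι c * ⟪ f , χ v ⟫) L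
    ⟪⟫-value f [] = ⟪⟫-0 f
    ⟪⟫-value f ((c , v) ∷ L) = trans (⟪⟫-+ f _ _) (cong₂ _+_ (⟪⟫-* f (ι c) (χ v)) (⟪⟫-value f L))

    ⊥-value : ∀ {v L} → v ⊥ L → ⟪ χ v , value L ⟫ ≡ 0#
    ⊥-value {v} {L} h = trans (⟪⟫-value (χ v) L) (go h)
      where
      go : ∀ {L} → v ⊥ L → ∑ᴸ (λ (c , y) → ι c * ⟪ χ v , χ y ⟫) L ≡ 0#
      go [] = refl
      go {(c , y) ∷ L} (e ∷ h) = trans (cong₂ _+_ (trans (cong (ι c *_) e) (zeroʳ _)) (go h)) (+-identityˡ 0#)

    coefficients : ∀ {L} → Orthogonal L → All (λ (c , v) → ⟪ χ v , value L ⟫ ≡ ι c * ⟪ χ v , χ v ⟫) L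
    coefficients [] = []
    coefficients {(c , v) ∷ L} (v⊥L ∷ oL) =
      trans (⟪⟫-+ _ _ _) (trans (cong₂ _+_ (⟪⟫-* _ _ _) (⊥-value v⊥L)) (+-identityʳ _)) ∷
      combine (coefficients oL) v⊥L
      where
      combine : ∀ {L′} → All (λ (d , y) → ⟪ χ y , value L ⟫ ≡ ι d * ⟪ χ y , χ y ⟫) L′ → v ⊥ L′ →
                All (λ (d , y) → ⟪ χ y , value ((c , v) ∷ L) ⟫ ≡ ι d * ⟪ χ y , χ y ⟫) L′
      combine [] [] = []
      combine (h ∷ hs) (o ∷ os) = trans (⟪⟫-+ _ _ _) (trans (cong₂ _+_
        (trans (⟪⟫-* _ _ _) (trans (cong (ι c *_) (trans (⟪⟫-comm _ _) o)) (zeroʳ _))) h)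
            (+-identityˡ _)) ∷ combine hs os

    -- c is an integer multiplicity counted in units of ⟪χ v , χ v⟫, and z the same quantity in units of e.
    Balanced : F → ℤ × Mat m → Set
    Balanced e (c , v) = Primitive U v × ∃ λ z → ι c * ⟪ χ v , χ v ⟫ ≡ ι z * e

    weight : ∀ {e L} → All (Balanced e) L → ℤ
    weight [] = ℤ.+ 0
    weight {L = (c , _) ∷ _} ((_ , z , _) ∷ h) = c ℤ.* z ℤ.+ weight h

    module _ {e : F} (0<e : 0# < e) where

      -- The source of positivity: `c` and `z` are signed integers, but their product times `e` is a
      -- square times a norm.
      weight-head : ∀ {c v} (b : Balanced e (c , v)) → ι (c ℤ.* proj₁ (proj₂ b)) * e ≡ (ι c * ι c) * ⟪ χ v , χ v ⟫
      weight-head {c} {v} (hv , z , eq) = trans (cong (_* e) (ι-* c z)) (trans (*-assoc _ _ _)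
        (trans (cong (ι c *_) (sym eq)) (sym (*-assoc _ _ _))))

      head-nonneg : ∀ {c v} (b : Balanced e (c , v)) → ℤ.+ 0 ℤ.≤ c ℤ.* proj₁ (proj₂ b)
      head-nonneg {c} {v} b@(hv , z , _) with ≤-total 0# (ι (c ℤ.* z))
      ... | inj₁ h = ι-0≤ h
      ... | inj₂ h = ι-0≤ (subst (0# ≤_) (sym t≡0) ≤-refl)
        where
        t = ι (c ℤ.* z)
        0≤te : 0# ≤ t * e
        0≤te = subst (0# ≤_) (sym (weight-head b)) (0≤* (0≤sq _) (<⇒≤ (⟪⟫-pos (χ v) (χ≢0 hv))))
        te≤0 : t * e ≤ 0#
        te≤0 = 0≤-⇒≤ (subst (0# ≤_) (trans (solve 3 (λ o t e → (o :- t) :* e := o :* e :- t :* e) refl 0# t e)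
          (cong (_- t * e) (zeroˡ e))) (0≤* (≤⇒0≤- h) (<⇒≤ 0<e)))
        t≡0 : t ≡ 0#
        t≡0 = *-integral (trans (*-comm e t) (≤-antisym te≤0 0≤te)) (0<⇒≢0 0<e)

      head-zero : ∀ {c v} (b : Balanced e (c , v)) → c ℤ.* proj₁ (proj₂ b) ≡ ℤ.+ 0 → ι c ≡ 0#
      head-zero {c} {v} b@(hv , z , _) h = sq≡0 (*-integral (trans (*-comm _ _) (trans (sym (weight-head b))
        (trans (cong (λ t → ι t * e) h) (trans (cong (_* e) ι-0) (zeroˡ e))))) (0<⇒≢0 (⟪⟫-pos (χ v) (χ≢0 hv))))

      weight-nonneg : ∀ {L} (h : All (Balanced e) L) → ℤ.+ 0 ℤ.≤ weight h
      weight-nonneg [] = ℤₚ.≤-refl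
      weight-nonneg (b ∷ h) = ℤₚ.+-mono-≤ (head-nonneg b) (weight-nonneg h)

      ℤ-sum-zero : ∀ {s t} → ℤ.+ 0 ℤ.≤ s → ℤ.+ 0 ℤ.≤ t → s ℤ.+ t ≡ ℤ.+ 0 → s ≡ ℤ.+ 0 × t ≡ ℤ.+ 0
      ℤ-sum-zero {ℤ.+ zero} {ℤ.+ zero} _ _ _ = refl , refl

      ℤ-sum-one : ∀ {s t} → ℤ.+ 0 ℤ.≤ s → ℤ.+ 0 ℤ.≤ t → s ℤ.+ t ≡ ℤ.+ 1 →
                  (s ≡ ℤ.+ 0 × t ≡ ℤ.+ 1) ⊎ (s ≡ ℤ.+ 1 × t ≡ ℤ.+ 0)
      ℤ-sum-one {ℤ.+ zero} {ℤ.+ t} _ _ h = inj₁ (refl , h)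
      ℤ-sum-one {ℤ.+ suc zero} {ℤ.+ zero} _ _ _ = inj₂ (refl , refl)

      value-zero : ∀ {L} (h : All (Balanced e) L) → weight h ≡ ℤ.+ 0 → ∀ g → value L g ≡ 0#
      value-zero [] _ g = refl
      value-zero {(c , v) ∷ L} (b ∷ h) w g with ℤ-sum-zero (head-nonneg b) (weight-nonneg h) w
      ... | t≡0 , w≡0 = trans (cong₂ _+_ (trans (cong (_* χ v g) (head-zero b t≡0)) (zeroˡ _))
          (value-zero h w≡0 g)) (+-identityˡ 0#)

      -- Non-negative integers adding up to 1: a single product `c * z` is 1, which makes `c` a unit
      -- of ℤ, and in all other terms `c` is 0 because the norms are positive.
      value-one : ∀ {L} (h : All (Balanced e) L) → weight h ≡ ℤ.+ 1 →
                  ∃ λ v → Primitive U v × ((∀ g → value L g ≡ χ v g) ⊎ (∀ g → value L g ≡ - χ v g))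
      value-one {(c , v) ∷ L} (b ∷ h) w with ℤ-sum-one (head-nonneg b) (weight-nonneg h) w
      ... | inj₁ (t≡0 , w≡1) = let y , hy , eq = value-one h w≡1 in y , hy , map⊎ (skip _) (skip _) eq
        where
        skip : ∀ (f : Fin m → F) → (∀ g → value L g ≡ f g) → ∀ g → value ((c , v) ∷ L) g ≡ f g
        skip f k g = trans (cong₂ _+_ (trans (cong (_* χ v g) (head-zero b t≡0)) (zeroˡ _)) (k g)) (+-identityˡ _)
      ... | inj₂ (t≡1 , w≡0) = v , proj₁ b , map⊎
          (λ c≡1 g → last g _ (trans (cong (λ h → ι h * χ v g) c≡1) (trans (cong (_* χ v g) ι-1) (*-identityˡ _))))
          (λ c≡-1 g → last g _ (trans (cong (λ h → ι h * χ v g) c≡-1)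
              (trans (cong (_* χ v g) (trans (ι-neg (ℤ.+ 1)) (cong -_ ι-1)))
            (negate (χ v g)))))
          (ℤ-unit c (proj₁ (proj₂ b)) t≡1)
        where
        last : ∀ g r → ι c * χ v g ≡ r → value ((c , v) ∷ L) g ≡ r
        last g r k = trans (cong₂ _+_ k (value-zero h w≡0 g)) (+-identityʳ _)
        negate : ∀ q → - 1# * q ≡ - q
        negate q = trans (solve 2 (λ o q → (:- o) :* q := :- (o :* q)) refl 1# q) (cong -_ (*-identityˡ q))

      weight-sum : ∀ {L f} (h : All (Balanced e) L) → All (λ (c , v) → ⟪ f , χ v ⟫ ≡ ι c * ⟪ χ v , χ v ⟫) L →
                   ∑ᴸ (λ (c , v) → ι c * ⟪ f , χ v ⟫) L ≡ ι (weight h) * e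
      weight-sum [] [] = trans (sym (zeroˡ e)) (cong (_* e) (sym ι-0))
      weight-sum {(c , v) ∷ L} {f} ((hv , z , eq) ∷ h) (k ∷ ks) = begin
        ι c * ⟪ f , χ v ⟫ + _          ≡⟨ cong₂ _+_ (cong (ι c *_) (trans k eq)) (weight-sum h ks) ⟩
        ι c * (ι z * e) + ι (weight h) * e  ≡⟨ solve 4 (λ c z e w → c :* (z :* e) :+ w :* e :=
            (c :* z :+ w) :* e) refl (ι c) (ι z) e (ι (weight h)) ⟩
        (ι c * ι z + ι (weight h)) * e  ≡⟨ cong (_* e) (trans (cong (_+ ι (weight h)) (sym (ι-* c z)))
            (sym (ι-+ _ _))) ⟩
        ι (c ℤ.* z ℤ.+ weight h) * e   ∎
        where open ≡-Reasoning

      -- Pairing with `χ v` gives `c * ⟪ χ v , χ v ⟫`, by orthogonality, and also a multiple of `e`,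
      -- so every term is balanced. Expanding `⟪ f , f ⟫` then gives the weight times `e`, and the
      -- norm condition makes the weight 1.
      irreducible : ∀ {L f} → Primitives L → (∀ u → u ∈ U → f u ≡ value L u) → ⟪ f , f ⟫ ≡ e →
                    (∀ v → Primitive U v → ∃ λ z → ⟪ f , χ v ⟫ ≡ ι z * e) →
                    ∃ λ v → Primitive U v × ((∀ u → u ∈ U → f u ≡ χ v u) ⊎ (∀ u → u ∈ U → f u ≡ - χ v u))
      irreducible {L} {f} hL f≡ norm integral =
        let v , hv , eq = value-one balanced weight≡1 in
        v , hv , map⊎ (λ k u hu → trans (f≡O u hu) (k u)) (λ k u hu → trans (f≡O u hu) (k u)) eq
        where
        open Orthogonalised (orthogonalise L hL)
        f≡O : ∀ u → u ∈ U → f u ≡ value list u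
        f≡O u hu = trans (f≡ u hu) (sym (value≡ u hu))
        coeffs : All (λ (c , v) → ⟪ f , χ v ⟫ ≡ ι c * ⟪ χ v , χ v ⟫) list
        coeffs = All.map (λ {(c , v)} k → trans (⟪⟫-comm _ _) (trans (⟪⟫-cong (λ _ _ → refl) f≡O) k))
            (coefficients orthogonal)
        balanced : All (Balanced e) list
        balanced = All.map (λ {(c , v)} (hv , k) → let z , ez = integral v hv in hv , z , trans (sym k) ez) (All.zip (primitives , coeffs))
        weight≡1 : weight balanced ≡ ℤ.+ 1
        weight≡1 = ι-injective (*-cancelˡ (0<⇒≢0 0<e) (begin
          e * ι (weight balanced)                             ≡⟨ *-comm _ _ ⟩
          ι (weight balanced) * e                             ≡⟨ sym (weight-sum balanced coeffs) ⟩
          ∑ᴸ (λ (c , v) → ι c * ⟪ f , χ v ⟫) list             ≡⟨ sym (⟪⟫-value f list) ⟩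
          ⟪ f , value list ⟫                                  ≡⟨ ⟪⟫-cong (λ _ _ → refl) (λ u hu → sym (f≡O u hu)) ⟩
          ⟪ f , f ⟫                                           ≡⟨ norm ⟩
          e                                                   ≡⟨ sym (*-identityʳ e) ⟩
          e * 1#                                              ≡⟨ cong (e *_) (sym ι-1) ⟩
          e * ι (ℤ.+ 1)                                       ∎))
          where open ≡-Reasoning

-- Frobenius: the kernel of a malnormal subgroup is closed under products.

module FrobeniusTheorem {m : ℕ} (G : FinGroup m) (H : Sub m) (isH : FinGroup.IsSub G H)
    (malnormal : FinGroup.Malnormal G H) where

  open import Data.Nat using (ℕ; zero)

  open import Data.Integer as ℤ using (ℤ)
  open import Data.Vec using ([]; _∷_)
  open import Data.List as List using (List; []; _∷_; _++_)
  open import Data.List.Relation.Unary.All as All using (All; []; _∷_)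
  import Data.List.Relation.Unary.All.Properties as Allₚ
  open RationalField
  open RationalSums
  open Matrices
  open FinGroup G
  open PrimitiveIdempotents G
  open Characters G
  open VirtualCharacters G

  private
    module 𝐇 where
      open Subgroup H isH public
      open Subgroup₂ H isH public
    module 𝐆 where
      open Subgroup full full-isSub public
      open Subgroup₂ full full-isSub public
      open Combinations full full-isSub public

  open IsSub isH

  -- A representation of H inside the functions on H, extended by zero to functions on G.
  record OnH (w : Mat m) : Set where
    field
      si : SI H w
      support : ∀ i j → i ∉ H → w ⟨ i , j ⟩ ≡ 0#
    open SI si public

  module Induced {w : Mat m} (hw : OnH w) where
    open OnH hw

    -- By invariance `w` is a convolution operator on `H`, determined by its row at `ε`; `ŵ` is the
    -- convolution kernel.
    ŵ : Fin m → F
    ŵ t = w ⟨ ε , t ⟩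

    swap : ∀ i j → w ⟨ i , j ⟩ ≡ w ⟨ j , i ⟩
    swap i j = trans (sym (ᵀ-entry w j i)) (cong (_⟨ j , i ⟩) symmetric)

    ŵ-∉ : ∀ {t} → t ∉ H → ŵ t ≡ 0#
    ŵ-∉ {t} ht = trans (swap ε t) (support t ε ht)

    ŵ-row : ∀ {s} t → s ∈ H → ŵ (s ⁻¹ ∙ t) ≡ w ⟨ s , t ⟩
    ŵ-row {s} t hs = trans (sym (invariant-entry {w} invariant hs ε (s ⁻¹ ∙ t)))
      (cong₂ (λ p q → w ⟨ p , q ⟩) (identityʳ s) (x∙x⁻¹y s t))

    ŵ-⁻¹ : ∀ t → ŵ (t ⁻¹) ≡ ŵ t
    ŵ-⁻¹ t with t ∈? H
    ... | yes ht = trans (cong ŵ (sym (identityʳ (t ⁻¹)))) (trans (ŵ-row ε ht) (swap t ε))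
    ... | no nt = trans (ŵ-∉ λ h → nt (subst (_∈ H) (⁻¹-involutive t) (⁻¹∈ h))) (sym (ŵ-∉ nt))

    -- The same convolution kernel used on all of `G`. Its image is the induced representation,
    -- obtained without choosing coset representatives.
    induced : Mat m
    induced = mat λ i j → ŵ (i ⁻¹ ∙ j)

    induced-entry : ∀ i j → induced ⟨ i , j ⟩ ≡ ŵ (i ⁻¹ ∙ j)
    induced-entry = mat-entry _

    induced-si : SI full induced
    induced-si = record
      { symmetric = ext λ i j → trans (ᵀ-entry _ i j) (trans (induced-entry j i) (trans (sym (ŵ-⁻¹ _))
          (trans (cong ŵ (solveᴳ (i ∷ j ∷ []) ((a₁ :⁻¹ :∙ a₀) :⁻¹) (a₀ :⁻¹ :∙ a₁) refl)) (sym (induced-entry i j)))))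
      ; idempotent = ext λ i j → trans (·-entry _ _ i j)
          (trans (∑-cong λ k → cong₂ _*_ (induced-entry i k) (induced-entry k j))
          (trans (∑-translate i _) (trans (∑-cong (term i j)) (trans (sym (·-entry w w ε (i ⁻¹ ∙ j)))
            (trans (cong (_⟨ ε , i ⁻¹ ∙ j ⟩) idempotent) (sym (induced-entry i j)))))))
      ; invariant = λ u _ → ext λ i j → trans (shift-entry u _ i j) (trans (induced-entry _ _)
          (trans (cong ŵ (solveᴳ (u ∷ i ∷ j ∷ []) ((a₀ :∙ a₁) :⁻¹ :∙ (a₀ :∙ a₂)) (a₁ :⁻¹ :∙ a₂) refl))
              (sym (induced-entry i j)))) }
      where
      -- `ŵ` vanishes outside `H`, so the sum over `G` is the product `w · w` read in the row of
      -- `ε`.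
      term : ∀ i j s → ŵ (i ⁻¹ ∙ (i ∙ s)) * ŵ ((i ∙ s) ⁻¹ ∙ j) ≡ w ⟨ ε , s ⟩ * w ⟨ s , i ⁻¹ ∙ j ⟩
      term i j s with s ∈? H
      ... | yes hs = cong₂ _*_ (cong ŵ (x⁻¹∙xy i s)) (trans (cong ŵ
        (solveᴳ (i ∷ s ∷ j ∷ []) ((a₀ :∙ a₁) :⁻¹ :∙ a₂) (a₁ :⁻¹ :∙ (a₀ :⁻¹ :∙ a₂)) refl)) (ŵ-row (i ⁻¹ ∙ j) hs))
      ... | no ns = trans (cong (_* ŵ ((i ∙ s) ⁻¹ ∙ j)) (trans (cong ŵ (x⁻¹∙xy i s)) (ŵ-∉ ns)))
        (trans (zeroˡ _) (sym (trans (cong (_* w ⟨ s , i ⁻¹ ∙ j ⟩) (ŵ-∉ ns)) (zeroˡ _))))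

    χ-induced : ∀ g → χ induced g ≡ ∑ λ x → ŵ (g ^ x)
    χ-induced g = ∑-cong λ x → trans (induced-entry x (g ∙ x)) (cong ŵ (sym (assoc _ _ _)))

    -- Gives `χ w` the shape of `χ-induced`, with the conjugating elements confined to `H`. So
    -- `reciprocity` covers both, and the two characters differ only in the terms with `x ∉ H`.
    χ-H : ∀ h → h ∈ H → χ w h ≡ ∑ λ x → 𝟙[ H ] x * ŵ (h ^ x)
    χ-H h hh = ∑-cong term
      where
      term : ∀ x → w ⟨ x , h ∙ x ⟩ ≡ 𝟙[ H ] x * ŵ (h ^ x)
      term x with x ∈? H
      ... | yes hx = sym (trans (cong (_* ŵ (h ^ x)) (𝟙-∈ {H} hx))
          (trans (*-identityˡ _) (trans (cong ŵ (assoc _ _ _)) (ŵ-row (h ∙ x) hx))))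
      ... | no nx = trans (support x _ nx) (sym (trans (cong (_* ŵ (h ^ x)) (𝟙-∉ {H} nx)) (zeroˡ _)))

    module _ (U : Sub m) (isU : IsSub U) (H⊆U : H ⊆ U) where
      open Subgroup U isU

      -- Frobenius reciprocity, simultaneously for G (induction) and for H itself.
      reciprocity : ∀ f → Class U f → ⟪ (λ u → ∑ λ x → 𝟙[ U ] x * ŵ (u ^ x)) , f ⟫ ≡ ∑ λ t → ŵ t * f t
      reciprocity f hf = begin
        ∣U∣⁻¹ * ∑ (λ u → 𝟙[ U ] u * (∑ (λ x → 𝟙[ U ] x * ŵ (u ^ x)) * f u))
          ≡⟨ cong (∣U∣⁻¹ *_) (∑-cong λ u → trans (cong (𝟙[ U ] u *_) (*-distribʳ-∑ _ _)) (*-distribˡ-∑ _ _)) ⟩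
        ∣U∣⁻¹ * ∑ (λ u → ∑ λ x → 𝟙[ U ] u * (𝟙[ U ] x * ŵ (u ^ x) * f u))
          ≡⟨ cong (∣U∣⁻¹ *_) (∑-comm _) ⟩
        ∣U∣⁻¹ * ∑ (λ x → ∑ λ u → 𝟙[ U ] u * (𝟙[ U ] x * ŵ (u ^ x) * f u))
          ≡⟨ cong (∣U∣⁻¹ *_) (∑-cong λ x → trans (∑-cong λ u →
               solve 4 (λ a b c d → a :* (b :* c :* d) := b :* (a :* (c :* d))) refl (𝟙[ U ] u) (𝟙[ U ] x)
                   (ŵ (u ^ x)) (f u))
               (trans (sym (*-distribˡ-∑ _ _)) (𝟙-cong-* U x (conjugate x)))) ⟩
        ∣U∣⁻¹ * ∑ (λ x → 𝟙[ U ] x * ∑ λ t → ŵ t * f t)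
          ≡⟨ cong (∣U∣⁻¹ *_) (sym (*-distribʳ-∑ _ _)) ⟩
        ∣U∣⁻¹ * (∣ U ∣ * ∑ λ t → ŵ t * f t)
          ≡⟨ trans (sym (*-assoc _ _ _)) (trans (cong (_* ∑ (λ t → ŵ t * f t)) ∣U∣⁻¹∣U∣) (*-identityˡ _)) ⟩
        ∑ (λ t → ŵ t * f t) ∎
        where
        open ≡-Reasoning
        conjugate : ∀ x → x ∈ U → ∑ (λ u → 𝟙[ U ] u * (ŵ (u ^ x) * f u)) ≡ ∑ λ t → ŵ t * f t
        conjugate x hx = trans
          (∑-reindex _ (_^ (x ⁻¹)) (_^ x)
            (λ u → solveᴳ (x ∷ u ∷ []) ((a₀ :⁻¹) :⁻¹ :∙ (a₀ :⁻¹ :∙ a₁ :∙ a₀) :∙ a₀ :⁻¹) a₁ refl)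
            (λ u → back u))
          (∑-cong λ t → term t (t ∈? H))
          where
          back : ∀ u → (u ^ (x ⁻¹)) ^ x ≡ u
          back u = solveᴳ (x ∷ u ∷ []) (a₀ :⁻¹ :∙ ((a₀ :⁻¹) :⁻¹ :∙ a₁ :∙ a₀ :⁻¹) :∙ a₀) a₁ refl
          conj∈ : ∀ {t y} → y ∈ U → t ∈ U → t ^ y ∈ U
          conj∈ hy ht = IsSub.∙∈ isU (IsSub.∙∈ isU (IsSub.⁻¹∈ isU hy) ht) hy
          term : ∀ t → Dec (t ∈ H) → 𝟙[ U ] (t ^ (x ⁻¹)) * (ŵ ((t ^ (x ⁻¹)) ^ x) * f (t ^ (x ⁻¹))) ≡ ŵ t * f t
          term t (yes ht) = trans (cong₂ _*_ (𝟙-∈ {U} (conj∈ (IsSub.⁻¹∈ isU hx) (H⊆U t ht)))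
              (cong₂ _*_ (cong ŵ (back t)) (hf (x ⁻¹) t (IsSub.⁻¹∈ isU hx)))) (*-identityˡ _)
          term t (no nt) = trans (cong (𝟙[ U ] (t ^ (x ⁻¹)) *_)
              (trans (cong (_* f (t ^ (x ⁻¹))) (trans (cong ŵ (back t)) (ŵ-∉ nt))) (zeroˡ _)))
            (trans (zeroʳ _) (sym (trans (cong (_* f t) (ŵ-∉ nt)) (zeroˡ _))))

    ⟪induced⟫ : ∀ f → Class full f → 𝐆.⟪ χ induced , f ⟫ ≡ 𝐇.⟪ χ w , f ⟫
    ⟪induced⟫ f hf = trans (𝐆.⟪⟫-cong (λ u _ → trans (χ-induced u) (∑-cong λ x → sym (*-identityˡ _))) (λ _ _ → refl))
      (trans (reciprocity full full-isSub (λ _ _ → refl) f hf)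
        (sym (trans (𝐇.⟪⟫-cong (λ u hu → χ-H u hu) (λ _ _ → refl))
          (reciprocity H isH (λ _ h → h) f (λ x u _ → hf x u refl)))))

    -- Malnormality enters here: conjugating `h` by an element outside `H` leaves `H`, where `ŵ` is
    -- 0.
    χ-induced-H : ∀ h → h ∈ H → h ≢ ε → χ induced h ≡ χ w h
    χ-induced-H h hh h≢ε = trans (χ-induced h) (trans (∑-cong term) (sym (χ-H h hh)))
      where
      term : ∀ x → ŵ (h ^ x) ≡ 𝟙[ H ] x * ŵ (h ^ x)
      term x with x ∈? H
      ... | yes hx = sym (trans (cong (_* ŵ (h ^ x)) (𝟙-∈ {H} hx)) (*-identityˡ _))
      ... | no nx = trans (ŵ-∉ λ k → h≢ε (malnormal x h nx hh k))
          (sym (trans (cong (_* ŵ (h ^ x)) (𝟙-∉ {H} nx)) (zeroˡ _)))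

    χ-induced-∉ : ∀ g → (∀ x → g ^ x ∉ H) → χ induced g ≡ 0#
    χ-induced-∉ g h = trans (χ-induced g) (∑-0 λ x → ŵ-∉ (h x))

    ε^ : ∀ x → ε ^ x ≡ ε
    ε^ x = solveᴳ (x ∷ []) (a₀ :⁻¹ :∙ :ε :∙ a₀) :ε refl

    χ-induced-ε : χ induced ε ≡ ∣ full ∣ * ŵ ε
    χ-induced-ε = trans (χ-induced ε) (trans (∑-cong λ x → trans (cong ŵ (ε^ x)) (sym (*-identityˡ _)))
        (sym (*-distribʳ-∑ _ _)))

    χ-H-ε : χ w ε ≡ ∣ H ∣ * ŵ ε
    χ-H-ε = trans (χ-H ε ε∈) (trans (∑-cong λ x → cong (𝟙[ H ] x *_) (cong ŵ (ε^ x))) (sym (*-distribʳ-∑ _ _)))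

  trivial-onH : OnH 𝐇.trivial
  trivial-onH = record { si = 𝐇.trivial-si ; support = λ i j ni → trans (𝐇.trivial-entry i j)
    (trans (cong (𝐇.∣U∣⁻¹ *_) (trans (cong (_* 𝟙[ H ] j) (𝟙-∉ {H} ni)) (zeroˡ _))) (zeroʳ _)) }

  -- The regular representation of `H`, with character `∣ H ∣` at `ε` and 0 elsewhere. It detects
  -- degrees in `degree-multiple` and separates `ε` from other elements in `kernel-∙`.
  identityᴴ : Mat m
  identityᴴ = mat λ i j → 𝟙[ H ] i * (if does (i Fin.≟ j) then 1# else 0#)

  private
    δ : Fin m → Fin m → F
    δ i j = if does (i Fin.≟ j) then 1# else 0#
    δ-refl : ∀ i → δ i i ≡ 1#
    δ-refl i = cong (if_then 1# else 0#) (dec-true (i Fin.≟ i) refl)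
    δ-≢ : ∀ {i j} → i ≢ j → δ i j ≡ 0#
    δ-≢ {i} {j} ne with i Fin.≟ j
    ... | yes e = contradiction e ne
    ... | no _ = refl

  identityᴴ-entry : ∀ i j → identityᴴ ⟨ i , j ⟩ ≡ 𝟙[ H ] i * δ i j
  identityᴴ-entry = mat-entry _

  identityᴴ-· : ∀ a i j → (identityᴴ · a) ⟨ i , j ⟩ ≡ 𝟙[ H ] i * a ⟨ i , j ⟩
  identityᴴ-· a i j = trans (·-entry _ a i j) (trans (∑-single _ i λ k ne →
      trans (cong (_* a ⟨ k , j ⟩) (trans (identityᴴ-entry i k) (trans (cong (𝟙[ H ] i *_) (δ-≢ (ne ∘ sym)))
          (zeroʳ _)))) (zeroˡ _))
    (cong (_* a ⟨ i , j ⟩) (trans (identityᴴ-entry i i) (trans (cong (𝟙[ H ] i *_) (δ-refl i)) (*-identityʳ _)))))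

  identityᴴ-si : SI H identityᴴ
  identityᴴ-si = record
    { symmetric = ext λ i j → trans (ᵀ-entry _ i j)
        (trans (identityᴴ-entry j i) (trans (flip i j (i Fin.≟ j)) (sym (identityᴴ-entry i j))))
    ; idempotent = ext λ i j → trans (identityᴴ-· identityᴴ i j) (trans (cong (𝟙[ H ] i *_) (identityᴴ-entry i j))
        (trans (sym (*-assoc _ _ _)) (trans (cong (_* δ i j) (𝐇.𝟙𝟙 i)) (sym (identityᴴ-entry i j)))))
    ; invariant = λ u hu → ext λ i j → trans (shift-entry u _ i j) (trans (identityᴴ-entry _ _)
        (trans (cong₂ _*_ (cong (if_then 1# else 0#) (𝐇.∈-translate hu i)) (δ-translate u i j (i Fin.≟ j)))
            (sym (identityᴴ-entry i j)))) }
    where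
    flip : ∀ i j → Dec (i ≡ j) → 𝟙[ H ] j * δ j i ≡ 𝟙[ H ] i * δ i j
    flip i j (yes refl) = refl
    flip i j (no ne) = trans (cong (𝟙[ H ] j *_) (δ-≢ (ne ∘ sym)))
        (trans (zeroʳ _) (sym (trans (cong (𝟙[ H ] i *_) (δ-≢ ne)) (zeroʳ _))))
    δ-translate : ∀ u i j → Dec (i ≡ j) → δ (u ∙ i) (u ∙ j) ≡ δ i j
    δ-translate u i j (yes refl) = trans (δ-refl (u ∙ i)) (sym (δ-refl i))
    δ-translate u i j (no ne) = trans (δ-≢ (ne ∘ ∙-cancelˡ u)) (sym (δ-≢ ne))

  χ-identityᴴ-ε : χ identityᴴ ε ≡ ∣ H ∣
  χ-identityᴴ-ε = ∑-cong λ i → trans (cong (identityᴴ ⟨ i ,_⟩) (identityˡ i))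
    (trans (identityᴴ-entry i i) (trans (cong (𝟙[ H ] i *_) (δ-refl i)) (*-identityʳ _)))

  χ-identityᴴ-≢ : ∀ {h} → h ≢ ε → χ identityᴴ h ≡ 0#
  χ-identityᴴ-≢ {h} ne = ∑-0 λ i → trans (identityᴴ-entry i (h ∙ i)) (trans (cong (𝟙[ H ] i *_) (δ-≢ (moved i)))
      (zeroʳ _))
    where
    moved : ∀ i → i ≢ h ∙ i
    moved i e = ne (trans (solveᴳ (h ∷ i ∷ []) a₀ (a₀ :∙ a₁ :∙ a₁ :⁻¹) refl)
        (trans (cong (_∙ i ⁻¹) (sym e)) (inverseʳ i)))

  -- The inner product of `χ w` with the regular character is the degree of `w`.
  degree-multiple : ∀ {w} → Primitive H w → ∃ λ z → χ w ε ≡ ι z * 𝐇.⟪ χ w , χ w ⟫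
  degree-multiple {w} hw = let z , e = 𝐇.multiplicity hw identityᴴ-si in z , trans (sym regular) e
    where
    regular : 𝐇.⟪ χ w , χ identityᴴ ⟫ ≡ χ w ε
    regular = trans (cong (𝐇.∣U∣⁻¹ *_) (trans (∑-single _ ε λ u ne →
          trans (cong (λ h → 𝟙[ H ] u * (χ w u * h)) (χ-identityᴴ-≢ ne)) (trans (cong (𝟙[ H ] u *_) (zeroʳ _))
              (zeroʳ _)))
        (trans (cong₂ _*_ (𝟙-∈ {H} ε∈) (cong (χ w ε *_) χ-identityᴴ-ε)) (*-identityˡ _))))
      (trans (solve 3 (λ a b c → a :* (b :* c) := b :* (a :* c)) refl 𝐇.∣U∣⁻¹ (χ w ε) ∣ H ∣)
        (trans (cong (χ w ε *_) 𝐇.∣U∣⁻¹∣U∣) (*-identityʳ _)))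

  private module E = Induced trivial-onH

  -- Θ is the extension of χ w to G that is constant on the kernel, written as a virtual character.
  module Extension {w : Mat m} (hw : OnH w) where
    private module W = Induced hw

    d : F
    d = χ w ε

    Θ : Fin m → F
    Θ g = χ W.induced g - d * χ E.induced g + d

    Θ-class : Class full Θ
    Θ-class x u hx = cong₂ (λ p q → p - d * q + d) (χ-class (SI.invariant W.induced-si) x u hx)
        (χ-class (SI.invariant E.induced-si) x u hx)

    Θ-H : ∀ h → h ∈ H → Θ h ≡ χ w h
    Θ-H h hh with h Fin.≟ ε
    ... | no ne = trans (cong₂ (λ p q → p - d * q + d) (W.χ-induced-H h hh ne)
                    (trans (E.χ-induced-H h hh ne) (𝐇.χ-trivial h hh)))
                  (trans (cong (λ q → χ w h - q + d) (*-identityʳ d)) (solve 2 (λ a b → a :- b :+ b := a) refl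
                      (χ w h) d))
    -- At `ε` the induced characters cancel: with `d` equal to `∣ H ∣ * ŵ ε`, both terms are
    -- `∣ full ∣ * ŵ ε`.
    ... | yes refl = trans (cong (_+ d) (trans (cong₂ (λ p q → p - d * q) W.χ-induced-ε
            (trans E.χ-induced-ε (cong (∣ full ∣ *_) 𝐇.trivial-εε)))
          (trans (cong (λ q → ∣ full ∣ * W.ŵ ε - q * (∣ full ∣ * 𝐇.∣U∣⁻¹)) W.χ-H-ε)
            (trans (solve 4 (λ g w h c → g :* w :- h :* w :* (g :* c) := g :* w :- (g :* w) :* (c :* h)) refl
                (∣ full ∣) (W.ŵ ε) (∣ H ∣) 𝐇.∣U∣⁻¹)
              (trans (cong (λ q → ∣ full ∣ * W.ŵ ε - ∣ full ∣ * W.ŵ ε * q) 𝐇.∣U∣⁻¹∣U∣)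
                (trans (cong (λ q → ∣ full ∣ * W.ŵ ε - q) (*-identityʳ _)) (-‿inverseʳ _)))))))
          (+-identityˡ d)

    Θ-kernel : ∀ k → k ∈ᴷ H → Θ k ≡ d
    Θ-kernel k (inj₁ refl) = Θ-H k ε∈
    Θ-kernel k (inj₂ h) = trans (cong₂ (λ p q → p - d * q + d) (W.χ-induced-∉ k h) (E.χ-induced-∉ k h))
      (trans (cong (λ q → 0# - q + d) (zeroʳ d)) (trans (cong (_+ d) (-‿inverseʳ 0#)) (+-identityˡ d)))

    ⟪Θ⟫ : ∀ f → Class full f → 𝐆.⟪ f , Θ ⟫ ≡ 𝐇.⟪ χ w , f ⟫ - d * 𝐇.⟪ (λ _ → 1#) , f ⟫ + d * 𝐆.⟪ (λ _ → 1#) , f ⟫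
    ⟪Θ⟫ f hf = begin
      𝐆.⟪ f , Θ ⟫
        ≡⟨ 𝐆.⟪⟫-cong (λ _ _ → refl) (λ u _ → solve 4 (λ a d b o → a :- d :* b :+ d := a :+ ((:- d) :* b :+ d)) refl
            (χ W.induced u) d (χ E.induced u) 1#) ⟩
      𝐆.⟪ f , (λ u → χ W.induced u + (- d * χ E.induced u + d)) ⟫
        ≡⟨ trans (𝐆.⟪⟫-+ f _ _) (cong (𝐆.⟪ f , χ W.induced ⟫ +_) (trans (𝐆.⟪⟫-+ f _ _)
             (cong₂ _+_ (𝐆.⟪⟫-* f (- d) (χ E.induced))
                 (trans (𝐆.⟪⟫-cong (λ _ _ → refl) (λ u _ → sym (*-identityʳ d))) (𝐆.⟪⟫-* f d (λ _ → 1#)))))) ⟩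
      𝐆.⟪ f , χ W.induced ⟫ + (- d * 𝐆.⟪ f , χ E.induced ⟫ + d * 𝐆.⟪ f , (λ _ → 1#) ⟫)
        ≡⟨ solve 4 (λ a d b c → a :+ ((:- d) :* b :+ d :* c) := a :- d :* b :+ d :* c) refl _ d _ _ ⟩
      𝐆.⟪ f , χ W.induced ⟫ - d * 𝐆.⟪ f , χ E.induced ⟫ + d * 𝐆.⟪ f , (λ _ → 1#) ⟫
        ≡⟨ cong₂ (λ p q → p + d * q) (cong₂ (λ p q → p - d * q)
             (trans (𝐆.⟪⟫-comm _ _) (W.⟪induced⟫ f hf))
             (trans (𝐆.⟪⟫-comm _ _) (trans (E.⟪induced⟫ f hf) (𝐇.⟪⟫-cong 𝐇.χ-trivial (λ _ _ → refl)))))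
             (𝐆.⟪⟫-comm _ _) ⟩
      𝐇.⟪ χ w , f ⟫ - d * 𝐇.⟪ (λ _ → 1#) , f ⟫ + d * 𝐆.⟪ (λ _ → 1#) , f ⟫ ∎
      where open ≡-Reasoning

    module Nontrivial (w-primitive : Primitive H w) (w⊥1 : 𝐇.⟪ χ w , (λ _ → 1#) ⟫ ≡ 0#) where

      e : F
      e = 𝐇.⟪ χ w , χ w ⟫

      0<e : 0# < e
      0<e = 𝐇.⟪⟫-pos (χ w) (𝐇.χ≢0 w-primitive)

      ⟪Θ,1⟫ : 𝐆.⟪ (λ _ → 1#) , Θ ⟫ ≡ 0#
      ⟪Θ,1⟫ = trans (⟪Θ⟫ (λ _ → 1#) (λ _ _ _ → refl)) (trans
        (cong₂ (λ p q → p + d * q) (cong₂ (λ p q → p - d * q) w⊥1 𝐇.⟪1,1⟫) 𝐆.⟪1,1⟫)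
        (solve 3 (λ o d i → o :- d :* i :+ d :* i := o) refl 0# d 1#))

      Θ-norm : 𝐆.⟪ Θ , Θ ⟫ ≡ e
      Θ-norm = trans (⟪Θ⟫ Θ Θ-class) (trans
        (cong₂ (λ p q → p + d * q) (cong₂ (λ p q → p - d * q)
          (𝐇.⟪⟫-cong (λ _ _ → refl) Θ-H)
          (trans (𝐇.⟪⟫-cong (λ _ _ → refl) Θ-H) (trans (𝐇.⟪⟫-comm _ _) w⊥1))) ⟪Θ,1⟫)
        (trans (cong₂ (λ p q → e - p + q) (zeroʳ d) (zeroʳ d))
          (solve 2 (λ e o → e :- o :+ o := e) refl e 0#)))

      Θ-integral : ∀ v → Primitive full v → ∃ λ z → 𝐆.⟪ Θ , χ v ⟫ ≡ ι z * e
      Θ-integral v hv with 𝐆.dichotomy hv 𝐆.trivial-primitive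
      ... | inj₁ eq = ℤ.+ 0 , trans (𝐆.⟪⟫-comm _ _)
          (trans (𝐆.⟪⟫-cong (λ u hu → trans (eq u hu) (𝐆.χ-trivial u hu)) (λ _ _ → refl))
                        (trans ⟪Θ,1⟫ (trans (sym (zeroˡ e)) (cong (_* e) (sym ι-0)))))
      ... | inj₂ v⊥1 = z₁ ℤ.+ ℤ.- (r ℤ.* z₂) , (begin
        𝐆.⟪ Θ , χ v ⟫
          ≡⟨ trans (𝐆.⟪⟫-comm _ _) (⟪Θ⟫ (χ v) (χ-class (Primitive.invariant hv))) ⟩
        𝐇.⟪ χ w , χ v ⟫ - d * 𝐇.⟪ (λ _ → 1#) , χ v ⟫ + d * 𝐆.⟪ (λ _ → 1#) , χ v ⟫
          ≡⟨ cong₂ _+_ (cong₂ _-_ (proj₂ m₁) (cong₂ _*_ (proj₂ deg) m₂))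
               (cong (d *_) (trans (𝐆.⟪⟫-comm _ _)
                   (trans (𝐆.⟪⟫-cong (λ _ _ → refl) (λ u hu → sym (𝐆.χ-trivial u hu))) v⊥1))) ⟩
        ι z₁ * e - ι r * e * ι z₂ + d * 0#
          ≡⟨ trans (cong (ι z₁ * e - ι r * e * ι z₂ +_) (zeroʳ d)) (+-identityʳ _) ⟩
        ι z₁ * e - ι r * e * ι z₂
          ≡⟨ solve 4 (λ a e b c → a :* e :- b :* e :* c := (a :+ (:- (b :* c))) :* e) refl (ι z₁) e (ι r) (ι z₂) ⟩
        (ι z₁ + - (ι r * ι z₂)) * e
          ≡⟨ cong (_* e) (trans (cong (λ h → ι z₁ + - h) (sym (ι-* r z₂))) (trans (cong (ι z₁ +_) (sym (ι-neg _)))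
              (sym (ι-+ _ _)))) ⟩
        ι (z₁ ℤ.+ ℤ.- (r ℤ.* z₂)) * e ∎)
        where
        open ≡-Reasoning
        v-si : SI H v
        v-si = record { symmetric = Primitive.symmetric hv ; idempotent = Primitive.idempotent hv
                      ; invariant = λ u _ → Primitive.invariant hv u refl }
        m₁ = 𝐇.multiplicity w-primitive v-si
        mₑ = 𝐇.multiplicity 𝐇.trivial-primitive v-si
        deg = degree-multiple w-primitive
        z₁ = proj₁ m₁
        z₂ = proj₁ mₑ
        r = proj₁ deg
        m₂ : 𝐇.⟪ (λ _ → 1#) , χ v ⟫ ≡ ι z₂
        m₂ = trans (𝐇.⟪⟫-cong (λ u hu → sym (𝐇.χ-trivial u hu)) (λ _ _ → refl)) (trans (proj₂ mₑ)
          (trans (cong (ι z₂ *_) (trans (𝐇.⟪⟫-cong 𝐇.χ-trivial 𝐇.χ-trivial) 𝐇.⟪1,1⟫)) (*-identityʳ _)))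

      Θ-irreducible : ¬ ¬ ∃ λ v → Primitive full v × (∀ g → Θ g ≡ χ v g)
      Θ-irreducible cont = 𝐆.decompose W.induced-si λ D₁ → 𝐆.decompose E.induced-si λ D₂ → cont (conclude D₁ D₂)
        where
        conclude : Decomposition full W.induced → Decomposition full E.induced → ∃ λ v →
            Primitive full v × (∀ g → Θ g ≡ χ v g)
        conclude D₁ D₂ = sign (𝐆.irreducible 0<e {L = L} L-primitives Θ-value Θ-norm Θ-integral)
          where
          module D₁ = Decomposition D₁
          module D₂ = Decomposition D₂
          dz = trace-integral (OnH.si hw)
          d≡ι : d ≡ ι (proj₁ dz)
          d≡ι = trans (χ-ε w) (proj₂ dz)
          scale : ℤ → List (Mat m) → 𝐆.Combination
          scale c = List.map (c ,_)
          scale-primitives : ∀ c {ps} → All (Primitive full) ps → 𝐆.Primitives (scale c ps)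
          scale-primitives c [] = []
          scale-primitives c (h ∷ hs) = h ∷ scale-primitives c hs
          scale-value : ∀ c ps g → 𝐆.value (scale c ps) g ≡ ι c * ∑ᴸ (λ p → χ p g) ps
          scale-value c [] g = sym (zeroʳ _)
          scale-value c (p ∷ ps) g = trans (cong (ι c * χ p g +_) (scale-value c ps g)) (sym (distribˡ _ _ _))
          -- The degree `d` occurs as a coefficient, so it has to be an integer; `trace-integral`
          -- provides this.
          L = scale (ℤ.+ 1) D₁.parts ++ (scale (ℤ.- proj₁ dz) D₂.parts ++ ((proj₁ dz , 𝐆.trivial) ∷ []))
          L-primitives : 𝐆.Primitives L
          L-primitives = Allₚ.++⁺ (scale-primitives _ D₁.primitives) (Allₚ.++⁺ (scale-primitives _ D₂.primitives)
              (𝐆.trivial-primitive ∷ []))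
          Θ-value : ∀ u → u ∈ full → Θ u ≡ 𝐆.value L u
          Θ-value u hu = sym (trans (∑ᴸ-++ _ (scale (ℤ.+ 1) D₁.parts) _) (trans (cong₂ _+_
              (trans (scale-value _ D₁.parts u) (trans (cong₂ _*_ ι-1 (sym (D₁.χ-sum u))) (*-identityˡ _)))
              (trans (∑ᴸ-++ _ (scale (ℤ.- proj₁ dz) D₂.parts) _) (cong₂ _+_
                (trans (scale-value _ D₂.parts u) (cong₂ _*_ (trans (ι-neg _) (cong -_ (sym d≡ι)))
                    (sym (D₂.χ-sum u))))
                (trans (+-identityʳ _) (trans (cong₂ _*_ (sym d≡ι) (𝐆.χ-trivial u hu)) (*-identityʳ _))))))
            (solve 3 (λ a d b → a :+ ((:- d) :* b :+ d) := a :- d :* b :+ d) refl (χ W.induced u) d (χ E.induced u))))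
          sign : (∃ λ v → Primitive full v × ((∀ u → u ∈ full → Θ u ≡ χ v u) ⊎ (∀ u → u ∈ full → Θ u ≡ - χ v u))) →
                 ∃ λ v → Primitive full v × (∀ g → Θ g ≡ χ v g)
          sign (v , hv , inj₁ h) = v , hv , λ g → h g refl
          -- The negative sign would make the degrees of `w` and `v` add up to 0, although neither
          -- is negative and that of `v` is not 0.
          sign (v , hv , inj₂ h) = contradiction (proj₂ (+-nonneg-zero {d} {χ v ε}
              (subst (0# ≤_) (sym (χ-ε w)) (0≤trace (OnH.si hw)))
              (subst (0# ≤_) (sym (χ-ε v)) (0≤trace (Primitive.si hv)))
              (trans (cong (_+ χ v ε) (trans (sym (Θ-H ε ε∈)) (h ε refl))) (-‿inverseˡ _))))
            (𝐆.χ≢0 hv)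

      -- For the `v` with `Θ = χ v`, the value of `χ v` at `k` is its degree, so by `χ-maximal`
      -- multiplying by `k` does not change `χ v`.
      Θ-∙ : ∀ {k k′} → k ∈ᴷ H → k′ ∈ᴷ H → Θ (k ∙ k′) ≡ d
      Θ-∙ {k} {k′} hk hk′ = decidable-stable (Θ (k ∙ k′) ≟ d) λ ne → Θ-irreducible λ (v , hv , eq) → ne
        (trans (eq (k ∙ k′)) (trans (χ-maximal (Primitive.si hv) (trans (sym (eq k)) (trans (Θ-kernel k hk)
          (trans (sym (Θ-H ε ε∈)) (eq ε)))) k′) (trans (sym (eq k′)) (Θ-kernel k′ hk′))))

  -- Suppose the product is conjugate to some `h ≢ ε` in `H`. Then each primitive `w` below
  -- `identityᴴ` takes the same value at `h` as at `ε`: a trivial one always, any other through `Θ`.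
  -- Adding up, the regular character of `H` would be as large at `h` as at `ε`.
  kernel-∙ : ∀ {k k′} → k ∈ᴷ H → k′ ∈ᴷ H → k ∙ k′ ∈ᴷ H
  kernel-∙ {k} {k′} hk hk′ with k ∙ k′ Fin.≟ ε
  ... | yes e = inj₁ e
  ... | no ne = inj₂ λ g h∈ → 𝐇.decompose identityᴴ-si λ D → absurd g h∈ D
    where
    absurd : ∀ g → (k ∙ k′) ^ g ∈ H → ¬ Decomposition H identityᴴ
    absurd g h∈ D = 0<⇒≢0 𝐇.∣U∣>0 (trans (sym χ-identityᴴ-ε) (trans (χ-sum ε)
        (trans (sum-equal primitives below) (trans (sym (χ-sum h)) (χ-identityᴴ-≢ h≢ε)))))
      where
      open Decomposition D
      h = (k ∙ k′) ^ g
      h≢ε : h ≢ ε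
      h≢ε e = ne (trans (solveᴳ (k ∙ k′ ∷ g ∷ []) a₀ (a₁ :∙ (a₁ :⁻¹ :∙ a₀ :∙ a₁) :∙ a₁ :⁻¹) refl)
        (trans (cong (λ t → g ∙ t ∙ g ⁻¹) e) (solveᴳ (g ∷ []) (a₀ :∙ :ε :∙ a₀ :⁻¹) :ε refl)))
      equal : ∀ {w} → Primitive H w → identityᴴ · w ≡ w → χ w ε ≡ χ w h
      equal {w} hw below with 𝐇.dichotomy hw 𝐇.trivial-primitive
      ... | inj₁ eq = trans (trans (eq ε ε∈) (𝐇.χ-trivial ε ε∈)) (sym (trans (eq h h∈) (𝐇.χ-trivial h h∈)))
      ... | inj₂ w⊥1 = trans (sym (Θ-∙ hk hk′)) (trans (sym (Θ-class g (k ∙ k′) refl)) (Θ-H h h∈))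
        where
        onH : OnH w
        onH = record { si = Primitive.si hw ; support = λ i j ni → trans (cong (_⟨ i , j ⟩) (sym below))
          (trans (identityᴴ-· w i j) (trans (cong (_* w ⟨ i , j ⟩) (𝟙-∉ {H} ni)) (zeroˡ _))) }
        open Extension onH
        open Nontrivial hw (trans (𝐇.⟪⟫-cong (λ _ _ → refl) (λ u hu → sym (𝐇.χ-trivial u hu))) w⊥1)
      sum-equal : ∀ {ws} → All (Primitive H) ws → All (λ w → identityᴴ · w ≡ w) ws →
          ∑ᴸ (λ w → χ w ε) ws ≡ ∑ᴸ (λ w → χ w h) ws
      sum-equal [] [] = refl
      sum-equal (hw ∷ hws) (b ∷ bs) = cong₂ _+_ (equal hw b) (sum-equal hws bs)

-- Cardinalities of finite Boolean subsets.

module Counting where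

  open import Data.Nat
  import Data.Nat.Properties as ℕₚ
  open import Data.Nat.Divisibility
  open import Data.Nat.Induction using (<-rec)
  open import Data.Fin.Permutation using (permutation)
  import Algebra.Properties.Semiring.Sum as Sum

  private
    module S = Sum ℕₚ.+-*-semiring
    variable n k : ℕ

  abstract
    ∑ : (Fin n → ℕ) → ℕ
    ∑ = S.sum

    ∑-cong : {f g : Fin n → ℕ} → (∀ i → f i ≡ g i) → ∑ f ≡ ∑ g
    ∑-cong = S.sum-cong-≗

    ∑-zero : (f : Fin 0 → ℕ) → ∑ f ≡ 0
    ∑-zero f = refl

    ∑-suc : (f : Fin (suc n) → ℕ) → ∑ f ≡ f zero + ∑ (f ∘ suc)
    ∑-suc f = refl

    ∑-distrib-+ : (f g : Fin n → ℕ) → ∑ (λ i → f i + g i) ≡ ∑ f + ∑ g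
    ∑-distrib-+ = S.∑-distrib-+

    ∑-comm : (f : Fin n → Fin k → ℕ) → ∑ (λ i → ∑ λ j → f i j) ≡ ∑ λ j → ∑ λ i → f i j
    ∑-comm = S.∑-comm

    *-distribʳ-∑ : ∀ x (f : Fin n → ℕ) → ∑ f * x ≡ ∑ λ i → f i * x
    *-distribʳ-∑ = S.*-distribʳ-sum

    ∑-reindex : (f : Fin k → ℕ) (φ : Fin n → Fin k) (ψ : Fin k → Fin n) →
                (∀ i → φ (ψ i) ≡ i) → (∀ i → ψ (φ i) ≡ i) → ∑ f ≡ ∑ (f ∘ φ)
    ∑-reindex f φ ψ φψ ψφ = S.sum-permute f (permutation φ ψ φψ ψφ)

  ∑-0 : {f : Fin n → ℕ} → (∀ i → f i ≡ 0) → ∑ f ≡ 0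
  ∑-0 {zero} h = ∑-zero _
  ∑-0 {suc n} h = trans (∑-suc _) (cong₂ _+_ (h zero) (∑-0 (h ∘ suc)))

  ∑-mono : {f g : Fin n → ℕ} → (∀ i → f i ≤ g i) → ∑ f ≤ ∑ g
  ∑-mono {zero} h = ℕₚ.≤-reflexive (trans (∑-zero _) (sym (∑-zero _)))
  ∑-mono {suc n} h = subst₂ _≤_ (sym (∑-suc _)) (sym (∑-suc _)) (ℕₚ.+-mono-≤ (h zero) (∑-mono (h ∘ suc)))

  ∑-single : (f : Fin n → ℕ) (j : Fin n) → (∀ i → i ≢ j → f i ≡ 0) → ∑ f ≡ f j
  ∑-single {suc n} f zero h = trans (∑-suc f) (trans (cong (f zero +_) (∑-0 (λ i → h (suc i) λ ())))
      (ℕₚ.+-identityʳ _))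
  ∑-single {suc n} f (suc j) h = trans (∑-suc f)
    (cong₂ _+_ (h zero λ ()) (∑-single (f ∘ suc) j λ i ne → h (suc i) λ { refl → ne refl }))

  f≤∑ : (f : Fin n → ℕ) (j : Fin n) → f j ≤ ∑ f
  f≤∑ {suc n} f zero = subst (f zero ≤_) (sym (∑-suc f)) (ℕₚ.m≤m+n _ _)
  f≤∑ {suc n} f (suc j) = subst (f (suc j) ≤_) (sym (∑-suc f)) (ℕₚ.≤-trans (f≤∑ (f ∘ suc) j) (ℕₚ.m≤n+m _ _))

  𝕀 : Bool → ℕ
  𝕀 true = 1
  𝕀 false = 0

  count : Sub n → ℕ
  count P = ∑ (𝕀 ∘ P)

  ∧-true : ∀ {a b} → a ∧ b ≡ true → a ≡ true × b ≡ true
  ∧-true {true} e = refl , e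

  ≡-by-⇔ : ∀ {a b} → (a ≡ true → b ≡ true) → (b ≡ true → a ≡ true) → a ≡ b
  ≡-by-⇔ {true} {b} f g = sym (f refl)
  ≡-by-⇔ {false} {true} f g = g refl
  ≡-by-⇔ {false} {false} f g = refl

  count-cong : {P Q : Sub n} → P ⊆ Q → Q ⊆ P → count P ≡ count Q
  count-cong h k = ∑-cong λ i → cong 𝕀 (≡-by-⇔ (h i) (k i))

  count-split : (P Q : Sub n) → count P ≡ count (λ i → P i ∧ Q i) + count (λ i → P i ∧ not (Q i))
  count-split P Q = trans (∑-cong λ i → split (P i) (Q i)) (∑-distrib-+ _ _)
    where
    split : ∀ a b → 𝕀 a ≡ 𝕀 (a ∧ b) + 𝕀 (a ∧ not b)
    split true true = refl
    split true false = refl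
    split false _ = refl

  count-∅ : {P : Sub n} → (∀ i → i ∉ P) → count P ≡ 0
  count-∅ {P = P} h = ∑-0 λ i → cong 𝕀 (∉⇒false P (h i))

  count-pos : {P : Sub n} {x : Fin n} → x ∈ P → 1 ≤ count P
  count-pos {P = P} {x} h = subst (_≤ count P) (cong 𝕀 h) (f≤∑ (𝕀 ∘ P) x)

  count-full : count {n} (λ _ → true) ≡ n
  count-full {zero} = ∑-zero _
  count-full {suc n} = trans (∑-suc _) (cong suc count-full)

  ⊆-count-≡ : {P Q : Sub n} → P ⊆ Q → count Q ≤ count P → Q ⊆ P
  ⊆-count-≡ {P = P} {Q} h le x hx with x ∈? P
  ... | yes p = p
  ... | no np = contradiction (count-pos {P = λ i → Q i ∧ not (P i)} {x} (cong₂ _∧_ hx (cong not (∉⇒false P np))))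
    (ℕₚ.<⇒≱ (s≤s (ℕₚ.≤-reflexive difference)))
    where
    common : count (λ i → Q i ∧ P i) ≡ count P
    common = count-cong (λ i e → proj₂ (∧-true e)) (λ i e → cong₂ _∧_ (h i e) e)
    difference : count (λ i → Q i ∧ not (P i)) ≡ 0
    difference = ℕₚ.n≤0⇒n≡0 (ℕₚ.+-cancelˡ-≤ (count P) _ _ (subst₂ _≤_
      (trans (count-split Q P) (cong (_+ count (λ i → Q i ∧ not (P i))) common)) (sym (ℕₚ.+-identityʳ _)) le))

  count-reindex : (P : Sub k) (φ : Fin n → Fin k) (ψ : Fin k → Fin n) →
                  (∀ i → φ (ψ i) ≡ i) → (∀ i → ψ (φ i) ≡ i) → count P ≡ count (P ∘ φ)
  count-reindex P = ∑-reindex (𝕀 ∘ P)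

  -- Double counting of the graph of `φ` over `P`: every row has one entry and every column at most
  -- one.
  count-injection : ∀ {a b} (P : Sub a) (Q : Sub b) (φ : Fin a → Fin b) → (∀ i → i ∈ P → φ i ∈ Q) →
                    (∀ i j → i ∈ P → j ∈ P → φ i ≡ φ j → i ≡ j) → count P ≤ count Q
  count-injection {a} {b} P Q φ into inj = subst (_≤ count Q) (sym fibres) (∑-mono fibre)
    where
    graph : Fin a → Fin b → ℕ
    graph i j = 𝕀 (P i ∧ does (φ i Fin.≟ j))
    row : ∀ i → 𝕀 (P i) ≡ ∑ (graph i)
    row i = sym (trans (∑-single (graph i) (φ i) λ j ne → trans
        (cong (λ d → 𝕀 (P i ∧ d)) (dec-false (φ i Fin.≟ j) (ne ∘ sym))) (cong 𝕀 (∧-false (P i))))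
      (trans (cong (λ d → 𝕀 (P i ∧ d)) (dec-true (φ i Fin.≟ φ i) refl)) (cong 𝕀 (∧-trueʳ (P i)))))
      where
      ∧-false : ∀ a → a ∧ false ≡ false
      ∧-false true = refl
      ∧-false false = refl
      ∧-trueʳ : ∀ a → a ∧ true ≡ a
      ∧-trueʳ true = refl
      ∧-trueʳ false = refl
    fibres : count P ≡ ∑ λ j → ∑ λ i → graph i j
    fibres = trans (∑-cong row) (∑-comm graph)
    fibre : ∀ j → ∑ (λ i → graph i j) ≤ 𝕀 (Q j)
    fibre j with Finₚ.any? (λ i → (i ∈? P) ×-dec (φ i Fin.≟ j))
    ... | no none = subst (_≤ 𝕀 (Q j)) (sym (∑-0 λ i → cong 𝕀 (∉⇒false (λ i → P i ∧ does (φ i Fin.≟ j))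
            λ e → none (i , proj₁ (∧-true e) , does-sound (φ i Fin.≟ j) (proj₂ (∧-true {P i} e)))))) z≤n
    ... | yes (i , hi , refl) = subst (_≤ 𝕀 (Q j))
        (sym (∑-single _ i λ i′ ne → cong 𝕀 (∉⇒false (λ i → P i ∧ does (φ i Fin.≟ j))
            λ e → ne (inj i′ i (proj₁ (∧-true e)) hi (does-sound (φ i′ Fin.≟ j) (proj₂ (∧-true {P i′} e)))))))
            (subst (graph i j ≤_) (cong 𝕀 (sym (into i hi))) (𝕀≤1 _))
      where
      𝕀≤1 : ∀ a → 𝕀 a ≤ 1
      𝕀≤1 true = ℕₚ.≤-refl
      𝕀≤1 false = z≤n

  injection⇒surjection : ∀ {a b} (P : Sub a) (Q : Sub b) (φ : Fin a → Fin b) → (∀ i → i ∈ P → φ i ∈ Q) →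
                         (∀ i j → i ∈ P → j ∈ P → φ i ≡ φ j → i ≡ j) → count Q ≤ count P →
                         ∀ j → j ∈ Q → ∃ λ i → i ∈ P × φ i ≡ j
  injection⇒surjection P Q φ into inj le j hj =
    does-sound (image? j) (⊆-count-≡ {P = image} {Q} image⊆Q (ℕₚ.≤-trans le (count-injection P image φ
      (λ i hi → dec-true (image? (φ i)) (i , hi , refl)) inj)) j hj)
    where
    image? : ∀ j → Dec (∃ λ i → i ∈ P × φ i ≡ j)
    image? j = Finₚ.any? (λ i → (i ∈? P) ×-dec (φ i Fin.≟ j))
    image : Sub _
    image j = does (image? j)
    image⊆Q : image ⊆ Q
    image⊆Q j e = let i , hi , eq = does-sound (image? j) e in subst (_∈ Q) eq (into i hi)

  -- Stands in for counting a quotient set: one class of `E` is removed from `Ω` and strong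
  -- induction on the size finishes. Lagrange's theorem and orbit counting are both obtained from
  -- it.
  class-divides : ∀ d (Ω : Sub n) (E : Fin n → Sub n) → (∀ x → x ∈ E x) → (∀ x y → y ∈ E x → x ∈ E y) →
                  (∀ x y z → y ∈ E x → z ∈ E y → z ∈ E x) → (∀ x y → x ∈ Ω → y ∈ E x → y ∈ Ω) →
                  (∀ x → x ∈ Ω → d ∣ count (E x)) → d ∣ count Ω
  class-divides {n} d Ω E rf sm tr = <-rec Goal step (count Ω) Ω refl
    where
    Goal : ℕ → Set
    Goal s = ∀ Ω → count Ω ≡ s → (∀ x y → x ∈ Ω → y ∈ E x → y ∈ Ω) → (∀ x → x ∈ Ω → d ∣ count (E x)) → d ∣ count Ω
    step : ∀ s → (∀ {t} → t < s → Goal t) → Goal s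
    step s rec Ω e closed div with Finₚ.any? (_∈? Ω)
    ... | no none = subst (d ∣_) (sym (count-∅ λ i h → none (i , h))) (d ∣0)
    ... | yes (x , hx) = subst (d ∣_) (sym total) (∣m∣n⇒∣m+n (div x hx)
            (rec smaller Ω′ refl closed′ (λ y hy → div y (proj₁ (∧-true hy)))))
      where
      Ω′ : Sub n
      Ω′ y = Ω y ∧ not (E x y)
      total : count Ω ≡ count (E x) + count Ω′
      total = trans (count-split Ω (E x))
          (cong (_+ count Ω′) (count-cong (λ y h → proj₂ (∧-true h)) (λ y h → cong₂ _∧_ (closed x y hx h) h)))
      smaller : count Ω′ < s
      smaller = subst (count Ω′ <_) (trans (sym total) e) (ℕₚ.+-monoˡ-≤ (count Ω′) (count-pos (rf x)))
      closed′ : ∀ y z → y ∈ Ω′ → z ∈ E y → z ∈ Ω′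
      closed′ y z hy hz = cong₂ _∧_ (closed y z (proj₁ (∧-true hy)) hz)
        (cong not (∉⇒false (E x) λ k → contradiction (trans (sym (proj₂ (∧-true {Ω y} hy)))
            (cong not (tr x z y k (sm y z hz)))) λ ()))

-- Prime powers and binomial coefficients modulo a prime.

module PrimePowers where

  open import Data.Nat renaming (_^_ to _^ⁿ_)
  import Data.Nat.Properties as ℕₚ
  open import Data.Nat.Divisibility
  open import Data.Nat.Primality using (Prime; prime⇒nonZero; prime⇒nonTrivial; prime⇒irreducible; euclidsLemma)
  open import Data.Nat.Coprimality using (Coprime; coprime-divisor)
  open import Data.Nat.Induction using (<-rec)
  open import Data.Nat.Solver using (module +-*-Solver)

  prime-coprime : ∀ {p q} → Prime p → ¬ p ∣ q → Coprime q p
  prime-coprime hp nd (d∣q , d∣p) with prime⇒irreducible hp d∣p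
  ... | inj₁ e = e
  ... | inj₂ refl = contradiction d∣q nd

  p∣divisor : ∀ {p} → Prime p → ∀ a {q} → q ∣ p ^ⁿ a → q ≡ 1 ⊎ p ∣ q
  p∣divisor hp zero h = inj₁ (∣1⇒≡1 h)
  p∣divisor {p} hp (suc a) {q} h with p ∣? q
  ... | yes d = inj₂ d
  ... | no nd = p∣divisor hp a (coprime-divisor (prime-coprime hp nd) h)

  prime-power-coprime : ∀ {p} a {q} → Prime p → ¬ p ∣ q → Coprime (p ^ⁿ a) q
  prime-power-coprime a hp nd {d} (d∣pa , d∣q) with p∣divisor hp a {d} d∣pa
  ... | inj₁ e = e
  ... | inj₂ p∣d = contradiction (∣-trans p∣d d∣q) nd

  binomial : ℕ → ℕ → ℕ
  binomial n zero = 1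
  binomial zero (suc k) = 0
  binomial (suc n) (suc k) = binomial n k + binomial n (suc k)

  absorption : ∀ n k → suc k * binomial (suc n) (suc k) ≡ suc n * binomial n k
  absorption zero zero = refl
  absorption zero (suc k) = trans (cong (suc (suc k) *_) (ℕₚ.+-identityʳ 0))
      (trans (ℕₚ.*-zeroʳ k) (sym (ℕₚ.+-identityʳ 0)))
  absorption (suc n) zero = cong suc (trans (ℕₚ.+-identityʳ _) (trans (sym (ℕₚ.+-identityʳ _)) (absorption n zero)))
  absorption (suc n) (suc k) = begin
    suc (suc k) * (B + (C + D))
      ≡⟨ solve 4 (λ k b c d → (con 2 :+ k) :* (b :+ (c :+ d)) := (con 1 :+ k) :* b :+ b :+ (con 2 :+ k) :*
          (c :+ d)) refl k B C D ⟩
    suc k * B + B + suc (suc k) * (C + D)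
      ≡⟨ cong₂ (λ s t → s + B + t) (absorption n k) (absorption n (suc k)) ⟩
    suc n * A + B + suc n * C
      ≡⟨ solve 4 (λ n a b c → (con 1 :+ n) :* a :+ b :+ (con 1 :+ n) :* c := b :+ (con 1 :+ n) :*
          (a :+ c)) refl n A B C ⟩
    B + suc n * B ∎
    where
    open ≡-Reasoning
    open +-*-Solver
    A = binomial n k
    B = binomial (suc n) (suc k)
    C = binomial n (suc k)
    D = binomial n (suc (suc k))

  factor-out : ∀ p → Prime p → ∀ n → 1 ≤ n → ∃ λ a → ∃ λ t → n ≡ p ^ⁿ a * t × ¬ p ∣ t
  factor-out p hp = <-rec _ step
    where
    step : ∀ n → (∀ {k} → k < n → 1 ≤ k → ∃ λ a → ∃ λ t → k ≡ p ^ⁿ a * t × ¬ p ∣ t) →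
           1 ≤ n → ∃ λ a → ∃ λ t → n ≡ p ^ⁿ a * t × ¬ p ∣ t
    step n rec 1≤n with p ∣? n
    ... | no nd = 0 , n , sym (ℕₚ.+-identityʳ n) , nd
    ... | yes (divides (suc k) e) =
      let a , t , e′ , nd = rec (subst (suc k <_) (sym e) (ℕₚ.m<m*n (suc k) p (nonTrivial⇒n>1 p {{prime⇒nonTrivial hp}}))) (s≤s z≤n) in
      suc a , t , trans e (trans (cong (_* p) e′) (trans (ℕₚ.*-comm _ p) (sym (ℕₚ.*-assoc p _ t)))) , nd
    ... | yes (divides zero refl) = contradiction 1≤n λ ()

  p∤1 : ∀ {p} → Prime p → ¬ p ∣ 1
  p∤1 {p} hp h = contradiction (∣1⇒≡1 h) λ { refl → contradiction
      (nonTrivial⇒n>1 p {{prime⇒nonTrivial hp}}) λ { (s≤s ()) } }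

  -- Let P + 1 = pᵃ and N + 1 = pᵃ t. By `absorption`, C(N+1, P+1) = t C(N, P), so `p` would divide
  -- C(N, P); and `p` divides C(N+1, i+1) for i < P, as otherwise pᵃ would divide i + 1. Pascal's
  -- rule then carries divisibility down row N to C(N, 0) = 1.
  p∤binomial : ∀ {p} a t → Prime p → ¬ p ∣ t → ¬ p ∣ binomial (p ^ⁿ a * t) (p ^ⁿ a)
  p∤binomial {p} a zero hp p∤t = contradiction (p ∣0) p∤t
  p∤binomial {p} a t@(suc _) hp p∤t = go (p ^ⁿ a) (p ^ⁿ a * t) refl refl
    where
    go : ∀ P N → P ≡ p ^ⁿ a → N ≡ p ^ⁿ a * t → ¬ p ∣ binomial N P
    go zero N eP eN = contradiction (ℕₚ.m^n≡0⇒m≡0 p a (sym eP)) (≢-nonZero⁻¹ p {{prime⇒nonZero hp}})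
    go (suc P) zero eP eN = contradiction (trans eN (cong (_* t) (sym eP))) λ ()
    go (suc P) (suc N) eP eN h with euclidsLemma t (binomial N P) hp (subst (p ∣_) top h)
      where
      top : binomial (suc N) (suc P) ≡ t * binomial N P
      top = ℕₚ.*-cancelˡ-≡ _ _ (suc P)
          (trans (absorption N P) (trans (cong (_* binomial N P) (trans eN (cong (_* t) (sym eP))))
              (ℕₚ.*-assoc (suc P) t _)))
    ... | inj₁ p∣t = p∤t p∣t
    ... | inj₂ p∣b = row P ℕₚ.≤-refl p∣b
      where
      middle : ∀ i → i < P → p ∣ binomial (suc N) (suc i)
      middle i i<P with p ∣? binomial (suc N) (suc i)
      ... | yes d = d
      ... | no nd = contradiction (∣⇒≤ (coprime-divisor {n = binomial (suc N) (suc i)} (prime-power-coprime a hp nd)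
              (subst (p ^ⁿ a ∣_) (trans (sym (absorption N i)) (ℕₚ.*-comm (suc i) _))
                (∣m⇒∣m*n (binomial N i) (subst (p ^ⁿ a ∣_) (sym eN) (m∣m*n t))))))
              (ℕₚ.<⇒≱ (subst (suc i <_) eP (s≤s i<P)))
      row : ∀ i → i ≤ P → ¬ p ∣ binomial N i
      row zero _ = p∤1 hp
      row (suc i) i<P d = row i (ℕₚ.<⇒≤ i<P) (∣m+n∣m⇒∣n (subst (p ∣_) (ℕₚ.+-comm (binomial N i) _) (middle i i<P)) d)

-- Lagrange's theorem and orbit counting.

module Orbits {m : ℕ} (G : FinGroup m) where

  open import Data.Nat renaming (_^_ to _^ⁿ_)

  import Data.Nat.Properties as ℕₚ
  open import Data.Nat.Divisibility
  open import Data.Nat.Primality using (Prime)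
  open import Data.Vec using ([]; _∷_)
  open Counting
  open PrimePowers
  open FinGroup G

  count-translate : ∀ g (P : Sub m) → count P ≡ count (λ x → P (g ∙ x))
  count-translate g P = count-reindex P (g ∙_) (g ⁻¹ ∙_) (x∙x⁻¹y g) (x⁻¹∙xy g)

  lagrange : ∀ {B Y} → IsSub B → IsSub Y → B ⊆ Y → count B ∣ count Y
  lagrange {B} {Y} isB isY B⊆Y = class-divides (count B) Y (λ x y → B (x ⁻¹ ∙ y))
    (λ x → subst (_∈ B) (sym (inverseˡ x)) B.ε∈)
    (λ x y h → subst (_∈ B) (solveᴳ (x ∷ y ∷ []) ((a₀ :⁻¹ :∙ a₁) :⁻¹) (a₁ :⁻¹ :∙ a₀) refl) (B.⁻¹∈ h))
    (λ x y z h k → subst (_∈ B) (solveᴳ (x ∷ y ∷ z ∷ []) ((a₀ :⁻¹ :∙ a₁) :∙ (a₁ :⁻¹ :∙ a₂)) (a₀ :⁻¹ :∙ a₂) refl)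
        (B.∙∈ h k))
    (λ x y hx h → subst (_∈ Y) (x∙x⁻¹y x y) (Y.∙∈ hx (B⊆Y _ h)))
    (λ x hx → ∣-reflexive (count-translate (x ⁻¹) B))
    where
    module B = IsSub isB
    module Y = IsSub isY

  same : ∀ {N} → Fin N → Sub N
  same i j = does (i Fin.≟ j)

  same-sound : ∀ {N} {i j : Fin N} → j ∈ same i → i ≡ j
  same-sound {i = i} {j} = does-sound (i Fin.≟ j)

  same-complete : ∀ {N} {i j : Fin N} → i ≡ j → j ∈ same i
  same-complete {i = i} {j} = dec-true (i Fin.≟ j)

  count-same : ∀ {N} (i : Fin N) → count (same i) ≡ 1
  count-same i = trans (∑-single _ i λ j ne → cong 𝕀 (dec-false (i Fin.≟ j) (ne ∘ sym)))
      (cong 𝕀 (same-complete {i = i} refl))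

  -- The action is on the classes of E, so that no type of cosets is needed.
  module Action {N : ℕ} (act : Fin m → Fin N → Fin N) (act-ε : ∀ x → act ε x ≡ x)
                (act-∙ : ∀ g h x → act (g ∙ h) x ≡ act g (act h x))
                (E : Fin N → Sub N) (E-refl : ∀ x → x ∈ E x) (E-sym : ∀ x y → y ∈ E x → x ∈ E y)
                (E-trans : ∀ x y z → y ∈ E x → z ∈ E y → z ∈ E x)
                (E-act : ∀ g x y → y ∈ E x → act g y ∈ E (act g x))
                {Y : Sub m} (isY : IsSub Y) where
    open IsSub isY

    stabiliser : Fin N → Sub m
    stabiliser x g = Y g ∧ E (act g x) x

    act-⁻¹ : ∀ g x → act (g ⁻¹) (act g x) ≡ x
    act-⁻¹ g x = trans (sym (act-∙ _ _ _)) (trans (cong (λ h → act h x) (inverseˡ g)) (act-ε x))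

    stabiliser-isSub : ∀ x → IsSub (stabiliser x)
    stabiliser-isSub x = record
      { ε∈ = cong₂ _∧_ ε∈ (subst (λ y → x ∈ E y) (sym (act-ε x)) (E-refl x))
      ; ∙∈ = λ {g} {h} hg hh → cong₂ _∧_ (∙∈ (proj₁ (∧-true hg)) (proj₁ (∧-true hh)))
          (subst (λ y → x ∈ E y) (sym (act-∙ g h x)) (E-trans _ (act g x) x (E-act g _ _ (proj₂ (∧-true {Y h} hh)))
              (proj₂ (∧-true {Y g} hg))))
      ; ⁻¹∈ = λ {g} hg → cong₂ _∧_ (⁻¹∈ (proj₁ (∧-true hg)))
          (subst (_∈ E (act (g ⁻¹) x)) (act-⁻¹ g x)
              (E-act (g ⁻¹) x (act g x) (E-sym (act g x) x (proj₂ (∧-true {Y g} hg))))) }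

    stabiliser⊆ : ∀ x → stabiliser x ⊆ Y
    stabiliser⊆ x g h = proj₁ (∧-true h)

    orbit? : ∀ x y → Dec (∃ λ g → g ∈ Y × y ∈ E (act g x))
    orbit? x y = Finₚ.any? λ g → (g ∈? Y) ×-dec (y ∈? E (act g x))

    orbit : Fin N → Sub N
    orbit x y = does (orbit? x y)

    -- Double count of the pairs of `g ∈ Y` and `y` in the class of `act g x`: each `g` contributes
    -- `c`, and for `y` in the orbit the admissible `g` form a coset of the stabiliser.
    orbit-stabiliser : ∀ x c → (∀ g → g ∈ Y → count (E (act g x)) ≡ c) →
        count (orbit x) * count (stabiliser x) ≡ count Y * c
    orbit-stabiliser x c size = begin
      count (orbit x) * count (stabiliser x)
        ≡⟨ *-distribʳ-∑ _ _ ⟩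
      ∑ (λ y → 𝕀 (orbit x y) * count (stabiliser x))
        ≡⟨ ∑-cong (λ y → sym (fibre y (orbit? x y))) ⟩
      ∑ (λ y → ∑ λ g → 𝕀 (Y g ∧ E (act g x) y))
        ≡⟨ ∑-comm _ ⟩
      ∑ (λ g → ∑ λ y → 𝕀 (Y g ∧ E (act g x) y))
        ≡⟨ ∑-cong (λ g → row g (g ∈? Y)) ⟩
      ∑ (λ g → 𝕀 (Y g) * c)
        ≡⟨ sym (*-distribʳ-∑ _ _) ⟩
      count Y * c ∎
      where
      open ≡-Reasoning
      row : ∀ g → Dec (g ∈ Y) → ∑ (λ y → 𝕀 (Y g ∧ E (act g x) y)) ≡ 𝕀 (Y g) * c
      row g (yes h) = trans (∑-cong λ y → cong (λ b → 𝕀 (b ∧ E (act g x) y)) h)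
          (trans (size g h) (sym (trans (cong (λ b → 𝕀 b * c) h) (ℕₚ.*-identityˡ c))))
      row g (no h) = trans (∑-0 λ y → cong (λ b → 𝕀 (b ∧ E (act g x) y)) (∉⇒false Y h))
          (sym (cong (λ b → 𝕀 b * c) (∉⇒false Y h)))
      fibre : ∀ y (d : Dec (∃ λ g → g ∈ Y × y ∈ E (act g x))) →
          ∑ (λ g → 𝕀 (Y g ∧ E (act g x) y)) ≡ 𝕀 (does d) * count (stabiliser x)
      fibre y (no none) = ∑-0 λ g → cong 𝕀 (∉⇒false (λ g → Y g ∧ E (act g x) y) λ h → none (g , ∧-true h))
      fibre y (yes (g , hg , hy)) = trans (count-translate g (λ g → Y g ∧ E (act g x) y))
        (trans (count-cong
          (λ k h → cong₂ _∧_ (subst (_∈ Y) (x⁻¹∙xy g k) (∙∈ (⁻¹∈ hg) (proj₁ (∧-true h))))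
            (subst₂ (λ s t → s ∈ E t) (act-⁻¹ g x) (trans (cong (act (g ⁻¹)) (act-∙ g k x)) (act-⁻¹ g (act k x)))
              (E-act (g ⁻¹) _ _ (E-trans _ y _ (proj₂ (∧-true {Y (g ∙ k)} h)) (E-sym _ _ hy)))))
          (λ k h → cong₂ _∧_ (∙∈ hg (proj₁ (∧-true h)))
            (subst (λ s → y ∈ E s) (sym (act-∙ g k x)) (E-trans _ _ _ (E-act g _ _ (proj₂ (∧-true {Y k} h))) hy))))
          (sym (ℕₚ.*-identityˡ _)))

    module _ (Ω : Sub N) (Ω-act : ∀ g x → g ∈ Y → x ∈ Ω → act g x ∈ Ω) (Ω-E : ∀ x y → x ∈ Ω → y ∈ E x → y ∈ Ω)
             (c : ℕ) (size : ∀ x → x ∈ Ω → count (E x) ≡ c) where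

      -- An orbit has `c` times the index of its stabiliser as size. `p` is any number here: a prime
      -- for Sylow's theorem, and the order of `H` for its action on the kernel in `H-divides`.
      orbits-divide : ∀ p → (∀ x → x ∈ Ω → p * count (stabiliser x) ∣ count Y) → p * c ∣ count Ω
      orbits-divide p div = class-divides (p * c) Ω orbit
        (λ x → dec-true (orbit? x x) (ε , ε∈ , subst (λ y → x ∈ E y) (sym (act-ε x)) (E-refl x)))
        (λ x y h → let g , hg , e = does-sound (orbit? x y) h in
          dec-true (orbit? y x) (g ⁻¹ , ⁻¹∈ hg , subst (_∈ E (act (g ⁻¹) y)) (act-⁻¹ g x)
              (E-act (g ⁻¹) _ _ (E-sym _ _ e))))
        (λ x y z h k → let g , hg , e = does-sound (orbit? x y) h ; g′ , hg′ , e′ = does-sound (orbit? y z) k in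
          dec-true (orbit? x z) (g′ ∙ g , ∙∈ hg′ hg , subst (λ s → z ∈ E s) (sym (act-∙ g′ g x))
              (E-trans _ _ _ (E-act g′ _ _ e) e′)))
        (λ x y hx h → let g , hg , e = does-sound (orbit? x y) h in Ω-E _ _ (Ω-act g x hg hx) e)
        sizes
        where
        sizes : ∀ x → x ∈ Ω → p * c ∣ count (orbit x)
        sizes x hx with div x hx
        ... | divides q e = divides q (ℕₚ.*-cancelʳ-≡ _ _ (count (stabiliser x))
            {{>-nonZero (count-pos (IsSub.ε∈ (stabiliser-isSub x)))}} (begin
          count (orbit x) * s    ≡⟨ orbit-stabiliser x c (λ g hg → size _ (Ω-act g x hg hx)) ⟩
          count Y * c            ≡⟨ cong (_* c) e ⟩
          q * (p * s) * c        ≡⟨ ℕₚ.*-assoc q (p * s) c ⟩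
          q * (p * s * c)        ≡⟨ cong (q *_)
              (trans (ℕₚ.*-assoc p s c) (trans (cong (p *_) (ℕₚ.*-comm s c)) (sym (ℕₚ.*-assoc p c s)))) ⟩
          q * (p * c * s)        ≡⟨ sym (ℕₚ.*-assoc q (p * c) s) ⟩
          q * (p * c) * s        ∎))
          where
          open ≡-Reasoning
          s = count (stabiliser x)

      -- In a group of prime power order a stabiliser is everything or has index divisible by `p`.
      -- If the first case never occurred, `orbits-divide` would contradict the hypothesis.
      fixed-point : ∀ {p} a → Prime p → count Y ≡ p ^ⁿ a → ¬ p * c ∣ count Ω → ∃ λ x →
          x ∈ Ω × (∀ g → g ∈ Y → x ∈ E (act g x))
      fixed-point {p} a hp ∣Y∣ ndiv with Finₚ.any? (λ x → (x ∈? Ω) ×-dec Finₚ.all? (λ g → stabilises? x g))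
        where
        stabilises? : ∀ x g → Dec (g ∈ Y → x ∈ E (act g x))
        stabilises? x g with g ∈? Y | x ∈? E (act g x)
        ... | yes h | yes k = yes λ _ → k
        ... | yes h | no k = no λ f → k (f h)
        ... | no h | _ = yes λ k → contradiction k h
      ... | yes (x , hx , fix) = x , hx , fix
      ... | no none = contradiction (orbits-divide p λ x hx → improve x hx) ndiv
        where
        improve : ∀ x → x ∈ Ω → p * count (stabiliser x) ∣ count Y
        improve x hx with lagrange (stabiliser-isSub x) isY (stabiliser⊆ x)
        ... | divides q e with p∣divisor hp a {q} (subst (q ∣_) (trans (sym e) ∣Y∣) (m∣m*n (count (stabiliser x))))
        ...   | inj₁ refl = contradiction (x , hx , λ g hg → proj₂ (∧-true {Y g} (⊆-count-≡ (stabiliser⊆ x)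
                  (ℕₚ.≤-reflexive (trans e (ℕₚ.*-identityˡ _))) g hg))) none
        ...   | inj₂ (divides r refl) = divides r (trans e (ℕₚ.*-assoc r p _))

  module PointAction {N : ℕ} (act : Fin m → Fin N → Fin N) (act-ε : ∀ x → act ε x ≡ x)
                     (act-∙ : ∀ g h x → act (g ∙ h) x ≡ act g (act h x)) {Y : Sub m} (isY : IsSub Y) where
    open Action act act-ε act-∙ same (λ i → same-complete {i = i} refl)
        (λ i j h → same-complete (sym (same-sound {i = i} h)))
      (λ i j k h h′ → same-complete (trans (same-sound {i = i} h) (same-sound {i = j} h′)))
      (λ g i j h → same-complete (cong (act g) (same-sound {i = i} h))) isY public

-- Existence of Sylow subgroups.

module SylowSubgroups where

  open import Data.Nat renaming (_^_ to _^ⁿ_)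
  import Data.Nat.Properties as ℕₚ
  open import Data.Nat.Divisibility
  open import Data.Nat.Primality using (Prime; prime⇒nonZero)
  open import Data.Nat.Coprimality using (coprime-divisor)
  open import Data.Fin using (splitAt; _↑ˡ_; _↑ʳ_)
  open import Data.Vec using (Vec; []; _∷_; lookup; tabulate)
  open import Data.Vec.Properties using (lookup∘tabulate; tabulate∘lookup; tabulate-cong)
  open Counting
  open PrimePowers

  -- 2 to the power `m`. Subsets are numbered because actions are on `Fin N`; doubling corresponds
  -- to the first bit.
  #subsets : ℕ → ℕ
  #subsets zero = 1
  #subsets (suc m) = #subsets m + #subsets m

  decode : ∀ m → Fin (#subsets m) → Vec Bool m
  decode zero _ = []
  decode (suc m) i with splitAt (#subsets m) i
  ... | inj₁ j = true ∷ decode m j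
  ... | inj₂ j = false ∷ decode m j

  encode : ∀ {m} → Vec Bool m → Fin (#subsets m)
  encode [] = zero
  encode {suc m} (true ∷ v) = encode v ↑ˡ #subsets m
  encode {suc m} (false ∷ v) = #subsets m ↑ʳ encode v

  decode-encode : ∀ {m} (v : Vec Bool m) → decode m (encode v) ≡ v
  decode-encode [] = refl
  decode-encode {suc m} (true ∷ v) rewrite Finₚ.splitAt-↑ˡ (#subsets m) (encode v) (#subsets m) = cong (true ∷_)
      (decode-encode v)
  decode-encode {suc m} (false ∷ v) rewrite Finₚ.splitAt-↑ʳ (#subsets m) (#subsets m) (encode v) = cong (false ∷_)
      (decode-encode v)

  encode-decode : ∀ m i → encode (decode m i) ≡ i
  encode-decode zero zero = refl
  encode-decode (suc m) i with splitAt (#subsets m) i in eq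
  ... | inj₁ j = trans (cong (_↑ˡ #subsets m) (encode-decode m j)) (Finₚ.splitAt⁻¹-↑ˡ eq)
  ... | inj₂ j = trans (cong (#subsets m ↑ʳ_) (encode-decode m j)) (Finₚ.splitAt⁻¹-↑ʳ eq)

  ∑-+ : ∀ a {b} (f : Fin (a + b) → ℕ) → ∑ f ≡ ∑ (λ i → f (i ↑ˡ b)) + ∑ (λ j → f (a ↑ʳ j))
  ∑-+ zero f = cong (_+ ∑ f) (sym (∑-zero _))
  ∑-+ (suc a) f = trans (∑-suc f) (trans (cong (f zero +_) (∑-+ a (f ∘ suc)))
    (trans (sym (ℕₚ.+-assoc (f zero) _ _)) (cong (_+ ∑ (λ j → f (suc a ↑ʳ j))) (sym (∑-suc (λ i → f (i ↑ˡ _)))))))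

  -- v is a j-element subset of Y.
  choice : ∀ {m} → Sub m → ℕ → Vec Bool m → Bool
  choice Y j (false ∷ v) = choice (Y ∘ suc) j v
  choice Y zero [] = true
  choice Y (suc j) [] = false
  choice Y zero (true ∷ v) = false
  choice Y (suc j) (true ∷ v) = Y zero ∧ choice (Y ∘ suc) j v

  count-choice : ∀ m (Y : Sub m) j → count (choice Y j ∘ decode m) ≡ binomial (count Y) j
  count-choice zero Y zero = trans (∑-suc _) (cong suc (∑-zero _))
  count-choice zero Y (suc j) = trans (∑-suc _)
      (trans (∑-zero _) (cong (λ n → binomial n (suc j)) (sym (∑-zero (𝕀 ∘ Y)))))
  count-choice (suc m) Y j = begin
    count (choice Y j ∘ decode (suc m))
      ≡⟨ ∑-+ (#subsets m) _ ⟩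
    ∑ (λ i → 𝕀 (choice Y j (decode (suc m) (i ↑ˡ #subsets m)))) + ∑
        (λ i → 𝕀 (choice Y j (decode (suc m) (#subsets m ↑ʳ i))))
      ≡⟨ cong₂ _+_ (∑-cong λ i → cong (𝕀 ∘ choice Y j) (left i)) (∑-cong λ i → cong (𝕀 ∘ choice Y j) (right i)) ⟩
    ∑ (λ i → 𝕀 (choice Y j (true ∷ decode m i))) + count (choice (Y ∘ suc) j ∘ decode m)
      ≡⟨ cong (∑ (λ i → 𝕀 (choice Y j (true ∷ decode m i))) +_) (count-choice m (Y ∘ suc) j) ⟩
    ∑ (λ i → 𝕀 (choice Y j (true ∷ decode m i))) + binomial c j
      ≡⟨ pascal j (Y zero) refl ⟩
    binomial (𝕀 (Y zero) + c) j
      ≡⟨ cong (λ n → binomial n j) (sym (∑-suc (𝕀 ∘ Y))) ⟩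
    binomial (count Y) j ∎
    where
    open ≡-Reasoning
    c = count (Y ∘ suc)
    left : ∀ i → decode (suc m) (i ↑ˡ #subsets m) ≡ true ∷ decode m i
    left i rewrite Finₚ.splitAt-↑ˡ (#subsets m) i (#subsets m) = refl
    right : ∀ i → decode (suc m) (#subsets m ↑ʳ i) ≡ false ∷ decode m i
    right i rewrite Finₚ.splitAt-↑ʳ (#subsets m) (#subsets m) i = refl
    pascal : ∀ j b → Y zero ≡ b → ∑ (λ i → 𝕀 (choice Y j (true ∷ decode m i))) + binomial c j ≡ binomial (𝕀 b + c) j
    pascal zero b e = trans (cong (_+ 1) (∑-0 λ i → refl)) refl
    pascal (suc j) true e = cong (_+ binomial c (suc j))
        (trans (∑-cong λ i → cong (λ b → 𝕀 (b ∧ choice (Y ∘ suc) j (decode m i))) e) (count-choice m (Y ∘ suc) j))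
    pascal (suc j) false e = cong (_+ binomial c (suc j))
        (∑-0 λ i → cong (λ b → 𝕀 (b ∧ choice (Y ∘ suc) j (decode m i))) e)

  choice-sound : ∀ {m} (Y : Sub m) j v → choice Y j v ≡ true → count (lookup v) ≡ j × lookup v ⊆ Y
  choice-sound Y zero [] e = ∑-zero _ , λ ()
  choice-sound Y j (false ∷ v) e = let c , s = choice-sound (Y ∘ suc) j v e in trans (∑-suc _) c , λ { (suc i) h → s i h }
  choice-sound Y (suc j) (true ∷ v) e =
    let y , e′ = ∧-true e ; c , s = choice-sound (Y ∘ suc) j v e′ in
    trans (∑-suc _) (cong suc c) , λ { zero _ → y ; (suc i) h → s i h }

  choice-complete : ∀ {m} (Y : Sub m) j v → count (lookup v) ≡ j → lookup v ⊆ Y → choice Y j v ≡ true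
  choice-complete Y zero [] c s = refl
  choice-complete Y (suc j) [] c s = contradiction (trans (sym (∑-zero _)) c) λ ()
  choice-complete Y j (false ∷ v) c s = choice-complete (Y ∘ suc) j v (trans (sym (∑-suc _)) c) (s ∘ suc)
  choice-complete Y zero (true ∷ v) c s = contradiction (trans (sym (∑-suc _)) c) λ ()
  choice-complete Y (suc j) (true ∷ v) c s =
    cong₂ _∧_ (s zero refl) (choice-complete (Y ∘ suc) j v (ℕₚ.suc-injective (trans (sym (∑-suc _)) c)) (s ∘ suc))

  module _ {m : ℕ} (G : FinGroup m) where
    open FinGroup G
    open Orbits G

    record Sylow (p : ℕ) (Y P : Sub m) : Set where
      field
        isSub : IsSub P
        P⊆Y : P ⊆ Y
        a t : ℕ
        ∣P∣ : count P ≡ p ^ⁿ a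
        ∣Y∣ : count Y ≡ p ^ⁿ a * t
        p∤t : ¬ p ∣ t

    -- Wielandt: Y acts by translation on its subsets of size pᵃ.
    wielandt : ∀ {p} → Prime p → ∀ {Y} → IsSub Y → ∃ (Sylow p Y)
    wielandt {p} hp {Y} isY = stabiliser i , record
        { isSub = stabiliser-isSub i ; P⊆Y = stabiliser⊆ i ; a = a ; t = t
        ; ∣P∣ = ∣stabiliser∣ ; ∣Y∣ = ∣Y∣ ; p∤t = p∤t }
      where
      open IsSub isY
      factored = factor-out p hp (count Y) (count-pos ε∈)
      a = proj₁ factored
      t = proj₁ (proj₂ factored)
      ∣Y∣ = proj₁ (proj₂ (proj₂ factored))
      p∤t = proj₂ (proj₂ (proj₂ factored))
      N = #subsets m

      move : Fin m → Vec Bool m → Vec Bool m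
      move g v = tabulate λ i → lookup v (g ⁻¹ ∙ i)
      move-lookup : ∀ g v i → lookup (move g v) i ≡ lookup v (g ⁻¹ ∙ i)
      move-lookup g v = lookup∘tabulate _
      act : Fin m → Fin N → Fin N
      act g i = encode (move g (decode m i))
      act-ε : ∀ i → act ε i ≡ i
      act-ε i = trans (cong encode
          (trans (tabulate-cong λ x → cong (lookup (decode m i)) (trans (cong (_∙ x) ε⁻¹) (identityˡ x)))
              (tabulate∘lookup (decode m i))))
        (encode-decode m i)
      act-∙ : ∀ g h i → act (g ∙ h) i ≡ act g (act h i)
      act-∙ g h i = cong encode
          (tabulate-cong λ x → sym (trans (cong (λ v → lookup v (g ⁻¹ ∙ x)) (decode-encode (move h (decode m i))))
        (trans (move-lookup h (decode m i) _)
            (cong (lookup (decode m i)) (solveᴳ (g ∷ h ∷ x ∷ []) (a₁ :⁻¹ :∙ (a₀ :⁻¹ :∙ a₂))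
                ((a₀ :∙ a₁) :⁻¹ :∙ a₂) refl)))))
      open PointAction act act-ε act-∙ isY
      Ω : Sub N
      Ω = choice Y (p ^ⁿ a) ∘ decode m
      Ω-act : ∀ g i → g ∈ Y → i ∈ Ω → act g i ∈ Ω
      Ω-act g i hg hi = trans (cong (choice Y (p ^ⁿ a)) (decode-encode (move g v))) (choice-complete Y _ (move g v)
        (trans (∑-cong λ x → cong 𝕀 (move-lookup g v x)) (trans (sym (count-translate (g ⁻¹) (lookup v)))
            (proj₁ sound)))
        (λ x hx → subst (_∈ Y) (x∙x⁻¹y g x) (∙∈ hg (proj₂ sound _ (trans (sym (move-lookup g v x)) hx)))))
        where
        v = decode m i
        sound = choice-sound Y (p ^ⁿ a) v hi
      search : Dec (∃ λ i → i ∈ Ω × ¬ p * count (stabiliser i) ∣ count Y)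
      search = Finₚ.any? λ i → (i ∈? Ω) ×-dec ¬? (p * count (stabiliser i) ∣? count Y)
      -- If all indices were divisible by `p`, so would be the number of these subsets, which is the
      -- binomial coefficient of `p∤binomial`.
      found : ∃ λ i → i ∈ Ω × ¬ p * count (stabiliser i) ∣ count Y
      found with search
      ... | yes f = f
      ... | no none = contradiction
        (subst₂ _∣_ (ℕₚ.*-identityʳ p) (trans (count-choice m Y (p ^ⁿ a)) (cong (λ n → binomial n (p ^ⁿ a)) ∣Y∣))
          (orbits-divide Ω Ω-act (λ i j hi e → subst (_∈ Ω) (same-sound {i = i} e) hi) 1 (λ i _ → count-same i) p
            λ i hi → decidable-stable (p * count (stabiliser i) ∣? count Y) λ n → none (i , hi , n)))
        (p∤binomial a t hp p∤t)
      i = proj₁ found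
      v = decode m i
      ∣v∣ : count (lookup v) ≡ p ^ⁿ a
      ∣v∣ = proj₁ (choice-sound Y (p ^ⁿ a) v (proj₁ (proj₂ found)))
      pᵃ≢0 : p ^ⁿ a ≢ 0
      pᵃ≢0 e = contradiction (ℕₚ.m^n≡0⇒m≡0 p a e) (≢-nonZero⁻¹ p {{prime⇒nonZero hp}})
      point : ∃ λ x → x ∈ lookup v
      point with Finₚ.any? (_∈? lookup v)
      ... | yes f = f
      ... | no none = contradiction (trans (sym ∣v∣) (count-∅ λ x h → none (x , h))) pᵃ≢0
      -- Elements that preserve the subset send a chosen point `x` of it to distinct points of it.
      -- The lower bound comes from the index being prime to `p`.
      stabiliser-≤ : count (stabiliser i) ≤ p ^ⁿ a
      stabiliser-≤ = subst (count (stabiliser i) ≤_) ∣v∣ (count-injection (stabiliser i) (lookup v) (_∙ x)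
        (λ g hg → trans (cong (λ w → lookup w (g ∙ x)) (sym (fixes g hg)))
            (trans (move-lookup g v _) (trans (cong (lookup v) (x⁻¹∙xy g x)) (proj₂ point))))
        (λ g h _ _ e → trans (solveᴳ (g ∷ x ∷ []) a₀ (a₀ :∙ a₁ :∙ a₁ :⁻¹) refl)
            (trans (cong (_∙ x ⁻¹) e) (solveᴳ (h ∷ x ∷ []) (a₀ :∙ a₁ :∙ a₁ :⁻¹) a₀ refl))))
        where
        x = proj₁ point
        fixes : ∀ g → g ∈ stabiliser i → move g v ≡ v
        fixes g hg = trans (sym (decode-encode _))
            (cong (decode m) (does-sound (act g i Fin.≟ i) (proj₂ (∧-true {Y g} hg))))
      pᵃ∣stabiliser : p ^ⁿ a ∣ count (stabiliser i)
      pᵃ∣stabiliser with lagrange (stabiliser-isSub i) isY (stabiliser⊆ i)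
      ... | divides q e = coprime-divisor {n = q} (prime-power-coprime a hp p∤q)
          (divides t (trans (sym e) (trans ∣Y∣ (ℕₚ.*-comm _ t))))
        where
        p∤q : ¬ p ∣ q
        p∤q (divides r refl) = proj₂ (proj₂ found) (divides r (trans e (ℕₚ.*-assoc r p _)))
      ∣stabiliser∣ : count (stabiliser i) ≡ p ^ⁿ a
      ∣stabiliser∣ = ℕₚ.≤-antisym stabiliser-≤
        (∣⇒≤ {{>-nonZero (count-pos (IsSub.ε∈ (stabiliser-isSub i)))}} pᵃ∣stabiliser)

    abstract
      sylow : ∀ {p} → Prime p → ∀ {Y} → IsSub Y → ∃ (Sylow p Y)
      sylow = wielandt

-- Conjugacy of Sylow subgroups, the Frattini argument, and centres of p-groups.

module Conjugation {m : ℕ} (G : FinGroup m) where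

  open import Data.Nat renaming (_^_ to _^ⁿ_)

  open import Data.Bool.Properties using (∧-zeroʳ) renaming (_≟_ to _≟ᵇ_)
  import Data.Nat.Properties as ℕₚ
  open import Data.Nat.Divisibility
  open import Data.Nat.Primality using (Prime; prime⇒nonZero)
  open import Data.Vec using ([]; _∷_)
  open Counting
  open PrimePowers
  open Orbits G
  open SylowSubgroups
  open FinGroup G

  ^-∙ : ∀ x g h → (x ^ g) ^ h ≡ x ^ (g ∙ h)
  ^-∙ x g h = solveᴳ (x ∷ g ∷ h ∷ []) (a₂ :⁻¹ :∙ (a₁ :⁻¹ :∙ a₀ :∙ a₁) :∙ a₂) ((a₁ :∙ a₂) :⁻¹ :∙ a₀ :∙ (a₁ :∙ a₂)) refl

  ^-ε : ∀ x → x ^ ε ≡ x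
  ^-ε x = solveᴳ (x ∷ []) (:ε :⁻¹ :∙ a₀ :∙ :ε) a₀ refl

  ^-homo : ∀ x y g → (x ∙ y) ^ g ≡ x ^ g ∙ y ^ g
  ^-homo x y g = solveᴳ (x ∷ y ∷ g ∷ []) (a₂ :⁻¹ :∙ (a₀ :∙ a₁) :∙ a₂)
      (a₂ :⁻¹ :∙ a₀ :∙ a₂ :∙ (a₂ :⁻¹ :∙ a₁ :∙ a₂)) refl

  ^-⁻¹ : ∀ x g → (x ⁻¹) ^ g ≡ (x ^ g) ⁻¹
  ^-⁻¹ x g = solveᴳ (x ∷ g ∷ []) (a₁ :⁻¹ :∙ a₀ :⁻¹ :∙ a₁) ((a₁ :⁻¹ :∙ a₀ :∙ a₁) :⁻¹) refl

  ε^ : ∀ g → ε ^ g ≡ ε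
  ε^ g = solveᴳ (g ∷ []) (a₀ :⁻¹ :∙ :ε :∙ a₀) :ε refl

  ^-undo : ∀ x g → (x ^ g) ^ (g ⁻¹) ≡ x
  ^-undo x g = trans (^-∙ x g (g ⁻¹)) (trans (cong (x ^_) (inverseʳ g)) (^-ε x))

  ^-undo′ : ∀ x g → (x ^ (g ⁻¹)) ^ g ≡ x
  ^-undo′ x g = trans (^-∙ x (g ⁻¹) g) (trans (cong (x ^_) (inverseˡ g)) (^-ε x))

  ^-conj : ∀ x z s → (x ^ z) ^ s ≡ (x ^ s) ^ (z ^ s)
  ^-conj x z s = solveᴳ (x ∷ z ∷ s ∷ []) (a₂ :⁻¹ :∙ (a₁ :⁻¹ :∙ a₀ :∙ a₁) :∙ a₂)
    ((a₂ :⁻¹ :∙ a₁ :∙ a₂) :⁻¹ :∙ (a₂ :⁻¹ :∙ a₀ :∙ a₂) :∙ (a₂ :⁻¹ :∙ a₁ :∙ a₂)) refl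

  ^-≢ε : ∀ {x} g → x ≢ ε → x ^ g ≢ ε
  ^-≢ε {x} g ne e = ne (trans (sym (^-undo x g)) (trans (cong (_^ (g ⁻¹)) e) (ε^ _)))

  ^≡⇒commute : ∀ {x g} → x ^ g ≡ x → g ∙ x ≡ x ∙ g
  ^≡⇒commute {x} {g} e = trans (cong (g ∙_) (sym e)) (solveᴳ (x ∷ g ∷ []) (a₁ :∙ (a₁ :⁻¹ :∙ a₀ :∙ a₁))
      (a₀ :∙ a₁) refl)

  commute⇒^≡ : ∀ {x g} → g ∙ x ≡ x ∙ g → x ^ g ≡ x
  commute⇒^≡ {x} {g} e = trans (assoc _ _ _) (trans (cong (g ⁻¹ ∙_) (sym e)) (x⁻¹∙xy g x))

  ^-same : ∀ {z y k} → z ^ y ≡ z ^ k → (k ∙ y ⁻¹) ∙ z ≡ z ∙ (k ∙ y ⁻¹)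
  ^-same {z} {y} {k} e = ^≡⇒commute (trans (sym (^-∙ z k (y ⁻¹))) (trans (cong (_^ (y ⁻¹)) (sym e)) (^-undo z y)))

  ∙⁻¹≡ε⇒≡ : ∀ {x y} → x ∙ y ⁻¹ ≡ ε → x ≡ y
  ∙⁻¹≡ε⇒≡ {x} {y} e = trans (solveᴳ (x ∷ y ∷ []) a₀ (a₀ :∙ a₁ :⁻¹ :∙ a₁) refl) (trans (cong (_∙ y) e) (identityˡ y))

  Normal : Sub m → Set
  Normal Y = ∀ {x} g → x ∈ Y → x ^ g ∈ Y

  _∩_ : Sub m → Sub m → Sub m
  (P ∩ Q) x = P x ∧ Q x

  ∩-isSub : ∀ {P Q} → IsSub P → IsSub Q → IsSub (P ∩ Q)
  ∩-isSub {P} {Q} isP isQ = record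
    { ε∈ = cong₂ _∧_ P.ε∈ Q.ε∈
    ; ∙∈ = λ {x} {y} hx hy → cong₂ _∧_ (P.∙∈ (proj₁ (∧-true hx)) (proj₁ (∧-true hy)))
        (Q.∙∈ (proj₂ (∧-true {P x} hx)) (proj₂ (∧-true {P y} hy)))
    ; ⁻¹∈ = λ {x} hx → cong₂ _∧_ (P.⁻¹∈ (proj₁ (∧-true hx))) (Q.⁻¹∈ (proj₂ (∧-true {P x} hx))) }
    where
    module P = IsSub isP
    module Q = IsSub isQ

  _∖ε : Sub m → Sub m
  (P ∖ε) x = P x ∧ not (does (x Fin.≟ ε))

  ∖ε-sound : ∀ P {x} → x ∈ P ∖ε → x ∈ P × x ≢ ε
  ∖ε-sound P {x} h =
    proj₁ (∧-true h) , λ e → contradiction (trans (sym (proj₂ (∧-true {P x} h)))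
        (cong not (dec-true (x Fin.≟ ε) e))) λ ()

  ∖ε-complete : ∀ {P x} → x ∈ P → x ≢ ε → x ∈ P ∖ε
  ∖ε-complete {x = x} h ne = cong₂ _∧_ h (cong not (dec-false (x Fin.≟ ε) ne))

  count-∖ε : ∀ {P} → IsSub P → count P ≡ 1 + count (P ∖ε)
  count-∖ε {P} isP = trans (count-split P (λ x → does (x Fin.≟ ε))) (cong (_+ count (P ∖ε))
    (trans (∑-single _ ε λ x ne → trans (cong (λ d → 𝕀 (P x ∧ d)) (dec-false (x Fin.≟ ε) ne))
        (cong 𝕀 (∧-zeroʳ (P x))))
      (cong 𝕀 (cong₂ _∧_ (IsSub.ε∈ isP) (dec-true (ε Fin.≟ ε) refl)))))

  nontrivial-count : ∀ {P x} → IsSub P → x ∈ P → x ≢ ε → 1 < count P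
  nontrivial-count {P} isP hx ne = subst (1 <_) (sym (count-∖ε isP))
      (s≤s (count-pos {P = P ∖ε} (∖ε-complete {P} hx ne)))

  count≡1 : ∀ {P} → IsSub P → ¬ (∃ λ x → x ∈ P × x ≢ ε) → count P ≡ 1
  count≡1 {P} isP none = trans (count-∖ε isP) (cong suc (count-∅ λ x h → none (x , ∖ε-sound P h)))

  module ConjugationAction {Y : Sub m} (isY : IsSub Y) where
    open PointAction (λ g x → x ^ (g ⁻¹)) (λ x → trans (cong (x ^_) ε⁻¹) (^-ε x))
      (λ g h x → trans (cong (x ^_) (⁻¹-∙ g h)) (sym (^-∙ x (h ⁻¹) (g ⁻¹)))) isY public

  -- g P g⁻¹
  conj : Fin m → Sub m → Sub m
  conj g P x = P (x ^ g)

  conj-isSub : ∀ {P} g → IsSub P → IsSub (conj g P)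
  conj-isSub {P} g isP = record
    { ε∈ = subst (_∈ P) (sym (ε^ g)) ε∈
    ; ∙∈ = λ {x} {y} hx hy → subst (_∈ P) (sym (^-homo x y g)) (∙∈ hx hy)
    ; ⁻¹∈ = λ {x} hx → subst (_∈ P) (sym (^-⁻¹ x g)) (⁻¹∈ hx) }
    where open IsSub isP

  conj-count : ∀ g P → count (conj g P) ≡ count P
  conj-count g P = sym (count-reindex P (_^ g) (_^ (g ⁻¹)) (λ x → ^-undo′ x g) (λ x → ^-undo x g))

  normaliser? : ∀ (P : Sub m) g → Dec (∀ x → P x ≡ P (x ^ g))
  normaliser? P g = Finₚ.all? {P = λ x → P x ≡ P (x ^ g)} λ x → P x ≟ᵇ P (x ^ g)

  abstract
    normaliser : Sub m → Sub m
    normaliser P g = does (normaliser? P g)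

    normaliser-sound : ∀ (P : Sub m) {g} → g ∈ normaliser P → ∀ x → P x ≡ P (x ^ g)
    normaliser-sound P {g} = does-sound (normaliser? P g)

    normaliser-complete : ∀ (P : Sub m) {g} → (∀ x → P x ≡ P (x ^ g)) → g ∈ normaliser P
    normaliser-complete P {g} = dec-true (normaliser? P g)

  normaliser-isSub : ∀ P → IsSub (normaliser P)
  normaliser-isSub P = record
    { ε∈ = normaliser-complete P λ x → cong P (sym (^-ε x))
    ; ∙∈ = λ {g} {h} hg hh → normaliser-complete P λ x →
        trans (normaliser-sound P hg x) (trans (normaliser-sound P hh _) (cong P (^-∙ x g h)))
    ; ⁻¹∈ = λ {g} hg → normaliser-complete P λ x →
        trans (cong P (sym (^-undo′ x g))) (sym (normaliser-sound P hg _)) }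

  module LeftCosets {A B : Sub m} (isA : IsSub A) (isB : IsSub B) where
    open IsSub isB
    open Action _∙_ identityˡ assoc (λ x y → B (x ⁻¹ ∙ y))
      (λ x → subst (_∈ B) (sym (inverseˡ x)) ε∈)
      (λ x y h → subst (_∈ B) (solveᴳ (x ∷ y ∷ []) ((a₀ :⁻¹ :∙ a₁) :⁻¹) (a₁ :⁻¹ :∙ a₀) refl) (⁻¹∈ h))
      (λ x y z h k → subst (_∈ B) (solveᴳ (x ∷ y ∷ z ∷ []) ((a₀ :⁻¹ :∙ a₁) :∙ (a₁ :⁻¹ :∙ a₂)) (a₀ :⁻¹ :∙ a₂) refl)
          (∙∈ h k))
      (λ g x y h → subst (_∈ B) (solveᴳ (g ∷ x ∷ y ∷ []) (a₁ :⁻¹ :∙ a₂) ((a₀ :∙ a₁) :⁻¹ :∙ (a₀ :∙ a₂)) refl) h)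
      isA public

  abstract
    -- That `A` fixes the left coset of `x` modulo `B` means precisely that `x` conjugates `A` into
    -- `B`. A fixed coset exists because `A` is a `p`-group and `p` does not divide the index of
    -- `B`.
    conjugate-into : ∀ {A B Y p} a → IsSub A → IsSub B → IsSub Y → A ⊆ Y → B ⊆ Y → Prime p → count A ≡ p ^ⁿ a →
                     ¬ p * count B ∣ count Y → ∃ λ x → x ∈ Y × (∀ g → g ∈ A → g ^ x ∈ B)
    conjugate-into {A} {B} {Y} a isA isB isY A⊆Y B⊆Y hp ∣A∣ ndiv =
      let x , hx , fix = fixed-point Y (λ g x hg hx → Y.∙∈ (A⊆Y g hg) hx) (λ x y hx h → subst (_∈ Y) (x∙x⁻¹y x y) (Y.∙∈ hx (B⊆Y _ h)))
                           (count B) (λ x _ → sym (count-translate (x ⁻¹) B)) a hp ∣A∣ ndiv in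
      x , hx , λ g hg → subst (_∈ B) (solveᴳ (g ∷ x ∷ []) (((a₀ :∙ a₁) :⁻¹ :∙ a₁) :⁻¹) (a₁ :⁻¹ :∙ a₀ :∙ a₁) refl)
          (IsSub.⁻¹∈ isB (fix g hg))
      where
      module Y = IsSub isY
      open LeftCosets isA isB

  centre? : ∀ P x → Dec (x ∈ P × (∀ y → y ∈ P → x ^ y ≡ x))
  centre? P x = (x ∈? P) ×-dec Finₚ.all? λ y → commutes y
    where
    commutes : ∀ y → Dec (y ∈ P → x ^ y ≡ x)
    commutes y with y ∈? P | x ^ y Fin.≟ x
    ... | yes h | yes k = yes λ _ → k
    ... | yes h | no k = no λ f → k (f h)
    ... | no h | _ = yes λ k → contradiction k h

  centre : Sub m → Sub m
  centre P x = does (centre? P x)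

  module _ {p : ℕ} (hp : Prime p) where

    sylow-index : ∀ {Y P} → Sylow G p Y P → ¬ p * count P ∣ count Y
    sylow-index {Y} {P} S h = p∤t (*-cancelʳ-∣ (p ^ⁿ a) {{ℕₚ.m^n≢0 p a {{prime⇒nonZero hp}}}}
      (subst₂ _∣_ (cong (p *_) ∣P∣) (trans ∣Y∣ (ℕₚ.*-comm _ t)) h))
      where open Sylow S

    abstract
      sylow-conjugate : ∀ {Y P P′} → IsSub Y → Sylow G p Y P → IsSub P′ → P′ ⊆ Y → count P′ ≡ count P →
                        ∃ λ x → x ∈ Y × (∀ g → P′ g ≡ P (g ^ x))
      sylow-conjugate {Y} {P} {P′} isY S isP′ P′⊆Y ∣P′∣ =
        let x , hx , into = conjugate-into a isP′ isSub isY P′⊆Y P⊆Y hp (trans ∣P′∣ ∣P∣) (sylow-index S) in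
        x , hx , λ g → ≡-by-⇔ (into g) (⊆-count-≡ {P = P′} {conj x P} into
            (ℕₚ.≤-reflexive (trans (conj-count x P) (sym ∣P′∣))) g)
        where open Sylow S

    sylow-conj : ∀ {Y P} → Normal Y → Sylow G p Y P → ∀ x → Sylow G p Y (conj x P)
    sylow-conj {Y} {P} normal S x = record
      { isSub = conj-isSub x isSub ; P⊆Y = λ g h → subst (_∈ Y) (^-undo g x) (normal (x ⁻¹) (P⊆Y _ h))
      ; a = a ; t = t ; ∣P∣ = trans (conj-count x P) ∣P∣ ; ∣Y∣ = ∣Y∣ ; p∤t = p∤t }
      where open Sylow S

    -- Every conjugate of `P` is a conjugate under `Y`, so `Y` is transitive on the cosets of the
    -- normaliser, whose index in `G` therefore divides the order of `Y`.
    frattini : ∀ {Y P} → IsSub Y → Normal Y → Sylow G p Y P → ∀ {r} → r * count (normaliser P) ∣ count full →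
        r ∣ count Y
    frattini {Y} {P} isY normal S {r} (divides k e) = divides (k * s) (sym (ℕₚ.*-cancelʳ-≡ _ _ N
        {{>-nonZero (count-pos (IsSub.ε∈ (normaliser-isSub P)))}} (begin
      k * s * r * N            ≡⟨ ℕₚ.*-assoc (k * s) r N ⟩
      k * s * (r * N)          ≡⟨ trans (cong (_* (r * N)) (ℕₚ.*-comm k s)) (ℕₚ.*-assoc s k _) ⟩
      s * (k * (r * N))        ≡⟨ trans (cong (s *_) (sym e)) (ℕₚ.*-comm s _) ⟩
      count full * s           ≡⟨ cong (_* s) (count-cong (λ g _ → everything g) (λ _ _ → refl)) ⟩
      count (orbit ε) * s      ≡⟨ orbit-stabiliser ε N (λ g _ → sym (count-translate ((g ∙ ε) ⁻¹) (normaliser P))) ⟩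
      count Y * N              ∎)))
      where
      open ≡-Reasoning
      open Sylow S
      open LeftCosets isY (normaliser-isSub P)
      N = count (normaliser P)
      s = count (stabiliser ε)
      everything : ∀ g → g ∈ orbit ε
      everything g =
        let y , hy , eq = sylow-conjugate isY S (conj-isSub g isSub) (Sylow.P⊆Y (sylow-conj normal S g)) (conj-count g P) in
        dec-true (orbit? ε g) (y , hy , normaliser-complete P λ x →
          trans (cong P (solveᴳ (x ∷ y ∷ []) a₀ (a₁ :⁻¹ :∙ (a₁ :∙ a₀ :∙ a₁ :⁻¹) :∙ a₁) refl))
            (trans (sym (eq (y ∙ x ∙ y ⁻¹))) (cong P (solveᴳ (x ∷ y ∷ g ∷ [])
              (a₂ :⁻¹ :∙ (a₁ :∙ a₀ :∙ a₁ :⁻¹) :∙ a₂) (((a₁ :∙ :ε) :⁻¹ :∙ a₂) :⁻¹ :∙ a₀ :∙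
                  ((a₁ :∙ :ε) :⁻¹ :∙ a₂)) refl))))

    abstract
      -- By `frattini` the index of the normaliser of `P` is not divisible by `r`, so some `x`
      -- conjugates `R` into that normaliser. Conjugating `P` back by `x` gives the invariant Sylow
      -- subgroup.
      invariant-sylow : ∀ {Y R r} b → IsSub Y → Normal Y → IsSub R → Prime r → count R ≡ r ^ⁿ b → ¬ r ∣ count Y →
                        ∃ λ P → Sylow G p Y P × R ⊆ normaliser P
      invariant-sylow {Y} {R} b isY normal isR hr ∣R∣ r∤Y =
        let P , S = sylow G hp isY
            x , _ , into = conjugate-into b isR (normaliser-isSub P) full-isSub (λ _ _ → refl) (λ _ _ → refl) hr ∣R∣
                             (λ h → r∤Y (frattini isY normal S h)) in
        conj x P , sylow-conj normal S x , λ g hg → normaliser-complete (conj x P) λ y →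
          trans (normaliser-sound P (into g hg) (y ^ x)) (cong P (sym (^-conj y g x)))

    sylow-nontrivial : ∀ {Y P} → Sylow G p Y P → p ∣ count Y → ∃ λ x → x ∈ P × x ≢ ε
    sylow-nontrivial {Y} {P} S p∣Y with Finₚ.any? (λ x → (x ∈? P) ×-dec ¬? (x Fin.≟ ε))
    ... | yes f = f
    ... | no none = contradiction
        (subst (p ∣_) (trans ∣Y∣ (trans (cong (_* t) (trans (sym ∣P∣) (count≡1 isSub none)))
            (ℕₚ.*-identityˡ t))) p∣Y) p∤t
      where open Sylow S

    centre-nontrivial : ∀ {P} a → IsSub P → count P ≡ p ^ⁿ a → (∃ λ x → x ∈ P × x ≢ ε) → ∃ λ x → x ∈ centre P × x ≢ ε
    centre-nontrivial {P} a isP ∣P∣ (x₀ , hx₀ , x₀≢ε) =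
      let x , hx , fix = fixed-point (P ∖ε)
            (λ g x hg hx → let x∈ , x≢ε = ∖ε-sound P hx in
              ∖ε-complete {P} (∙∈ (∙∈ (⁻¹∈ (⁻¹∈ hg)) x∈) (⁻¹∈ hg)) (^-≢ε (g ⁻¹) x≢ε))
            (λ x y hx e → subst (_∈ P ∖ε) (same-sound {i = x} e) hx) 1 (λ x _ → count-same x) a hp ∣P∣ p∤ in
      x , dec-true (centre? P x) (proj₁ (∖ε-sound P hx) , λ y hy →
            trans (cong (x ^_) (sym (⁻¹-involutive y))) (same-sound {i = x ^ ((y ⁻¹) ⁻¹)} (fix (y ⁻¹) (⁻¹∈ hy)))) ,
          proj₂ (∖ε-sound P hx)
      where
      open IsSub isP
      open ConjugationAction isP
      p∣P : p ∣ count P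
      p∣P with p∣divisor hp a {p ^ⁿ a} ∣-refl
      ... | inj₂ d = subst (p ∣_) (sym ∣P∣) d
      ... | inj₁ e = contradiction (trans ∣P∣ e) (ℕₚ.>⇒≢ (nontrivial-count isP hx₀ x₀≢ε))
      p∤ : ¬ p * 1 ∣ count (P ∖ε)
      p∤ h = p∤1 hp (∣m+n∣m⇒∣n (subst (p ∣_) (trans (count-∖ε isP) (ℕₚ.+-comm 1 _)) p∣P)
          (subst (_∣ count (P ∖ε)) (ℕₚ.*-identityʳ p) h))

-- The Frobenius kernel as a normal subgroup, and products over subsets of a group.

module Kernels {m : ℕ} (G : FinGroup m) where

  open import Data.Nat renaming (_^_ to _^ⁿ_)

  import Data.Nat.Properties as ℕₚ
  open import Data.Nat.Divisibility
  open import Data.Nat.Primality using (Prime)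
  open import Data.Fin.Permutation using (permutation)
  open import Data.Vec using ([]; _∷_)
  import Data.List as List
  import Data.List.Relation.Unary.All as All
  open import Data.Nat.Primality.Factorisation using (factorise; PrimeFactorisation)
  open import Algebra.Bundles using (CommutativeMonoid)
  import Algebra.Properties.CommutativeMonoid.Sum as CSum
  import Algebra.Properties.Monoid.Mult as Mult
  open Counting
  open PrimePowers
  open Orbits G
  open SylowSubgroups
  open Conjugation G
  open FinGroup G

  module Kernel {H : Sub m} (isH : IsSub H) (malnormal : Malnormal H) where
    private module H = IsSub isH

    abstract
      K : Sub m
      K = kernel H

      K-sound : ∀ {x} → x ∈ K → x ∈ᴷ H
      K-sound {x} = does-sound (kernel? H x)

      K-complete : ∀ {x} → x ∈ᴷ H → x ∈ K
      K-complete {x} = dec-true (kernel? H x)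

    K-normal : Normal K
    K-normal {x} g hx with K-sound hx
    ... | inj₁ e = K-complete (inj₁ (trans (cong (_^ g) e) (ε^ g)))
    ... | inj₂ k = K-complete (inj₂ λ h h∈ → k (g ∙ h) (subst (_∈ H) (^-∙ x g h) h∈))

    K-isSub : IsSub K
    K-isSub = record
      { ε∈ = K-complete (inj₁ refl)
      ; ∙∈ = λ hx hy → K-complete (FrobeniusTheorem.kernel-∙ G H isH malnormal (K-sound hx) (K-sound hy))
      ; ⁻¹∈ = λ {x} hx → K-complete (inverse x (K-sound hx)) }
      where
      inverse : ∀ x → x ∈ᴷ H → x ⁻¹ ∈ᴷ H
      inverse x (inj₁ e) = inj₁ (trans (cong _⁻¹ e) ε⁻¹)
      inverse x (inj₂ k) = inj₂ λ g h → k g (subst (_∈ H) (trans (cong _⁻¹ (^-⁻¹ x g)) (⁻¹-involutive _)) (H.⁻¹∈ h))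

    K∩H : ∀ {x} → x ∈ K → x ∈ H → x ≡ ε
    K∩H {x} hx hH with K-sound hx
    ... | inj₁ e = e
    ... | inj₂ k = contradiction (subst (_∈ H) (sym (^-ε x)) hH) (k ε)

    ∉K⇒conjugate : ∀ {g} → g ∉ K → ∃ λ x → g ^ x ∈ H
    ∉K⇒conjugate {g} ng with Finₚ.any? (λ x → (g ^ x) ∈? H)
    ... | yes f = f
    ... | no none = contradiction (K-complete (inj₂ λ x h → none (x , h))) ng

    ∉K⇒≢ε : ∀ {g} → g ∉ K → g ≢ ε
    ∉K⇒≢ε ng e = ng (K-complete (inj₁ e))

    -- Some `x` conjugates `g` into `H`. If `k ^ x` lies in `H` too, it is in both `K` and `H`,
    -- hence trivial. If not, malnormality applies to `k ^ x`, which fixes `g ^ x`, and would make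
    -- `g` trivial.
    free : ∀ {g k} → g ∉ K → k ∈ K → k ∙ g ≡ g ∙ k → k ≡ ε
    free {g} {k} ng hk e with ∉K⇒conjugate ng
    ... | x , h∈ with (k ^ x) ∈? H
    ...   | yes k∈ = decidable-stable (k Fin.≟ ε) λ ne → ^-≢ε x ne (K∩H (K-normal x hk) k∈)
    ...   | no k∉ = contradiction
        (malnormal (k ^ x) (g ^ x) k∉ h∈
            (subst (_∈ H) (sym (trans (sym (^-conj g k x)) (cong (_^ x) (commute⇒^≡ e)))) h∈))
                      (^-≢ε x (∉K⇒≢ε ng))

    -- By `free`, conjugation by `H` on the non-trivial elements of `K` has trivial stabilisers.
    -- Consequently the orders of `H` and `K` have no common prime.
    H-divides : count H ∣ count (K ∖ε)
    H-divides = subst (_∣ count (K ∖ε)) (ℕₚ.*-identityʳ (count H)) (orbits-divide (K ∖ε)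
        (λ g x hg hx → let x∈ , x≢ε = ∖ε-sound K hx in ∖ε-complete {K} (K-normal (g ⁻¹) x∈) (^-≢ε (g ⁻¹) x≢ε))
        (λ x y hx e → subst (_∈ K ∖ε) (same-sound {i = x} e) hx) 1 (λ x _ → count-same x)
        (count H) (λ x hx → ∣-reflexive (trans (cong (count H *_) (trivial-stabiliser x hx)) (ℕₚ.*-identityʳ _))))
      where
      open ConjugationAction isH
      trivial-stabiliser : ∀ x → x ∈ K ∖ε → count (stabiliser x) ≡ 1
      trivial-stabiliser x hx = count≡1 (stabiliser-isSub x) λ (g , hg , g≢ε) →
        let x∈ , x≢ε = ∖ε-sound K hx ; g∈ , fixed = ∧-true hg in
        x≢ε (free (λ gK → g≢ε (K∩H gK g∈)) x∈ (trans (cong (_∙ g) (sym (same-sound {i = x ^ (g ⁻¹)} fixed)))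
          (solveᴳ (g ∷ x ∷ []) ((a₀ :⁻¹) :⁻¹ :∙ a₁ :∙ a₀ :⁻¹ :∙ a₀) (a₀ :∙ a₁) refl)))

    prime∤K : ∀ {q} → Prime q → q ∣ count H → ¬ q ∣ count K
    prime∤K hq q∣H q∣K =
      p∤1 hq (∣m+n∣m⇒∣n (subst (_ ∣_) (trans (count-∖ε K-isSub) (ℕₚ.+-comm 1 _)) q∣K) (∣-trans q∣H H-divides))

  prime-divisor : ∀ n → 1 < n → ∃ λ p → Prime p × p ∣ n
  prime-divisor n 1<n = first (factorise n {{>-nonZero (ℕₚ.<⇒≤ 1<n)}})
    where
    first : PrimeFactorisation n → ∃ λ p → Prime p × p ∣ n
    first record { factors = List.[] ; isFactorisation = e } = contradiction 1<n
        (subst (λ n → ¬ 1 < n) (sym e) λ { (s≤s ()) })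
    first record { factors = p List.∷ ps ; isFactorisation = e ; factorsPrime = hp All.∷ _ } = p , hp , subst
        (p ∣_) (sym e) (m∣m*n _)

  module RestrictedProduct {c ℓ} (M : CommutativeMonoid c ℓ) where
    open CommutativeMonoid M renaming
        (_∙_ to _⊕_; ε to 0ᴹ; refl to ≈-refl; sym to ≈-sym; trans to ≈-trans; identityˡ to ⊕-identityˡ; identityʳ to ⊕-identityʳ)
    private module S = CSum M
    open Mult monoid using () renaming (_×_ to _⊗_) public

    abstract
      Π : ∀ {n} → (Fin n → Carrier) → Carrier
      Π = S.sum

      Π-cong : ∀ {n} {f g : Fin n → Carrier} → (∀ i → f i ≈ g i) → Π f ≈ Π g
      Π-cong = S.sum-cong-≋

      Π-comm : ∀ {n k} (f : Fin n → Fin k → Carrier) → Π (λ i → Π λ j → f i j) ≈ Π λ j → Π λ i → f i j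
      Π-comm = S.∑-comm

      Π-⊕ : ∀ {n} (f g : Fin n → Carrier) → Π (λ i → f i ⊕ g i) ≈ Π f ⊕ Π g
      Π-⊕ = S.∑-distrib-+

      Π-reindex : ∀ {n} (f : Fin n → Carrier) (φ ψ : Fin n → Fin n) →
                  (∀ i → φ (ψ i) ≡ i) → (∀ i → ψ (φ i) ≡ i) → Π f ≈ Π (f ∘ φ)
      Π-reindex f φ ψ φψ ψφ = S.sum-permute f (permutation φ ψ φψ ψφ)

      Π-ε : ∀ {n} {f : Fin n → Carrier} → (∀ i → f i ≈ 0ᴹ) → Π f ≈ 0ᴹ
      Π-ε {n} h = ≈-trans (S.sum-cong-≋ h) (S.sum-replicate-zero n)

      Π-single : ∀ {n} (f : Fin n → Carrier) j → (∀ i → i ≢ j → f i ≈ 0ᴹ) → Π f ≈ f j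
      Π-single {suc n} f zero h = ≈-trans (∙-congˡ (Π-ε λ i → h (suc i) λ ())) (⊕-identityʳ _)
      Π-single {suc n} f (suc j) h = ≈-trans
          (∙-cong (h zero λ ()) (Π-single (f ∘ suc) j λ i ne → h (suc i) λ { refl → ne refl })) (⊕-identityˡ _)

      Π-homo : ∀ {n} (θ : Carrier → Carrier) → θ 0ᴹ ≈ 0ᴹ → (∀ x y → θ (x ⊕ y) ≈ θ x ⊕ θ y) →
               ∀ (f : Fin n → Carrier) → θ (Π f) ≈ Π (θ ∘ f)
      Π-homo {zero} θ θε θ⊕ f = θε
      Π-homo {suc n} θ θε θ⊕ f = ≈-trans (θ⊕ _ _) (∙-congˡ (Π-homo θ θε θ⊕ (f ∘ suc)))

      Π-count : ∀ {n} (P : Sub n) b → Π (λ i → if P i then b else 0ᴹ) ≈ count P ⊗ b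
      Π-count {zero} P b = reflexive (cong (_⊗ b) (sym (∑-zero (𝕀 ∘ P))))
      Π-count {suc n} P b = ≈-trans (∙-congˡ (Π-count (P ∘ suc) b))
          (≈-trans (head (P zero)) (reflexive (cong (_⊗ b) (sym (∑-suc (𝕀 ∘ P))))))
        where
        head : ∀ p → (if p then b else 0ᴹ) ⊕ (count (P ∘ suc) ⊗ b) ≈ (𝕀 p + count (P ∘ suc)) ⊗ b
        head true = ≈-refl
        head false = ⊕-identityˡ _

    Π[_] : Sub m → (Fin m → Carrier) → Carrier
    Π[ Q ] f = Π λ i → if Q i then f i else 0ᴹ

    if-cong : ∀ (Q : Sub m) {f g : Fin m → Carrier} i → (i ∈ Q → f i ≈ g i) →
        (if Q i then f i else 0ᴹ) ≈ (if Q i then g i else 0ᴹ)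
    if-cong Q i h with Q i
    ... | true = h refl
    ... | false = ≈-refl

    Π[]-cong : ∀ Q {f g : Fin m → Carrier} → (∀ i → i ∈ Q → f i ≈ g i) → Π[ Q ] f ≈ Π[ Q ] g
    Π[]-cong Q {f} {g} h = Π-cong λ i → if-cong Q {f} {g} i (h i)

    Π[]-ε : ∀ Q {f : Fin m → Carrier} → (∀ i → i ∈ Q → f i ≈ 0ᴹ) → Π[ Q ] f ≈ 0ᴹ
    Π[]-ε Q {f} h = Π-ε term
      where
      term : ∀ i → (if Q i then f i else 0ᴹ) ≈ 0ᴹ
      term i with i ∈? Q
      ... | yes e = ≈-trans (reflexive (cong (if_then f i else 0ᴹ) e)) (h i e)
      ... | no e = reflexive (cong (if_then f i else 0ᴹ) (∉⇒false Q e))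

    Π[]-single : ∀ Q {f : Fin m → Carrier} j → j ∈ Q → (∀ i → i ∈ Q → i ≢ j → f i ≈ 0ᴹ) → Π[ Q ] f ≈ f j
    Π[]-single Q {f} j hj h = ≈-trans (Π-single _ j term) (reflexive (cong (if_then f j else 0ᴹ) hj))
      where
      term : ∀ i → i ≢ j → (if Q i then f i else 0ᴹ) ≈ 0ᴹ
      term i ne with i ∈? Q
      ... | yes e = ≈-trans (reflexive (cong (if_then f i else 0ᴹ) e)) (h i e ne)
      ... | no e = reflexive (cong (if_then f i else 0ᴹ) (∉⇒false Q e))

    Π[]-homo : ∀ Q (θ : Carrier → Carrier) → θ 0ᴹ ≈ 0ᴹ → (∀ x y → θ (x ⊕ y) ≈ θ x ⊕ θ y) →
               ∀ (f : Fin m → Carrier) → θ (Π[ Q ] f) ≈ Π[ Q ] (θ ∘ f)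
    Π[]-homo Q θ θε θ⊕ f = ≈-trans (Π-homo θ θε θ⊕ _) (Π-cong λ i → branch (Q i) (f i))
      where
      branch : ∀ b x → θ (if b then x else 0ᴹ) ≈ (if b then θ x else 0ᴹ)
      branch true x = ≈-refl
      branch false x = θε

    Π[]-comm : ∀ P Q (f : Fin m → Fin m → Carrier) → Π[ P ] (λ i → Π[ Q ] (f i)) ≈ Π[ Q ] (λ j → Π[ P ] λ i → f i j)
    Π[]-comm P Q f = ≈-trans (Π-cong λ i → inside (P i) (λ j → if Q j then f i j else 0ᴹ)) (≈-trans (Π-comm _)
      (Π-cong λ j → ≈-trans (Π-cong λ i → swap (P i) (Q j) (f i j)) (≈-sym (inside (Q j) _))))
      where
      inside : ∀ b (g : Fin m → Carrier) → (if b then Π g else 0ᴹ) ≈ Π λ j → if b then g j else 0ᴹ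
      inside true g = ≈-refl
      inside false g = ≈-sym (Π-ε λ _ → ≈-refl)
      swap : ∀ a b x → (if a then (if b then x else 0ᴹ) else 0ᴹ) ≈ (if b then (if a then x else 0ᴹ) else 0ᴹ)
      swap true b x = ≈-refl
      swap false true x = ≈-refl
      swap false false x = ≈-refl

    Π[]-reindex : ∀ Q (f : Fin m → Carrier) (φ : Fin m → Fin m) → (∀ i → i ∈ Q → φ i ∈ Q) →
                  (∀ i j → i ∈ Q → j ∈ Q → φ i ≡ φ j → i ≡ j) → Π[ Q ] f ≈ Π[ Q ] (f ∘ φ)
    Π[]-reindex Q f φ into inj = ≈-trans
      (Π-reindex _ φ̂ (proj₁ ∘ surj) (proj₂ ∘ surj) (λ i → φ̂-injective _ _ (proj₂ (surj (φ̂ i)))))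
      (Π-cong term)
      where
      -- `φ` is extended by the identity outside `Q`, giving a permutation of the whole index set.
      φ̂ : Fin m → Fin m
      φ̂ i = if Q i then φ i else i
      φ̂-in : ∀ {i} → i ∈ Q → φ̂ i ≡ φ i
      φ̂-in {i} h = cong (if_then φ i else i) h
      φ̂-out : ∀ {i} → i ∉ Q → φ̂ i ≡ i
      φ̂-out {i} h = cong (if_then φ i else i) (∉⇒false Q h)
      φ̂-injective : ∀ i j → φ̂ i ≡ φ̂ j → i ≡ j
      φ̂-injective i j e with i ∈? Q | j ∈? Q
      ... | yes hi | yes hj = inj i j hi hj (trans (sym (φ̂-in hi)) (trans e (φ̂-in hj)))
      ... | yes hi | no hj = contradiction (subst (_∈ Q) (trans (sym (φ̂-in hi)) (trans e (φ̂-out hj)))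
          (into i hi)) hj
      ... | no hi | yes hj = contradiction (subst (_∈ Q) (trans (sym (φ̂-in hj)) (trans (sym e) (φ̂-out hi)))
          (into j hj)) hi
      ... | no hi | no hj = trans (sym (φ̂-out hi)) (trans e (φ̂-out hj))
      surj : ∀ j → ∃ λ i → φ̂ i ≡ j
      surj j = let i , _ , e = injection⇒surjection full full φ̂ (λ _ _ → refl) (λ i j _ _ → φ̂-injective i j) ℕₚ.≤-refl j refl in i , e
      term : ∀ i → (if Q (φ̂ i) then f (φ̂ i) else 0ᴹ) ≈ (if Q i then f (φ i) else 0ᴹ)
      term i with i ∈? Q
      ... | yes h = reflexive (trans (cong (λ t → if Q t then f t else 0ᴹ) (φ̂-in h))
                      (trans (cong (if_then f (φ i) else 0ᴹ) (into i h)) (sym (cong (if_then f (φ i) else 0ᴹ) h))))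
      ... | no h = reflexive (trans (cong (λ t → if Q t then f t else 0ᴹ) (φ̂-out h))
                      (trans (cong (if_then f i else 0ᴹ) (∉⇒false Q h))
                          (sym (cong (if_then f (φ i) else 0ᴹ) (∉⇒false Q h)))))

-- Comparing the kernels of two malnormal subgroups.

module Complements {m : ℕ} (G : FinGroup m) where

  open import Data.Nat renaming (_^_ to _^ⁿ_)

  import Data.Nat.Properties as ℕₚ
  open import Data.Nat.Divisibility
  open import Data.Nat.GCD using (module Bézout)
  open import Data.Nat.Coprimality using (Coprime; coprime-Bézout)
  open import Data.Nat.Primality using (Prime)
  open import Data.Vec using ([]; _∷_)
  open import Data.Empty using (⊥)
  open import Algebra.Bundles using (CommutativeMonoid)
  import Algebra.Properties.Monoid.Mult as Mult
  open Counting
  open PrimePowers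
  open Orbits G
  open SylowSubgroups
  open Conjugation G
  open Kernels G
  open FinGroup G

  -- If Q normalises two p-Sylow subgroups of K, these coincide, because some z ∈ Q acts on K without fixed points.
  invariant-sylow-unique : ∀ {K P P′ p z} → IsSub K → Normal K → Prime p → Sylow G p K P → Sylow G p K P′ →
      count P′ ≡ count P →
                           (∀ k → k ∈ K → k ∙ z ≡ z ∙ k → k ≡ ε) → z ∈ normaliser P → z ∈ normaliser P′ → ∀ g → P′ g ≡ P g
  invariant-sylow-unique {K} {P} {P′} {p} {z} isK K-normal hp S S′ ∣P′∣ free zP zP′ g =
    trans (eq g) (sym (normaliser-sound P k∈N g))
    where
    module K = IsSub isK
    N = normaliser P
    module N = IsSub (normaliser-isSub P)
    conjugate = sylow-conjugate hp isK S (Sylow.isSub S′) (Sylow.P⊆Y S′) ∣P′∣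
    k : Fin m
    k = proj₁ conjugate
    hk : k ∈ K
    hk = proj₁ (proj₂ conjugate)
    eq : ∀ g → P′ g ≡ P (g ^ k)
    eq = proj₂ (proj₂ conjugate)
    -- `P′` is carried to `P` by `k`, so `k` carries the normaliser of `P′`, which contains `z`, to
    -- that of `P`.
    zᵏ∈N : z ^ k ∈ N
    zᵏ∈N = normaliser-complete P λ x → begin
      P x                              ≡⟨ cong P (sym (^-undo′ x k)) ⟩
      P ((x ^ (k ⁻¹)) ^ k)             ≡⟨ sym (eq _) ⟩
      P′ (x ^ (k ⁻¹))                  ≡⟨ normaliser-sound P′ zP′ _ ⟩
      P′ ((x ^ (k ⁻¹)) ^ z)            ≡⟨ eq _ ⟩
      P (((x ^ (k ⁻¹)) ^ z) ^ k)       ≡⟨ cong P (^-conj _ z k) ⟩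
      P (((x ^ (k ⁻¹)) ^ k) ^ (z ^ k)) ≡⟨ cong (λ t → P (t ^ (z ^ k))) (^-undo′ x k) ⟩
      P (x ^ (z ^ k))                  ∎
      where open ≡-Reasoning
    commutator∈K : ∀ y → y ∈ K → z ⁻¹ ∙ z ^ y ∈ K
    commutator∈K y hy = subst (_∈ K) (solveᴳ (z ∷ y ∷ []) (a₀ :⁻¹ :∙ a₁ :⁻¹ :∙ a₀ :∙ a₁)
        (a₀ :⁻¹ :∙ (a₁ :⁻¹ :∙ a₀ :∙ a₁)) refl)
      (K.∙∈ (K-normal z (K.⁻¹∈ hy)) hy)
    N₀ : Sub m
    N₀ = N ∩ K
    -- As `z` commutes with nothing in `K` but `ε`, the commutator map `y ↦ z ⁻¹ ∙ z ^ y` is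
    -- injective on `K`. It preserves the finite set `N ∩ K`, so it is onto there and hits the value
    -- at `k`; injectivity on `K` then identifies `k` with an element of `N`.
    onto = injection⇒surjection N₀ N₀ (λ y → z ⁻¹ ∙ z ^ y)
      (λ y hy → let hN , hK = ∧-true hy in cong₂ _∧_ (N.∙∈ (N.⁻¹∈ zP) (N.∙∈ (N.∙∈ (N.⁻¹∈ hN) zP) hN)) (commutator∈K y hK))
      (λ y y′ hy hy′ e → ∙⁻¹≡ε⇒≡ (free _ (K.∙∈ (proj₂ (∧-true {N y} hy)) (K.⁻¹∈ (proj₂ (∧-true {N y′} hy′))))
          (^-same (sym (∙-cancelˡ (z ⁻¹) e)))))
      ℕₚ.≤-refl (z ⁻¹ ∙ z ^ k) (cong₂ _∧_ (N.∙∈ (N.⁻¹∈ zP) zᵏ∈N) (commutator∈K k hk))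
    k∈N : k ∈ N
    k∈N = let y , hy , e = onto in
      subst (_∈ N) (sym (∙⁻¹≡ε⇒≡ (free _ (K.∙∈ hk (K.⁻¹∈ (proj₂ (∧-true {N y} hy)))) (^-same (∙-cancelˡ (z ⁻¹) e)))))
        (proj₁ (∧-true hy))

  -- Multiplying the conjugates of b ∈ B by x s x⁻¹ over all x ∈ Q and s ∈ R gives ε in one order and ∣Q∣ ⊗ b in the other.
  module AbelianContradiction
    {B Q R : Sub m} (isB : IsSub B) (isQ : IsSub Q) (isR : IsSub R)
    (B-comm : ∀ {x y} → x ∈ B → y ∈ B → x ∙ y ≡ y ∙ x)
    (Q-acts : ∀ {g x} → g ∈ Q → x ∈ B → g ∙ x ∙ g ⁻¹ ∈ B) (R-acts : ∀ {g x} → g ∈ R → x ∈ B → g ∙ x ∙ g ⁻¹ ∈ B)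
    (R-Q : ∀ {s x} → s ∈ R → x ∈ Q → s ∙ x ∙ s ⁻¹ ∈ Q)
    {z s₀ : Fin m} (hz : z ∈ Q) (hs₀ : s₀ ∈ R)
    (Q-free : ∀ b → b ∈ B → b ∙ z ≡ z ∙ b → b ≡ ε) (R-free : ∀ b → b ∈ B → b ∙ s₀ ≡ s₀ ∙ b → b ≡ ε)
    (R-free-Q : ∀ s x → s ∈ R → s ≢ ε → x ∈ Q → x ∙ s ≡ s ∙ x → x ≡ ε) where

    private
      module B = IsSub isB
      module Q = IsSub isQ
      module R = IsSub isR

    𝔹 : CommutativeMonoid _ _
    𝔹 = record
      { Carrier = ∃ (_∈ B) ; _≈_ = λ x y → proj₁ x ≡ proj₁ y
      ; _∙_ = λ (x , hx) (y , hy) → x ∙ y , B.∙∈ hx hy ; ε = ε , B.ε∈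
      ; isCommutativeMonoid = record
        { isMonoid = record
          { isSemigroup = record
            { isMagma = record
              { isEquivalence = record { refl = refl ; sym = sym ; trans = trans }
              ; ∙-cong = cong₂ _∙_ }
            ; assoc = λ x y z → assoc _ _ _ }
          ; identity = (λ x → identityˡ _) , (λ x → identityʳ _) }
        ; comm = λ (x , hx) (y , hy) → B-comm hx hy } }

    open RestrictedProduct 𝔹
    open CommutativeMonoid 𝔹 using (Carrier; _≈_) renaming (ε to 0ᴹ; _∙_ to _⊕_)

    -- Conjugation made total: the value `0ᴹ` is a default for conjugates outside `B`, which do not
    -- occur for products of elements of `Q` and `R`.
    act : Fin m → Carrier → Carrier
    act g (b , hb) with (g ∙ b ∙ g ⁻¹) ∈? B
    ... | yes h = g ∙ b ∙ g ⁻¹ , h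
    ... | no _ = 0ᴹ

    act-value : ∀ g b → g ∙ proj₁ b ∙ g ⁻¹ ∈ B → proj₁ (act g b) ≡ g ∙ proj₁ b ∙ g ⁻¹
    act-value g (b , hb) h with (g ∙ b ∙ g ⁻¹) ∈? B
    ... | yes _ = refl
    ... | no n = contradiction h n

    conj-ε : ∀ g → g ∙ ε ∙ g ⁻¹ ≡ ε
    conj-ε g = solveᴳ (g ∷ []) (a₀ :∙ :ε :∙ a₀ :⁻¹) :ε refl

    module _ {A : Sub m} (isA : IsSub A) (A-acts : ∀ {g x} → g ∈ A → x ∈ B → g ∙ x ∙ g ⁻¹ ∈ B) where
      private module A = IsSub isA

      act-homo : ∀ {g} → g ∈ A → ∀ x y → act g (x ⊕ y) ≈ act g x ⊕ act g y
      act-homo {g} hg x@(x₁ , hx) y@(y₁ , hy) = trans (act-value g (x ⊕ y) (A-acts hg (B.∙∈ hx hy)))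
        (trans (solveᴳ (g ∷ x₁ ∷ y₁ ∷ []) (a₀ :∙ (a₁ :∙ a₂) :∙ a₀ :⁻¹)
            (a₀ :∙ a₁ :∙ a₀ :⁻¹ :∙ (a₀ :∙ a₂ :∙ a₀ :⁻¹)) refl)
          (sym (cong₂ _∙_ (act-value g x (A-acts hg hx)) (act-value g y (A-acts hg hy)))))

      act-ε : ∀ {g} → g ∈ A → act g 0ᴹ ≈ 0ᴹ
      act-ε {g} hg = trans (act-value g 0ᴹ (A-acts hg B.ε∈)) (conj-ε g)

      -- The product over an A-orbit is fixed by A.
      orbit-product : ∀ {y} → y ∈ A → (∀ b → b ∈ B → b ∙ y ≡ y ∙ b → b ≡ ε) → ∀ b → Π[ A ] (λ g → act g b) ≈ 0ᴹ
      orbit-product {y} hy y-free b = y-free (proj₁ t) (proj₂ t)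
        (trans (cong (_∙ y) (sym fixed)) (solveᴳ (y ∷ proj₁ t ∷ []) (a₀ :∙ a₁ :∙ a₀ :⁻¹ :∙ a₀) (a₀ :∙ a₁) refl))
        where
        t = Π[ A ] (λ g → act g b)
        fixed : y ∙ proj₁ t ∙ y ⁻¹ ≡ proj₁ t
        fixed = trans (sym (act-value y t (A-acts hy (proj₂ t))))
          (trans (Π[]-homo A (act y) (act-ε hy) (act-homo hy) (λ g → act g b))
          (trans (Π[]-cong A {act y ∘ λ g → act g b} {λ g → act (y ∙ g) b} λ g hg →
              trans (act-value y (act g b) (A-acts hy (proj₂ (act g b))))
                (trans (cong (λ c → y ∙ c ∙ y ⁻¹) (act-value g b (A-acts hg (proj₂ b))))
                  (trans (solveᴳ (y ∷ g ∷ proj₁ b ∷ []) (a₀ :∙ (a₁ :∙ a₂ :∙ a₁ :⁻¹) :∙ a₀ :⁻¹)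
                      ((a₀ :∙ a₁) :∙ a₂ :∙ (a₀ :∙ a₁) :⁻¹) refl)
                    (sym (act-value (y ∙ g) b (A-acts (A.∙∈ hy hg) (proj₂ b)))))))
            (sym (Π[]-reindex A (λ g → act g b) (y ∙_) (λ g hg → A.∙∈ hy hg) (λ g h _ _ e → ∙-cancelˡ y e)))))

    ∣Q∣⊗b : ∀ b → count Q ⊗ b ≈ 0ᴹ
    ∣Q∣⊗b b = trans (sym (Π-count Q b)) (trans (sym diagonal) (trans (sym (Π[]-comm Q R T)) columns))
      where
      T : Fin m → Fin m → Carrier
      T x s = act (x ∙ s ∙ x ⁻¹) b
      QR-acts : ∀ {x s c} → x ∈ Q → s ∈ R → c ∈ B → (x ∙ s ∙ x ⁻¹) ∙ c ∙ (x ∙ s ∙ x ⁻¹) ⁻¹ ∈ B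
      QR-acts {x} {s} {c} hx hs hc = subst (_∈ B)
        (solveᴳ (x ∷ s ∷ c ∷ []) (a₀ :∙ (a₁ :∙ (a₀ :⁻¹ :∙ a₂ :∙ (a₀ :⁻¹) :⁻¹) :∙ a₁ :⁻¹) :∙ a₀ :⁻¹)
          ((a₀ :∙ a₁ :∙ a₀ :⁻¹) :∙ a₂ :∙ (a₀ :∙ a₁ :∙ a₀ :⁻¹) :⁻¹) refl)
        (Q-acts hx (R-acts hs (Q-acts (Q.⁻¹∈ hx) hc)))
      -- For fixed `x` the product over `s` is the `x`-conjugate of the product over an `R`-orbit,
      -- hence trivial.
      columns : Π[ Q ] (λ x → Π[ R ] (T x)) ≈ 0ᴹ
      columns = Π[]-ε Q λ x hx → let b′ = act (x ⁻¹) b in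
        trans (Π[]-cong R {T x} {act x ∘ λ s → act s b′} λ s hs →
          trans (act-value _ b (QR-acts hx hs (proj₂ b)))
            (trans (solveᴳ (x ∷ s ∷ proj₁ b ∷ []) ((a₀ :∙ a₁ :∙ a₀ :⁻¹) :∙ a₂ :∙ (a₀ :∙ a₁ :∙ a₀ :⁻¹) :⁻¹)
               (a₀ :∙ (a₁ :∙ (a₀ :⁻¹ :∙ a₂ :∙ (a₀ :⁻¹) :⁻¹) :∙ a₁ :⁻¹) :∙ a₀ :⁻¹) refl)
              (sym (trans (act-value x (act s b′) (Q-acts hx (proj₂ (act s b′)))) (cong (λ c → x ∙ c ∙ x ⁻¹)
                (trans (act-value s b′ (R-acts hs (proj₂ b′)))
                    (cong (λ c → s ∙ c ∙ s ⁻¹) (act-value (x ⁻¹) b (Q-acts (Q.⁻¹∈ hx) (proj₂ b)))))))))) 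
        (trans (sym (Π[]-homo R (act x) (act-ε isQ Q-acts hx) (act-homo isQ Q-acts hx) (λ s → act s b′)))
          (trans (act-value x (Π[ R ] λ s → act s b′) (Q-acts hx (proj₂ (Π[ R ] λ s → act s b′))))
            (trans (cong (λ c → x ∙ c ∙ x ⁻¹) (orbit-product isR R-acts hs₀ R-free b′)) (conj-ε x))))
      diagonal : Π[ R ] (λ s → Π[ Q ] λ x → T x s) ≈ Π[ Q ] (λ _ → b)
      diagonal = trans (Π[]-single R {λ s → Π[ Q ] λ x → T x s} ε R.ε∈ off)
        (Π[]-cong Q {λ x → T x ε} {λ _ → b} λ x hx → trans (act-value _ b (QR-acts hx R.ε∈ (proj₂ b)))
          (solveᴳ (x ∷ proj₁ b ∷ []) ((a₀ :∙ :ε :∙ a₀ :⁻¹) :∙ a₁ :∙ (a₀ :∙ :ε :∙ a₀ :⁻¹) :⁻¹) a₁ refl))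
        where
        off : ∀ s → s ∈ R → s ≢ ε → Π[ Q ] (λ x → T x s) ≈ 0ᴹ
        off s hs ne = trans (Π[]-cong Q {λ x → T x s} {(λ y → act y (act s b)) ∘ φ} λ x hx →
            trans (act-value _ b (QR-acts hx hs (proj₂ b)))
              (trans (solveᴳ (x ∷ s ∷ proj₁ b ∷ []) ((a₀ :∙ a₁ :∙ a₀ :⁻¹) :∙ a₂ :∙ (a₀ :∙ a₁ :∙ a₀ :⁻¹) :⁻¹)
                ((a₀ :∙ (a₁ :∙ a₀ :⁻¹ :∙ a₁ :⁻¹)) :∙ (a₁ :∙ a₂ :∙ a₁ :⁻¹) :∙
                    (a₀ :∙ (a₁ :∙ a₀ :⁻¹ :∙ a₁ :⁻¹)) :⁻¹) refl)
                (sym (trans (act-value (φ x) (act s b) (Q-acts (φ-in x hx) (proj₂ (act s b))))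
                  (cong (λ c → φ x ∙ c ∙ φ x ⁻¹) (act-value s b (R-acts hs (proj₂ b))))))))
          (trans (sym (Π[]-reindex Q (λ y → act y (act s b)) φ φ-in φ-injective))
            (orbit-product isQ Q-acts hz Q-free (act s b)))
          where
          -- `x s x⁻¹` is `φ x ∙ s`, and `φ` permutes `Q` because `s` acts freely on it. So for
          -- `s ≢ ε` the product over `x` is a product over a `Q`-orbit and vanishes; only `s = ε`
          -- survives.
          φ : Fin m → Fin m
          φ x = x ∙ (s ∙ x ⁻¹ ∙ s ⁻¹)
          φ-in : ∀ x → x ∈ Q → φ x ∈ Q
          φ-in x hx = Q.∙∈ hx (R-Q hs (Q.⁻¹∈ hx))
          φ-injective : ∀ x y → x ∈ Q → y ∈ Q → φ x ≡ φ y → x ≡ y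
          φ-injective x y hx hy e = sym (trans (sym (⁻¹-involutive y)) (sym (inverse-unique (y ⁻¹) x
            (R-free-Q s (y ⁻¹ ∙ x) hs ne (Q.∙∈ (Q.⁻¹∈ hy) hx)
              (trans (solveᴳ (x ∷ y ∷ s ∷ []) (a₁ :⁻¹ :∙ a₀ :∙ a₂) (a₁ :⁻¹ :∙ (a₀ :∙ (a₂ :∙ a₀ :⁻¹ :∙ a₂ :⁻¹)) :∙
                  (a₂ :∙ a₀)) refl)
                (trans (cong (λ t → y ⁻¹ ∙ t ∙ (s ∙ x)) e)
                  (solveᴳ (x ∷ y ∷ s ∷ []) (a₁ :⁻¹ :∙ (a₁ :∙ (a₂ :∙ a₁ :⁻¹ :∙ a₂ :⁻¹)) :∙ (a₂ :∙ a₀))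
                      (a₂ :∙ (a₁ :⁻¹ :∙ a₀)) refl)))))))

    -- Translation by `b` permutes `B`, so the product of all elements of `B` absorbs `count B`
    -- copies of `b`.
    ∣B∣⊗b : ∀ b → count B ⊗ b ≈ 0ᴹ
    ∣B∣⊗b b@(b₁ , hb) = ∙-cancelˡ (proj₁ total) (trans (B-comm (proj₂ total) (proj₂ (count B ⊗ b)))
        (trans (cong₂ _∙_ (sym (Π-count B b)) refl)
            (trans (sym (Π-⊕ (λ i → if B i then b else 0ᴹ) (λ i → if B i then element i else 0ᴹ)))
          (trans (Π-cong merge) (trans
              (sym (Π[]-reindex B element (b₁ ∙_) (λ i hi → B.∙∈ hb hi) (λ i j _ _ e → ∙-cancelˡ b₁ e)))
                  (sym (identityʳ _)))))))
      where
      element : Fin m → Carrier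
      element i with i ∈? B
      ... | yes h = i , h
      ... | no _ = 0ᴹ
      element-value : ∀ {i} → i ∈ B → proj₁ (element i) ≡ i
      element-value {i} h with i ∈? B
      ... | yes _ = refl
      ... | no n = contradiction h n
      total = Π[ B ] element
      merge : ∀ i → (if B i then b else 0ᴹ) ⊕ (if B i then element i else 0ᴹ) ≈ (if B i then element (b₁ ∙ i) else 0ᴹ)
      merge i = branch (B i) refl
        where
        branch : ∀ c → B i ≡ c → (if c then b else 0ᴹ) ⊕ (if c then element i else 0ᴹ) ≈
            (if c then element (b₁ ∙ i) else 0ᴹ)
        branch true h = trans (cong (b₁ ∙_) (element-value h)) (sym (element-value (B.∙∈ hb h)))
        branch false h = identityˡ ε

    ⊗-multiple : ∀ k {n} b → n ⊗ b ≈ 0ᴹ → (k * n) ⊗ b ≈ 0ᴹ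
    ⊗-multiple k {n} b h = trans (sym (Mult.×-assocˡ monoid b k n)) (trans (Mult.×-congʳ monoid k {n ⊗ b} {0ᴹ} h)
        (zeros k))
      where
      open CommutativeMonoid 𝔹 using (monoid)
      zeros : ∀ k → k ⊗ 0ᴹ ≈ 0ᴹ
      zeros zero = refl
      zeros (suc k) = trans (cong (ε ∙_) (zeros k)) (identityˡ ε)

    B-trivial : Coprime (count Q) (count B) → ∀ b → b ∈ B → b ≡ ε
    B-trivial coprime b hb = from (coprime-Bézout coprime)
      where
      b̂ : Carrier
      b̂ = b , hb
      conclude : ∀ {i j} → suc i ≡ j → i ⊗ b̂ ≈ 0ᴹ → j ⊗ b̂ ≈ 0ᴹ → b ≡ ε
      conclude {i} {j} e hi hj = trans (sym (identityʳ b))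
          (trans (cong (b ∙_) (sym hi)) (trans (cong (λ k → proj₁ (k ⊗ b̂)) e) hj))
      from : Bézout.Identity 1 (count Q) (count B) → b ≡ ε
      from (Bézout.+- x y e) = conclude e (⊗-multiple y b̂ (∣B∣⊗b b̂)) (⊗-multiple x b̂ (∣Q∣⊗b b̂))
      from (Bézout.-+ x y e) = conclude e (⊗-multiple x b̂ (∣Q∣⊗b b̂)) (⊗-multiple y b̂ (∣B∣⊗b b̂))

  coprime-orders : ∀ {A B} → IsSub A → IsSub B → ∀ {q} → Prime q → ∀ b → count A ≡ q ^ⁿ b → ¬ q ∣ count B →
                   ∀ x → x ∈ A → x ∈ B → x ≡ ε
  coprime-orders {A} {B} isA isB hq b ∣A∣ q∤B x hA hB = decidable-stable (x Fin.≟ ε) λ ne →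
      contradiction (nontrivial-count isC (cong₂ _∧_ hA hB) ne) (subst (λ n → ¬ 1 < n) (sym one) λ { (s≤s ()) })
    where
    C = A ∩ B
    isC = ∩-isSub isA isB
    one : count C ≡ 1
    one with p∣divisor hq b {count C} (subst (count C ∣_) ∣A∣ (lagrange isC isA λ y h → proj₁ (∧-true h)))
    ... | inj₁ e = e
    ... | inj₂ d = contradiction (∣-trans d (lagrange isC isB λ y h → proj₂ (∧-true {A y} h))) q∤B

  module TwoComplements {H S : Sub m} (isH : IsSub H) (H-malnormal : Malnormal H) (isS : IsSub S)
      (S-malnormal : Malnormal S) where
    private
      module H = Kernel isH H-malnormal
      module S = Kernel isS S-malnormal

    -- If no `h ≢ ε` of `H` lies in `S.K`, no element of `S.K` is outside `H.K`, as it would have a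
    -- conjugate in `H`. Otherwise `k ↦ h ^ k ∙ h ⁻¹` is injective on `H.K` by `free`, so every
    -- element of `H.K` is such a commutator; those lie in `S.K`, which is normal and contains `h`.
    comparable : H.K ⊆ S.K ⊎ S.K ⊆ H.K
    comparable with Finₚ.any? (λ h → (h ∈? S.K) ×-dec (h ∈? H) ×-dec ¬? (h Fin.≟ ε))
    ... | no none = inj₂ λ x hx → decidable-stable (x ∈? H.K) λ x∉ →
            let y , hy = H.∉K⇒conjugate x∉ in none (x ^ y , S.K-normal y hx , hy , ^-≢ε y (H.∉K⇒≢ε x∉))
    ... | yes (h , hS , hH , h≢ε) = inj₁ λ k hk →
            let x , hx , e = injection⇒surjection H.K H.K (λ k → h ^ k ∙ h ⁻¹)
                  (λ k hk → subst (_∈ H.K) (solveᴳ (h ∷ k ∷ []) (a₁ :⁻¹ :∙ ((a₀ :⁻¹) :⁻¹ :∙ a₁ :∙ a₀ :⁻¹))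
                      (a₁ :⁻¹ :∙ a₀ :∙ a₁ :∙ a₀ :⁻¹) refl)
                    (K.∙∈ (K.⁻¹∈ hk) (H.K-normal (h ⁻¹) hk)))
                  (λ k k′ hk hk′ e → ∙⁻¹≡ε⇒≡ (H.free (λ hK → h≢ε (H.K∩H hK hH)) (K.∙∈ hk (K.⁻¹∈ hk′))
                      (^-same (sym (cancel e)))))
                  ℕₚ.≤-refl k hk in
            subst (_∈ S.K) e (IsSub.∙∈ S.K-isSub (S.K-normal x hS) (IsSub.⁻¹∈ S.K-isSub hS))
      where
      module K = IsSub H.K-isSub
      cancel : ∀ {x y} → x ∙ h ⁻¹ ≡ y ∙ h ⁻¹ → x ≡ y
      cancel {x} {y} e = trans (solveᴳ (x ∷ h ∷ []) a₀ (a₀ :∙ a₁ :⁻¹ :∙ a₁) refl)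
          (trans (cong (_∙ h) e) (solveᴳ (y ∷ h ∷ []) (a₀ :∙ a₁ :⁻¹ :∙ a₁) a₀ refl))

    kernel-maximal : (∃ λ k → k ∈ H.K × k ≢ ε) → (∃ λ s → s ∈ S × s ≢ ε) → H.K ⊆ S.K → S.K ⊆ H.K
    kernel-maximal (k₀ , hk₀ , k₀≢ε) (s₁ , hs₁ , s₁≢ε) K⊆M g gM = decidable-stable (g ∈? K) absurd
      where
      K = H.K
      M = S.K
      absurd : g ∉ K → ⊥
      absurd g∉K = proj₂ (proj₂ centre-element) (B-trivial coprime-QB b (proj₁ (proj₂ centre-element)))
        where
        x₁ = proj₁ (H.∉K⇒conjugate g∉K)
        -- `g` is in `M` but not in `K`, so it has a conjugate in `H`, which stays in the normal
        -- `M`. A prime `q` of `L` divides the order of `H`, hence not that of `K`; a prime `r` of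
        -- `S` does not divide that of `M`. These are the conditions for `invariant-sylow`.
        L = M ∩ H
        isL = ∩-isSub S.K-isSub isH
        l∈L : g ^ x₁ ∈ L
        l∈L = cong₂ _∧_ (S.K-normal x₁ gM) (proj₂ (H.∉K⇒conjugate g∉K))
        divisor-q = prime-divisor (count L) (nontrivial-count isL l∈L (^-≢ε x₁ (H.∉K⇒≢ε g∉K)))
        q = proj₁ divisor-q
        hq = proj₁ (proj₂ divisor-q)
        q∤K : ¬ q ∣ count K
        q∤K = H.prime∤K hq (∣-trans (proj₂ (proj₂ divisor-q)) (lagrange isL isH λ y h → proj₂ (∧-true {M y} h)))
        divisor-r = prime-divisor (count S) (nontrivial-count isS hs₁ s₁≢ε)
        r = proj₁ divisor-r
        hr = proj₁ (proj₂ divisor-r)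
        r∤M : ¬ r ∣ count M
        r∤M = S.prime∤K hr (proj₂ (proj₂ divisor-r))
        divisor-p = prime-divisor (count K) (nontrivial-count H.K-isSub hk₀ k₀≢ε)
        p = proj₁ divisor-p
        hp = proj₁ (proj₂ divisor-p)
        sylow-R = sylow G hr isS
        R = proj₁ sylow-R
        module R = Sylow (proj₂ sylow-R)
        sylow-Q = invariant-sylow hq R.a S.K-isSub S.K-normal R.isSub hr R.∣P∣ r∤M
        Q = proj₁ sylow-Q
        module Q = Sylow (proj₁ (proj₂ sylow-Q))
        R⊆NQ : R ⊆ normaliser Q
        R⊆NQ = proj₂ (proj₂ sylow-Q)
        sylow-P = invariant-sylow hp Q.a H.K-isSub H.K-normal Q.isSub hq Q.∣P∣ q∤K
        P = proj₁ sylow-P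
        module P = Sylow (proj₁ (proj₂ sylow-P))
        Q⊆NP : Q ⊆ normaliser P
        Q⊆NP = proj₂ (proj₂ sylow-P)
        z-element = sylow-nontrivial hq (proj₁ (proj₂ sylow-Q)) (∣-trans (proj₂ (proj₂ divisor-q))
            (lagrange isL S.K-isSub λ y h → proj₁ (∧-true h)))
        z = proj₁ z-element
        s-element = sylow-nontrivial hr (proj₂ sylow-R) (proj₂ (proj₂ divisor-r))
        s₀ = proj₁ s-element
        z∉K : z ∉ K
        z∉K hK = proj₂ (proj₂ z-element) (coprime-orders Q.isSub H.K-isSub hq Q.a Q.∣P∣ q∤K z
            (proj₁ (proj₂ z-element)) hK)
        R∩M : ∀ {s} → s ∈ R → s ≢ ε → s ∉ M
        R∩M hs ne hM = ne (S.K∩H hM (R.P⊆Y _ hs))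
        R-Q : ∀ {s x} → s ∈ R → x ∈ Q → x ^ s ∈ Q
        R-Q {s} {x} hs hx = trans (sym (normaliser-sound Q (R⊆NQ s hs) x)) hx
        -- `R` normalises `Q`, so for `s ∈ R` the conjugate `conj s P` is again normalised by
        -- `z ∈ Q`; uniqueness of such a Sylow subgroup makes it `P`.
        R⊆NP : R ⊆ normaliser P
        R⊆NP s hs = normaliser-complete P λ x → sym (invariant-sylow-unique H.K-isSub H.K-normal hp
          (proj₁ (proj₂ sylow-P)) (sylow-conj hp H.K-normal (proj₁ (proj₂ sylow-P)) s) (conj-count s P)
          (λ k hk → H.free z∉K hk) (Q⊆NP z (proj₁ (proj₂ z-element)))
          (normaliser-complete (conj s P) λ y → trans
              (normaliser-sound P (Q⊆NP (z ^ s) (R-Q hs (proj₁ (proj₂ z-element)))) (y ^ s))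
            (cong P (sym (^-conj y z s)))) x)
        B = centre P
        B-sound : ∀ {x} → x ∈ B → x ∈ P × (∀ y → y ∈ P → x ^ y ≡ x)
        B-sound {x} = does-sound (centre? P x)
        B-complete : ∀ {x} → x ∈ P × (∀ y → y ∈ P → x ^ y ≡ x) → x ∈ B
        B-complete {x} = dec-true (centre? P x)
        module PS = IsSub P.isSub
        isB : IsSub B
        isB = record
          { ε∈ = B-complete (PS.ε∈ , λ y _ → ε^ y)
          ; ∙∈ = λ {x} {y} hx hy → B-complete (PS.∙∈ (proj₁ (B-sound hx)) (proj₁ (B-sound hy)) ,
              λ w hw → trans (^-homo x y w) (cong₂ _∙_ (proj₂ (B-sound hx) w hw) (proj₂ (B-sound hy) w hw)))
          ; ⁻¹∈ = λ {x} hx → B-complete (PS.⁻¹∈ (proj₁ (B-sound hx)) , λ w hw → trans (^-⁻¹ x w)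
              (cong _⁻¹ (proj₂ (B-sound hx) w hw))) }
        centre-element = centre-nontrivial hp P.a P.isSub P.∣P∣
          (sylow-nontrivial hp (proj₁ (proj₂ sylow-P)) (proj₂ (proj₂ divisor-p)))
        b = proj₁ centre-element
        B⊆K : ∀ {x} → x ∈ B → x ∈ K
        B⊆K hx = P.P⊆Y _ (proj₁ (B-sound hx))
        normalises-B : ∀ {n x} → n ∈ normaliser P → x ∈ B → x ^ n ∈ B
        normalises-B {n} {x} hn hx = B-complete
          ( trans (sym (normaliser-sound P hn x)) (proj₁ (B-sound hx))
          , λ y hy → trans (cong ((x ^ n) ^_) (sym (^-undo′ y n))) (trans (sym (^-conj x (y ^ (n ⁻¹)) n))
              (cong (_^ n) (proj₂ (B-sound hx) (y ^ (n ⁻¹))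
                  (trans (normaliser-sound P hn _) (trans (cong P (^-undo′ y n)) hy))))))
        acts : ∀ {A} → IsSub A → A ⊆ normaliser P → ∀ {g x} → g ∈ A → x ∈ B → g ∙ x ∙ g ⁻¹ ∈ B
        acts isA A⊆N {g} {x} hg hx = subst (λ t → t ∙ x ∙ g ⁻¹ ∈ B) (⁻¹-involutive g)
            (normalises-B (A⊆N _ (IsSub.⁻¹∈ isA hg)) hx)
        open AbelianContradiction isB Q.isSub R.isSub
          (λ {x} {y} hx hy → sym (^≡⇒commute (proj₂ (B-sound hx) y (proj₁ (B-sound hy)))))
          (acts Q.isSub Q⊆NP) (acts R.isSub R⊆NP)
          (λ {s} {x} hs hx → subst (λ t → t ∙ x ∙ s ⁻¹ ∈ Q) (⁻¹-involutive s) (R-Q (IsSub.⁻¹∈ R.isSub hs) hx))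
          (proj₁ (proj₂ z-element)) (proj₁ (proj₂ s-element))
          (λ c hc → H.free z∉K (B⊆K hc))
          (λ c hc → S.free (R∩M (proj₁ (proj₂ s-element)) (proj₂ (proj₂ s-element))) (K⊆M _ (B⊆K hc)))
          (λ s x hs ne hx → S.free (R∩M hs ne) (Q.P⊆Y x hx))
        coprime-QB : Coprime (count Q) (count B)
        coprime-QB = subst (λ n → Coprime n (count B)) (sym Q.∣P∣)
          (prime-power-coprime Q.a hq λ d → q∤K (∣-trans d (lagrange isB H.K-isSub λ x hx → B⊆K hx)))

-- The product formula and equality of orders of complements.

module Orders {m : ℕ} (G : FinGroup m) where

  open import Data.Nat renaming (_^_ to _^ⁿ_)

  import Data.Nat.Properties as ℕₚ
  open Counting
  open Orbits G
  open Conjugation G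
  open Kernels G
  open Complements G
  open FinGroup G

  -- Counting the pairs (g , x) with g ^ x ∈ H.
  ∣K∣*∣H∣ : ∀ {H} (isH : IsSub H) (mal : Malnormal H) → count (Kernel.K isH mal) * count H ≡ m
  ∣K∣*∣H∣ {H} isH mal = ℕₚ.+-cancelʳ-≡ (count notK * count H) _ _ (begin
    count K * count H + count notK * count H
      ≡⟨ sym (ℕₚ.*-distribʳ-+ (count H) (count K) (count notK)) ⟩
    (count K + count notK) * count H
      ≡⟨ cong (_* count H) (trans (sym (count-split full K)) count-full) ⟩
    m * count H
      ≡⟨ cong (_* count H) (sym count-full) ⟩
    count full * count H
      ≡⟨ *-distribʳ-∑ (count H) _ ⟩
    ∑ (λ x → 1 * count H)
      ≡⟨ ∑-cong (λ x → trans (ℕₚ.*-identityˡ _) (sym (conj-count x H))) ⟩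
    ∑ (λ x → ∑ λ g → 𝕀 (H (g ^ x)))
      ≡⟨ ∑-comm _ ⟩
    ∑ (λ g → ∑ λ x → 𝕀 (H (g ^ x)))
      ≡⟨ ∑-cong fibre ⟩
    ∑ (λ g → 𝕀 (does (g Fin.≟ ε)) * m + 𝕀 (notK g) * count H)
      ≡⟨ ∑-distrib-+ _ _ ⟩
    ∑ (λ g → 𝕀 (does (g Fin.≟ ε)) * m) + ∑ (λ g → 𝕀 (notK g) * count H)
      ≡⟨ cong₂ _+_ (trans (∑-single _ ε λ g ne → cong (λ b → 𝕀 b * m) (dec-false (g Fin.≟ ε) ne))
           (trans (cong (λ b → 𝕀 b * m) (dec-true (ε Fin.≟ ε) refl)) (ℕₚ.*-identityˡ m)))
               (sym (*-distribʳ-∑ (count H) _)) ⟩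
    m + count notK * count H ∎)
    where
    open ≡-Reasoning
    open Kernel isH mal
    module H = IsSub isH
    notK : Sub m
    notK g = true ∧ not (K g)
    fibre : ∀ g → ∑ (λ x → 𝕀 (H (g ^ x))) ≡ 𝕀 (does (g Fin.≟ ε)) * m + 𝕀 (notK g) * count H
    fibre g with g ∈? K
    -- The `x` that conjugate `g` into `H` form the left coset of `H` through `a`: malnormality
    -- excludes all others.
    ... | no g∉K = trans (trans (count-translate a (λ x → H (g ^ x))) (count-cong
            (λ x h → decidable-stable (x ∈? H) λ x∉ → ^-≢ε a (∉K⇒≢ε g∉K)
                (mal x (g ^ a) x∉ (proj₂ (∉K⇒conjugate g∉K)) (subst (_∈ H) (sym (^-∙ g a x)) h)))
            (λ x h → subst (_∈ H) (^-∙ g a x) (H.∙∈ (H.∙∈ (H.⁻¹∈ h) (proj₂ (∉K⇒conjugate g∉K))) h))))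
          (sym (trans (cong₂ (λ b c → 𝕀 b * m + 𝕀 (not c) * count H) (dec-false (g Fin.≟ ε) (∉K⇒≢ε g∉K))
              (∉⇒false K g∉K)) (ℕₚ.*-identityˡ _)))
      where a = proj₁ (∉K⇒conjugate g∉K)
    ... | yes g∈K = trans (inK (K-sound g∈K))
        (sym (trans (cong (λ c → 𝕀 (does (g Fin.≟ ε)) * m + 𝕀 (not c) * count H) g∈K) (ℕₚ.+-identityʳ _)))
      where
      inK : g ∈ᴷ H → ∑ (λ x → 𝕀 (H (g ^ x))) ≡ 𝕀 (does (g Fin.≟ ε)) * m
      inK (inj₁ refl) = trans (∑-cong λ x → cong 𝕀 (trans (cong H (ε^ x)) H.ε∈)) (trans count-full
        (sym (trans (cong (λ b → 𝕀 b * m) (dec-true (ε Fin.≟ ε) refl)) (ℕₚ.*-identityˡ m))))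
      inK (inj₂ k) with g Fin.≟ ε
      ... | yes e = contradiction (subst (_∈ H) (sym (trans (^-ε g) e)) H.ε∈) (k ε)
      ... | no _ = count-∅ k

  -- With a trivial kernel the product formula would make `H` as large as `G`.
  proper⇒kernel-nontrivial : ∀ {H} (isH : IsSub H) (mal : Malnormal H) → (∃ λ g → g ∉ H) → ∃ λ k →
      k ∈ Kernel.K isH mal × k ≢ ε
  proper⇒kernel-nontrivial {H} isH mal (g , g∉H) with Finₚ.any? (λ k → (k ∈? Kernel.K isH mal) ×-dec ¬? (k Fin.≟ ε))
  ... | yes f = f
  ... | no none = contradiction (⊆-count-≡ {P = H} {full} (λ _ _ → refl)
      (ℕₚ.≤-reflexive (trans count-full (sym ∣H∣≡m))) g refl) g∉H
    where
    open Kernel isH mal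
    ∣H∣≡m : count H ≡ m
    ∣H∣≡m = trans (sym (ℕₚ.*-identityˡ _)) (trans (cong (_* count H) (sym (count≡1 K-isSub none))) (∣K∣*∣H∣ isH mal))

  complements-equinumerous : ∀ {H S} → IsSub H → Malnormal H → IsSub S → Malnormal S →
    (∃ λ h → h ∈ H × h ≢ ε) → (∃ λ g → g ∉ H) → (∃ λ s → s ∈ S × s ≢ ε) → (∃ λ g → g ∉ S) → count H ≡ count S
  complements-equinumerous {H} {S} isH malH isS malS ntH prH ntS prS =
    ℕₚ.*-cancelˡ-≡ _ _ (count H.K) {{>-nonZero (count-pos (IsSub.ε∈ H.K-isSub))}}
      (trans (∣K∣*∣H∣ isH malH)
          (sym (trans (cong (_* count S) (count-cong (proj₁ equal-kernels) (proj₂ equal-kernels)))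
              (∣K∣*∣H∣ isS malS))))
    where
    module H = Kernel isH malH
    module S = Kernel isS malS
    equal-kernels : H.K ⊆ S.K × S.K ⊆ H.K
    equal-kernels with TwoComplements.comparable isH malH isS malS
    ... | inj₁ le = le , TwoComplements.kernel-maximal isH malH isS malS
        (proper⇒kernel-nontrivial isH malH prH) ntS le
    ... | inj₂ ge = TwoComplements.kernel-maximal isS malS isH malH
        (proper⇒kernel-nontrivial isS malS prS) ntH ge , ge

-- From lists of permutations to abstract groups, and the components of the derangement graph.

module PermutationGroups where

  open import Data.Nat using (ℕ; zero; suc; _+_; _<_; _≤_; >-nonZero)
  import Data.Nat
  import Data.Nat.Properties as ℕₚ
  open import Data.Fin using (combine; fromℕ<)
  open import Data.List as List using (List; length)
  import Data.List.Relation.Unary.All as All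
  open import Data.List.Relation.Unary.Any using (index)
  open import Data.List.Relation.Unary.Any.Properties using (lookup-index)
  open import Data.List.Relation.Unary.AllPairs using (_∷_)
  open import Data.List.Relation.Unary.Unique.Propositional using (Unique)
  import Data.List.Membership.Propositional as List∈
  open import Data.List.Membership.Propositional.Properties using (∈-lookup)
  import Data.List.Membership.DecPropositional as DecMembership
  open import Data.Vec using (lookup; []; _∷_)
  open import Data.Vec.Properties using (lookup∘tabulate; tabulate∘lookup; tabulate-cong; ≡-dec)
  open import Function.Bundles using (_⤖_; mk⤖; _⇔_; mk⇔; Bijection)
  open import Defs
  open Counting

  -- The number of members of `P` below a given index; it numbers the elements of `P` consecutively.
  rank : ∀ {n} → Sub n → Fin n → ℕ
  rank P zero = 0
  rank P (suc i) = 𝕀 (P zero) + rank (P ∘ suc) i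

  rank-< : ∀ {n} (P : Sub n) i → i ∈ P → rank P i < count P
  rank-< P zero h = subst (0 <_) (sym (∑-suc (𝕀 ∘ P))) (ℕₚ.≤-trans (ℕₚ.≤-reflexive (sym (cong 𝕀 h))) (ℕₚ.m≤m+n _ _))
  rank-< P (suc i) h = subst (rank P (suc i) <_) (sym (∑-suc (𝕀 ∘ P)))
      (ℕₚ.+-monoʳ-< (𝕀 (P zero)) (rank-< (P ∘ suc) i h))

  rank-injective : ∀ {n} (P : Sub n) i j → i ∈ P → j ∈ P → rank P i ≡ rank P j → i ≡ j
  rank-injective P zero zero _ _ _ = refl
  rank-injective P zero (suc j) hi _ e = contradiction (trans e (cong (λ b → 𝕀 b + rank (P ∘ suc) j) hi)) λ ()
  rank-injective P (suc i) zero _ hj e = contradiction (trans (sym (cong (λ b → 𝕀 b + rank (P ∘ suc) i) hj)) e) λ ()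
  rank-injective P (suc i) (suc j) hi hj e = cong suc (rank-injective (P ∘ suc) i j hi hj
      (ℕₚ.+-cancelˡ-≡ (𝕀 (P zero)) _ _ e))

  unique-lookup : ∀ {A : Set} {xs : List A} → Unique xs → ∀ i j → List.lookup xs i ≡ List.lookup xs j → i ≡ j
  unique-lookup (_ ∷ _) zero zero _ = refl
  unique-lookup {xs = _ List.∷ xs} (h ∷ _) zero (suc j) e = contradiction e (All.lookup h (∈-lookup {xs = xs} j))
  unique-lookup {xs = _ List.∷ xs} (h ∷ _) (suc i) zero e = contradiction (sym e)
      (All.lookup h (∈-lookup {xs = xs} i))
  unique-lookup (_ ∷ u) (suc i) (suc j) e = cong suc (unique-lookup u i j e)

  module _ {n : ℕ} where

    map-ext : {σ τ : Map n} → (∀ x → lookup σ x ≡ lookup τ x) → σ ≡ τ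
    map-ext {σ} {τ} h = trans (sym (tabulate∘lookup σ)) (trans (tabulate-cong h) (tabulate∘lookup τ))

    _≟ₘ_ : (σ τ : Map n) → Dec (σ ≡ τ)
    _≟ₘ_ = ≡-dec Fin._≟_

    ∘ₚ-lookup : (σ τ : Map n) → ∀ x → lookup (σ ∘ₚ τ) x ≡ lookup σ (lookup τ x)
    ∘ₚ-lookup σ τ = lookup∘tabulate _

    idₚ-lookup : ∀ x → lookup (idₚ {n}) x ≡ x
    idₚ-lookup = lookup∘tabulate _

    -- The underscore stands for the local function of inv, which has no name outside Defs; it is determined by the first clause.
    mutual
      inv-lookup : ∀ (σ : Map n) → IsPerm σ → ∀ j → lookup σ (lookup (inv σ) j) ≡ j
      inv-lookup σ perm j = trans (cong (lookup σ) (lookup∘tabulate _ j)) (preimage σ perm j)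

      preimage : ∀ (σ : Map n) → IsPerm σ → ∀ j → lookup σ _ ≡ j
      preimage σ perm j with Finₚ.any? (λ i → lookup σ i Fin.≟ j)
      ... | yes (_ , e) = e
      ... | no none = contradiction (perm j) none

    module PermGroup (G : List (Map n)) (isG : IsPermGroup G) where
      open IsPermGroup isG

      m : ℕ
      m = length G

      elt : Fin m → Map n
      elt = List.lookup G

      elt∈ : ∀ i → elt i List∈.∈ G
      elt∈ = ∈-lookup

      elt-injective : ∀ {i j} → elt i ≡ elt j → i ≡ j
      elt-injective {i} {j} = unique-lookup unique i j

      act : Fin m → Fin n → Fin n
      act i = lookup (elt i)

      abstract
        _*_ : Fin m → Fin m → Fin m
        i * j = index (closed∘ (elt i) (elt j) (elt∈ i) (elt∈ j))

        elt-* : ∀ i j → elt (i * j) ≡ elt i ∘ₚ elt j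
        elt-* i j = sym (lookup-index (closed∘ (elt i) (elt j) (elt∈ i) (elt∈ j)))

        e : Fin m
        e = index has-id

        elt-e : elt e ≡ idₚ
        elt-e = sym (lookup-index has-id)

        _⁻ : Fin m → Fin m
        i ⁻ = index (closed⁻ (elt i) (elt∈ i))

        elt-⁻ : ∀ i → elt (i ⁻) ≡ inv (elt i)
        elt-⁻ i = sym (lookup-index (closed⁻ (elt i) (elt∈ i)))

      act-* : ∀ i j x → act (i * j) x ≡ act i (act j x)
      act-* i j x = trans (cong (λ σ → lookup σ x) (elt-* i j)) (∘ₚ-lookup (elt i) (elt j) x)

      act-e : ∀ x → act e x ≡ x
      act-e x = trans (cong (λ σ → lookup σ x) elt-e) (idₚ-lookup x)

      act-ext : ∀ {i j} → (∀ x → act i x ≡ act j x) → i ≡ j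
      act-ext h = elt-injective (map-ext h)

      *-assoc : ∀ i j k → (i * j) * k ≡ i * (j * k)
      *-assoc i j k = act-ext λ x → trans (act-* (i * j) k x) (trans (act-* i j _)
        (sym (trans (act-* i (j * k) x) (cong (act i) (act-* j k x)))))

      *-identityˡ : ∀ i → e * i ≡ i
      *-identityˡ i = act-ext λ x → trans (act-* e i x) (act-e _)

      *-identityʳ : ∀ i → i * e ≡ i
      *-identityʳ i = act-ext λ x → trans (act-* i e x) (cong (act i) (act-e x))

      *-inverseʳ : ∀ i → i * (i ⁻) ≡ e
      *-inverseʳ i = act-ext λ x → trans (act-* i (i ⁻) x) (trans (cong (act i) (cong (λ σ → lookup σ x) (elt-⁻ i)))
        (trans (inv-lookup (elt i) (perms (elt i) (elt∈ i)) x) (sym (act-e x))))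

      -- `inv` is known only as a right inverse. Applying it twice identifies `i` with the inverse
      -- of `i ⁻`.
      *-inverseˡ : ∀ i → (i ⁻) * i ≡ e
      *-inverseˡ i = trans (cong ((i ⁻) *_) i≡i⁻⁻) (*-inverseʳ (i ⁻))
        where
        i≡i⁻⁻ : i ≡ (i ⁻) ⁻
        i≡i⁻⁻ = trans (sym (*-identityʳ i)) (trans (cong (i *_) (sym (*-inverseʳ (i ⁻))))
          (trans (sym (*-assoc _ _ _)) (trans (cong (_* ((i ⁻) ⁻)) (*-inverseʳ i)) (*-identityˡ _))))

      group : FinGroup m
      group = record { _∙_ = _*_ ; ε = e ; _⁻¹ = _⁻ ; assoc = *-assoc ; identityˡ = *-identityˡ ; identityʳ = *-identityʳ
                     ; inverseˡ = *-inverseˡ ; inverseʳ = *-inverseʳ }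

      open FinGroup group

      index-of : ∀ {σ} → σ List∈.∈ G → ∃ λ i → elt i ≡ σ
      index-of h = index h , sym (lookup-index h)

      ≡ε : ∀ {i} → elt i ≡ idₚ → i ≡ ε
      ≡ε h = elt-injective (trans h (sym elt-e))

      act-⁻¹-cancel : ∀ g x → act (g ⁻¹) (act g x) ≡ x
      act-⁻¹-cancel g x = trans (sym (act-* (g ⁻¹) g x)) (trans (cong (λ i → act i x) (inverseˡ g)) (act-e x))

      act-cancel-⁻¹ : ∀ g x → act g (act (g ⁻¹) x) ≡ x
      act-cancel-⁻¹ g x = trans (sym (act-* g (g ⁻¹) x)) (trans (cong (λ i → act i x) (inverseʳ g)) (act-e x))

      act-^ : ∀ h g x → act (h ^ g) x ≡ act (g ⁻¹) (act h (act g x))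
      act-^ h g x = trans (act-* (g ⁻¹ ∙ h) g x) (act-* (g ⁻¹) h (act g x))

      module Subgroup (H : List (Map n)) (isH : IsSubgroup H G) where
        private module H = IsSubgroup isH
        open DecMembership _≟ₘ_ using () renaming (_∈?_ to _∈ᴸ?_)

        abstract
          member : Sub m
          member i = does (elt i ∈ᴸ? H)

          member-sound : ∀ {i} → i ∈ member → elt i List∈.∈ H
          member-sound {i} = does-sound (elt i ∈ᴸ? H)

          member-complete : ∀ {i} → elt i List∈.∈ H → i ∈ member
          member-complete {i} = dec-true (elt i ∈ᴸ? H)

        member-isSub : IsSub member
        member-isSub = record
          { ε∈ = member-complete (subst (List∈._∈ H) (sym elt-e) H.has-id)
          ; ∙∈ = λ {i} {j} hi hj → member-complete (subst (List∈._∈ H) (sym (elt-* i j))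
              (H.closed∘ (elt i) (elt j) (member-sound hi) (member-sound hj)))
          ; ⁻¹∈ = λ {i} hi → member-complete (subst (List∈._∈ H) (sym (elt-⁻ i))
              (H.closed⁻ (elt i) (member-sound hi))) }

        count-member : count member ≡ length H
        count-member = ℕₚ.≤-antisym
          (subst (count member ≤_) count-full (count-injection member (λ _ → true) position (λ _ _ → refl)
            (λ i j hi hj eq → elt-injective (trans (sym (position-correct (member-sound hi)))
                (trans (cong (List.lookup H) eq) (position-correct (member-sound hj)))))))
          (subst (_≤ count member) count-full (count-injection (λ _ → true) member embed
            (λ j _ → member-complete (subst (List∈._∈ H) (sym (embed-correct j)) (∈-lookup j)))
            (λ i j _ _ eq → unique-lookup H.unique i j
                (trans (sym (embed-correct i)) (trans (cong elt eq) (embed-correct j))))))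
          where
          embed : Fin (length H) → Fin m
          embed j = proj₁ (index-of (H.sub _ (∈-lookup j)))
          embed-correct : ∀ j → elt (embed j) ≡ List.lookup H j
          embed-correct j = proj₂ (index-of (H.sub _ (∈-lookup j)))
          position : Fin m → Fin (length H)
          position i with elt i ∈ᴸ? H
          ... | yes h = index h
          ... | no _ = index H.has-id
          position-correct : ∀ {i} → elt i List∈.∈ H → List.lookup H (position i) ≡ elt i
          position-correct {i} hi with elt i ∈ᴸ? H
          ... | yes h = sym (lookup-index h)
          ... | no n = contradiction hi n

      module Complement (H : List (Map n)) (isC : IsFrobeniusComplement G H) where
        open IsFrobeniusComplement isC
        open Subgroup H subgroup public

        malnormal : Malnormal member
        malnormal g h g∉ h∈ h^g∈ = ∙-cancelˡ (g ⁻¹) (trans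
          (trans (solveᴳ (g ∷ h ∷ []) (a₀ :⁻¹ :∙ a₁) (a₀ :⁻¹ :∙ a₁ :∙ a₀ :∙ a₀ :⁻¹) refl) (cong (_∙ g ⁻¹) h^g≡ε))
          (solveᴳ (g ∷ []) (:ε :∙ a₀ :⁻¹) (a₀ :⁻¹ :∙ :ε) refl))
          where
          h^g≡ε : h ^ g ≡ ε
          h^g≡ε = ≡ε (trivInt (elt g) (elt∈ g) (λ k → g∉ (member-complete k)) (elt (h ^ g)) (member-sound h^g∈)
            (elt h , member-sound h∈ , trans (elt-* (g ⁻¹ ∙ h) g)
                (cong (_∘ₚ elt g) (trans (elt-* (g ⁻¹) h) (cong (_∘ₚ elt h) (elt-⁻ g))))))

        member-nontrivial : ∃ λ i → i ∈ member × i ≢ ε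
        member-nontrivial =
          let σ , hσ , ne = nontrivial ; i , eq = index-of (IsSubgroup.sub subgroup σ hσ) in
          i , member-complete (subst (List∈._∈ H) (sym eq) hσ) , λ i≡ε → ne
              (trans (sym eq) (trans (cong elt i≡ε) elt-e))

        member-proper : ∃ λ i → i ∉ member
        member-proper = let σ , hσ , ∉H = proper ; i , eq = index-of hσ in
          i , λ h → ∉H (subst (List∈._∈ H) eq (member-sound h))

      module Frobenius (isF : IsFrobenius G) where
        open IsFrobenius isF

        x₀ : Fin n
        x₀ = proj₁ (proj₂ (proj₂ (proj₂ someFixes)))

        abstract
          stab : Sub m
          stab i = does (act i x₀ Fin.≟ x₀)

          stab-sound : ∀ {i} → i ∈ stab → act i x₀ ≡ x₀
          stab-sound {i} = does-sound (act i x₀ Fin.≟ x₀)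

          stab-complete : ∀ {i} → act i x₀ ≡ x₀ → i ∈ stab
          stab-complete {i} = dec-true (act i x₀ Fin.≟ x₀)

        stab-isSub : IsSub stab
        stab-isSub = record
          { ε∈ = stab-complete (act-e x₀)
          ; ∙∈ = λ {i} {j} hi hj → stab-complete
              (trans (act-* i j x₀) (trans (cong (act i) (stab-sound hj)) (stab-sound hi)))
          ; ⁻¹∈ = λ {i} hi → stab-complete (trans (cong (act (i ⁻¹)) (sym (stab-sound hi))) (act-⁻¹-cancel i x₀)) }

        stab-malnormal : Malnormal stab
        stab-malnormal g h g∉ h∈ h^g∈ = decidable-stable (h Fin.≟ ε) λ ne →
          g∉ (stab-complete (atMostOne (elt h) (elt∈ h) (ne ∘ ≡ε) (act g x₀) x₀
            (trans (sym (act-cancel-⁻¹ g _)) (cong (act g) (trans (sym (act-^ h g x₀)) (stab-sound h^g∈))))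
                (stab-sound h∈)))

        transitiveᴵ : ∀ x y → ∃ λ i → act i x ≡ y
        transitiveᴵ x y = let σ , hσ , eq = transitive x y ; i , eqᵢ = index-of hσ in
          i , trans (cong (λ τ → lookup τ x) eqᵢ) eq

        stab-nontrivial : ∃ λ i → i ∈ stab × i ≢ ε
        stab-nontrivial = let σ , hσ , ne , _ , fix = someFixes ; i , eq = index-of hσ in
          i , stab-complete (trans (cong (λ τ → lookup τ x₀) eq) fix) , λ i≡ε → ne
              (trans (sym eq) (trans (cong elt i≡ε) elt-e))

        -- If all of `G` fixed `x₀`, transitivity would make `x₀` the only point, and then all
        -- elements of `G` would coincide.
        stab-proper : ∃ λ i → i ∉ stab
        stab-proper with Finₚ.any? (λ i → ¬? (i ∈? stab))
        ... | yes f = f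
        ... | no none = let i , _ , i≢ε = stab-nontrivial in
            contradiction (act-ext λ x → trans (only (act i x)) (sym (only (act ε x)))) i≢ε
          where
          only : ∀ x → x ≡ x₀
          only x = let g , eq = transitiveᴵ x₀ x in
            trans (sym eq) (stab-sound (decidable-stable (g ∈? stab) λ k → none (g , k)))

        ∣stab∣*n : n Data.Nat.* count stab ≡ m
        ∣stab∣*n = begin
          n Data.Nat.* count stab                    ≡⟨ cong₂ Data.Nat._*_ (sym count-full)
              (count-cong (λ i h → dec-true (act i x₀ Fin.≟ x₀) (stab-sound h))
                  (λ i h → stab-complete (does-sound (act i x₀ Fin.≟ x₀) h))) ⟩
          count {n} (λ _ → true) Data.Nat.* count (stabiliser x₀)
            ≡⟨ cong (Data.Nat._* count (stabiliser x₀)) (count-cong (λ y _ → dec-true (orbit? x₀ y)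
                 (let g , eq = transitiveᴵ x₀ y in g , refl , dec-true (act g x₀ Fin.≟ y) eq)) (λ _ _ → refl)) ⟩
          count (orbit x₀) Data.Nat.* count (stabiliser x₀)
            ≡⟨ orbit-stabiliser x₀ 1 (λ g _ → Orbits.count-same group (act g x₀)) ⟩
          count full Data.Nat.* 1                    ≡⟨ trans (ℕₚ.*-identityʳ _) count-full ⟩
          m                                          ∎
          where
          open ≡-Reasoning
          open Orbits.PointAction group act act-e act-* full-isSub

        open Kernels.Kernel group stab-isSub stab-malnormal
        private module K = IsSub K-isSub

        ∣K∣≡n : count K ≡ n
        ∣K∣≡n = ℕₚ.*-cancelʳ-≡ _ _ (count stab) {{>-nonZero (count-pos (IsSub.ε∈ stab-isSub))}}
          (trans (Orders.∣K∣*∣H∣ group stab-isSub stab-malnormal) (sym ∣stab∣*n))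

        fixes∧K⇒ε : ∀ {k x} → k ∈ K → act k x ≡ x → k ≡ ε
        fixes∧K⇒ε {k} {x} hk fix with K-sound hk
        ... | inj₁ k≡ε = k≡ε
        ... | inj₂ none = let a , eq = transitiveᴵ x₀ x in
          contradiction (stab-complete
              (trans (act-^ k a x₀) (trans (cong (act (a ⁻¹)) (trans (cong (act k) eq) (trans fix (sym eq))))
                  (act-⁻¹-cancel a x₀)))) (none a)

        derangement⇒K : ∀ {k} → (∀ x → act k x ≢ x) → k ∈ K
        derangement⇒K {k} der = K-complete (inj₂ λ a h → der (act a x₀)
          (trans (sym (act-cancel-⁻¹ a _)) (cong (act a) (trans (sym (act-^ k a x₀)) (stab-sound h)))))

        abstract
          -- Only `ε` in `K` has a fixed point, so elements of `K` are determined by the image of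
          -- `x₀`; as `K` has order `n`, every point is reached and `K` is regular.
          K-onto : ∀ y → ∃ λ k → k ∈ K × act k x₀ ≡ y
          K-onto y = injection⇒surjection K (λ _ → true) (λ k → act k x₀) (λ _ _ → refl)
            (λ k k′ hk hk′ eq → sym (trans (sym (⁻¹-involutive k′)) (sym (inverse-unique (k′ ⁻¹) k
              (fixes∧K⇒ε (K.∙∈ (K.⁻¹∈ hk′) hk)
                  (trans (act-* (k′ ⁻¹) k x₀) (trans (cong (act (k′ ⁻¹)) eq) (act-⁻¹-cancel k′ x₀))))))))
            (ℕₚ.≤-reflexive (trans count-full (sym ∣K∣≡n))) y refl

        -- Removes the factor from `K` that moves `x₀` like `i` does. What remains fixes `x₀` and
        -- depends only on the coset of `K`, so the point stabiliser labels these cosets.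
        rep : Fin m → Fin m
        rep i = proj₁ (K-onto (act i x₀)) ⁻¹ ∙ i

        rep∈ : ∀ i → rep i ∈ stab
        rep∈ i = let k , _ , eq = K-onto (act i x₀) in
          stab-complete (trans (act-* (k ⁻¹) i x₀) (trans (cong (act (k ⁻¹)) (sym eq)) (act-⁻¹-cancel k x₀)))

        rep-≡⇒K : ∀ i j → rep i ≡ rep j → i ∙ j ⁻¹ ∈ K
        rep-≡⇒K i j eq = subst (_∈ K) same (K.∙∈ hk (K.⁻¹∈ hk′))
          where
          k = proj₁ (K-onto (act i x₀))
          k′ = proj₁ (K-onto (act j x₀))
          hk = proj₁ (proj₂ (K-onto (act i x₀)))
          hk′ = proj₁ (proj₂ (K-onto (act j x₀)))
          same : k ∙ k′ ⁻¹ ≡ i ∙ j ⁻¹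
          same = trans (solveᴳ (k ∷ k′ ∷ j ∷ []) (a₀ :∙ a₁ :⁻¹) (a₀ :∙ (a₁ :⁻¹ :∙ a₂) :∙ a₂ :⁻¹) refl)
            (trans (cong (λ t → k ∙ t ∙ j ⁻¹) (sym eq)) (solveᴳ (k ∷ i ∷ j ∷ []) (a₀ :∙ (a₀ :⁻¹ :∙ a₁) :∙ a₂ :⁻¹)
                (a₁ :∙ a₂ :⁻¹) refl))

        K⇒rep-≡ : ∀ i j → i ∙ j ⁻¹ ∈ K → rep i ≡ rep j
        K⇒rep-≡ i j h = Conjugation.∙⁻¹≡ε⇒≡ group (K∩H
          (subst (_∈ K) (solveᴳ (k ∷ k′ ∷ i ∷ j ∷ []) (a₀ :⁻¹ :∙ (a₂ :∙ a₃ :⁻¹) :∙ a₁)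
              ((a₀ :⁻¹ :∙ a₂) :∙ (a₁ :⁻¹ :∙ a₃) :⁻¹) refl)
            (K.∙∈ (K.∙∈ (K.⁻¹∈ hk) h) hk′))
          (IsSub.∙∈ stab-isSub (rep∈ i) (IsSub.⁻¹∈ stab-isSub (rep∈ j))))
          where
          k = proj₁ (K-onto (act i x₀))
          k′ = proj₁ (K-onto (act j x₀))
          hk = proj₁ (proj₂ (K-onto (act i x₀)))
          hk′ = proj₁ (proj₂ (K-onto (act j x₀)))

        module _ {c : ℕ} (∣stab∣ : count stab ≡ c) where

          component : Fin m → Fin c
          component i = fromℕ< (subst (rank stab (rep i) <_) ∣stab∣ (rank-< stab (rep i) (rep∈ i)))

          component-≡⇒K : ∀ i j → component i ≡ component j → i ∙ j ⁻¹ ∈ K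
          component-≡⇒K i j eq = rep-≡⇒K i j (rank-injective stab _ _ (rep∈ i) (rep∈ j)
              (Finₚ.fromℕ<-injective _ _ _ _ eq))

          K⇒component-≡ : ∀ i j → i ∙ j ⁻¹ ∈ K → component i ≡ component j
          K⇒component-≡ i j h = Finₚ.fromℕ<-cong _ _ (cong (rank stab) (K⇒rep-≡ i j h)) _ _

          -- The first entry is the coset of `K`; within a coset, regularity of `K` lets the image
          -- of `x₀` tell the elements apart.
          coordinates : Fin m → Fin c × Fin n
          coordinates i = component i , act i x₀

          quotient-fixes : ∀ i j → act i x₀ ≡ act j x₀ → act (i ∙ j ⁻¹) (act j x₀) ≡ act j x₀
          quotient-fixes i j eq = trans (act-* i (j ⁻¹) _) (trans (cong (act i) (act-⁻¹-cancel j x₀)) eq)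

          coordinates-injective : ∀ {i j} → coordinates i ≡ coordinates j → i ≡ j
          coordinates-injective {i} {j} eq = Conjugation.∙⁻¹≡ε⇒≡ group (fixes∧K⇒ε
            (component-≡⇒K i j (cong proj₁ eq)) (quotient-fixes i j (cong proj₂ eq)))

          coordinates-surjective : ∀ y → ∃ λ i → coordinates i ≡ y
          coordinates-surjective (a , b) =
            let i , _ , eq = injection⇒surjection (λ _ → true) (λ _ → true) code (λ _ _ → refl)
                  (λ i j _ _ eq → coordinates-injective (decode eq)) (ℕₚ.≤-reflexive sizes) (combine a b) refl in
            i , decode eq
            where
            code : Fin m → Fin (c Data.Nat.* n)
            code i = combine (component i) (act i x₀)
            decode : ∀ {i} {a : Fin c} {b : Fin n} → code i ≡ combine a b → coordinates i ≡ (a , b)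
            decode {i} {a} {b} eq = let e₁ , e₂ = Finₚ.combine-injective (component i) (act i x₀) a b eq in cong₂ _,_ e₁ e₂
            sizes : count {c Data.Nat.* n} (λ _ → true) ≡ count {m} (λ _ → true)
            sizes = trans count-full (trans (ℕₚ.*-comm c n) (trans (cong (n Data.Nat.*_) (sym ∣stab∣))
                (trans ∣stab∣*n (sym count-full))))

          bijection : Fin m ⤖ (Fin c × Fin n)
          bijection = mk⤖ (coordinates-injective , λ y → let i , eq = coordinates-surjective y in i , λ { refl → eq })

          adjacency : ∀ i j → DerAdj (elt i) (elt j) ⇔ CopiesAdj (coordinates i) (coordinates j)
          adjacency i j = mk⇔
            (λ der → let der′ = λ x → subst (λ σ → lookup σ x ≢ x) (sym quotient) (der x) in
              K⇒component-≡ i j (derangement⇒K der′) , λ eq → der′ (act j x₀) (quotient-fixes i j eq))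
            (λ (eq , ne) x fix → ne (cong (λ k → act k x₀) (Conjugation.∙⁻¹≡ε⇒≡ group
              (fixes∧K⇒ε (component-≡⇒K i j eq) (subst (λ σ → lookup σ x ≡ x) (sym quotient) fix)))))
            where
            quotient : elt (i ∙ j ⁻¹) ≡ elt i ∘ₚ inv (elt j)
            quotient = trans (elt-* i (j ⁻¹)) (cong (elt i ∘ₚ_) (elt-⁻ j))

open PermutationGroups
open Counting using (count)
open import Defs
open import Data.List using (List; length; lookup)
open import Function.Bundles using (_⤖_; _⇔_; Bijection)

theorem5p10 : (n : ℕ) (G H : List (Map n)) → IsPermGroup G → IsFrobenius G →
    IsFrobeniusComplement G H →
    Σ (Fin (length G) ⤖ (Fin (length H) × Fin n)) λ φ →
    ∀ i j → DerAdj (lookup G i) (lookup G j) ⇔ CopiesAdj (Bijection.to φ i) (Bijection.to φ j)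
theorem5p10 n G H isG isF isC = bijection ∣stab∣ , adjacency ∣stab∣
  where
  open PermGroup G isG
  open Frobenius isF
  module C = Complement H isC
  -- The components are labelled by the stabiliser of `x₀`; equality of orders transfers the labels
  -- to the given complement.
  ∣stab∣ : count stab ≡ length H
  ∣stab∣ = trans (sym (Orders.complements-equinumerous group C.member-isSub C.malnormal stab-isSub stab-malnormal
    C.member-nontrivial C.member-proper stab-nontrivial stab-proper)) C.count-member
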